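{- For every $n \ge 1$, the polynomial $f^+_n(x)$ is equal to the local $h$-polynomial $\ell_{[n]}(K_n, x)$ of the simplicial subdivision $K_n$ of the simplex $2^{[n]}$. In particular, $f^+_n$ has nonnegative, symmetric and unimodal coefficients. Moreover, for every $n \in \mathbb{N}$, $$ f^+_n(x) = \sum_{k=0}^n (-1)^{n-k} \binom{n}{k} B^+_k(x) \quad\text{and}\quad f^-_n(x) = \sum_{k=0}^n (-1)^{n-k} \binom{n}{k} B^-_k(x). $$
   Context: Signed permutations: a signed permutation of $[n]$ is a set $S = \{a_1, \dots, a_n\}$ with $a_i \in \{i, -i\}$, together with a bijection $w : S \to S$, written as the word $w(a_1) \cdots w(a_n)$. The set of these is $B_n$. - An index $i \in \{0, \dots, n-1\}$ is a $B$-descent if $w(a_i) > w(a_{i+1})$, with the convention $w(a_0) = 0$; $\mathrm{des}_B(w)$ is the number of $B$-descents. - $B^+_n$ (resp. $B^-_n$) is the set of $w \in B_n$ with $w(a_n) > 0$ (resp. $< 0$). - $B^\pm_n(x) = \sum_{w \in B^\pm_n} x^{\mathrm{des}_B(w)}$, with $B^+_0(x) = 1$ and $B^-_0(x) = 0$. - $a \in S$ is a $B$-excedance if $w(a) > a$, or if $a < 0$ and $w(a) = a$. - $w$ is a derangement if no $a \in S$ with $a > 0$ satisfies $w(a) = a$. - $d^B_n(x) = \sum_{w \text{ derangement}} x^{\mathrm{exc}_B(w)}$, with $d^B_0 = 1$. - $f^+_n, f^-_n$ are the unique real polynomials with $d^B_n = f^+_n + f^-_n$, $f^+_n(x) = x^n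 f^+_n(1/x)$ and $f^-_n(x) = x^{n+1} f^-_n(1/x)$. Face enumeration: for a simplicial complex $\Delta$ of dimension $d-1$, the $h$-polynomial is $h(\Delta, x) = \sum_{F \in \Delta} x^{|F|} (1-x)^{d-|F|}$. Subdivisions: a simplicial subdivision of the simplex $2^V$ (with $|V| = d$) is a simplicial complex $\Gamma$ with a map $\sigma : \Gamma \to 2^V$ such that, for every $F \subseteq V$, the restriction $\Gamma_F = \sigma^{ -1}(2^F)$ is a subcomplex homeomorphic to a ball of dimension $|F|-1$ whose interior is $\sigma^{ -1}(F)$. Its local $h$-polynomial is $$ \ell_V(\Gamma, x) = \sum_{F \subseteq V} (-1)^{d-|F|}\, h(\Gamma_F, x). $$ $K_n$: let $P$ be the set of intervals $[A, B]$ with $\emptyset \ne A \subseteq B \subseteq [n]$ (intervals in the Boolean lattice), ordered by inclusion: $[A, B] \le [A', B']$ iff $A' \subseteq A$ and $B \subseteq B'$. $K_n$ is the order complex of $P$, i.e. the simplicial complex of chains of $P$. It is a simplicial subdivision of $2^{[n]}$ via the carrier map sending a nonempty chain to the set $B$ of its largest element $[A, B]$, and the empty chain to $\emptyset$. -}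

module Defs where

open import Level using (0ℓ)
open import Data.Nat as ℕ using (ℕ; zero; suc; _∸_; _⊔_; z≤n; s≤s)
import Data.Nat.Properties as ℕₚ
open import Data.Nat.Combinatorics using (_C_)
open import Data.Integer as ℤ using (ℤ; +_; -[1+_]; 0ℤ; 1ℤ; -1ℤ; _◃_)
import Data.Integer.Properties as ℤₚ
import Algebra.Properties.AbelianGroup ℤₚ.+-0-abelianGroup as ℤ-Group
open import Data.Integer.Tactic.RingSolver using (solve-∀)
open import Data.Sign using (Sign)
open import Data.Bool.Properties using () renaming (_≟_ to _≟ᵇ_)
open import Data.Empty using (⊥; ⊥-elim)
open import Data.Fin as Fin using (Fin; toℕ; inject₁)
import Data.Fin.Properties as Finₚ
open import Data.Fin.Subset as Subset using (Subset; Nonempty; inside; outside; ∣_∣)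
import Data.Fin.Subset.Properties as Subsetₚ
open import Data.Vec as Vec using (Vec)
import Data.Vec.Properties as Vecₚ
open import Data.List
  using (List; []; _∷_; _++_; map; foldr; filter; length; head; replicate;
         upTo; applyUpTo; allFin; cartesianProduct; cartesianProductWith)
import Data.List.Properties as Listₚ
open import Data.List.Membership.Propositional using (_∈_)
open import Data.List.Membership.Propositional.Properties using (∈-filter⁺; ∈-filter⁻)
open import Data.List.Relation.Unary.All as All using (All; []; _∷_)
open import Data.List.Relation.Unary.Any using (here; there)
open import Data.List.Relation.Unary.AllPairs using (AllPairs; []; _∷_; allPairs?)
open import Data.List.Relation.Unary.Unique.Propositional using (Unique)
import Data.List.Relation.Unary.Unique.Propositional.Properties as Uniqueₚ
open import Data.List.Relation.Binary.Sublist.Propositional using (_⊆_; []; _∷_; _∷ʳ_)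
import Data.List.Relation.Binary.Sublist.Propositional as Sublist
import Data.List.Relation.Binary.Sublist.Propositional.Properties as Sublistₚ
open import Data.Maybe using (Maybe; just; nothing; maybe′)
open import Data.Product using (∃-syntax; _×_; _,_; proj₁; proj₂)
open import Data.Product.Properties using (≡-dec)
open import Data.Sum using (_⊎_; inj₁; inj₂)
open import Function using (_∘_)
open import Function.Definitions using (Bijective)
open import Relation.Binary using (Rel; IsDecPartialOrder)
open import Relation.Binary.PropositionalEquality
open import Relation.Nullary using (¬_; ¬?; _×-dec_; _⊎-dec_; _→-dec_; map′)
open import Relation.Unary using (Pred; Decidable)

-- A polynomial is the list of its coefficients, constant term first;
-- trailing zeros are allowed, so equality is _≈_ and not _≡_.
Poly : Set
Poly = List ℤ

coeff : Poly → ℕ → ℤ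
coeff []      _       = 0ℤ
coeff (a ∷ p) zero    = a
coeff (a ∷ p) (suc i) = coeff p i

infix 4 _≈_
_≈_ : Poly → Poly → Set
p ≈ q = ∀ i → coeff p i ≡ coeff q i

infixl 6 _⊕_
infixl 7 _⊗_ _·_
infixr 8 _^ₚ_

_⊕_ : Poly → Poly → Poly
[]      ⊕ q       = q
(a ∷ p) ⊕ []      = a ∷ p
(a ∷ p) ⊕ (b ∷ q) = (a ℤ.+ b) ∷ (p ⊕ q)

_·_ : ℤ → Poly → Poly
c · p = map (c ℤ.*_) p

_⊗_ : Poly → Poly → Poly
[]      ⊗ q = []
(a ∷ p) ⊗ q = (a · q) ⊕ (0ℤ ∷ (p ⊗ q))

_^ₚ_ : Poly → ℕ → Poly
p ^ₚ zero  = 1ℤ ∷ []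
p ^ₚ suc n = p ⊗ (p ^ₚ n)

X^_ : ℕ → Poly
X^ k = replicate k 0ℤ ++ (1ℤ ∷ [])

1-X : Poly
1-X = 1ℤ ∷ -1ℤ ∷ []

∑ : {A : Set} → List A → (A → Poly) → Poly
∑ xs f = foldr (λ a p → f a ⊕ p) [] xs

-- coefficients of a polynomial regarded as a Laurent polynomial
coeffᶻ : Poly → ℤ → ℤ
coeffᶻ p (+ i)    = coeff p i
coeffᶻ p -[1+ _ ] = 0ℤ

-- p(x) = xⁿ p(1/x), as an identity of Laurent polynomials
Symmetric : ℕ → Poly → Set
Symmetric n p = ∀ k → coeffᶻ p k ≡ coeffᶻ p (+ n ℤ.- k)

Nonneg : Poly → Set
Nonneg p = ∀ i → 0ℤ ℤ.≤ coeff p i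

-- The zeros following the leading coefficient are included in the sequence;
-- this makes no difference for polynomials with nonnegative coefficients.
Unimodal : Poly → Set
Unimodal p = ∃[ m ] (∀ i → i ℕ.< m → coeff p i ℤ.≤ coeff p (suc i))
                  × (∀ i → m ℕ.≤ i → coeff p (suc i) ℤ.≤ coeff p i)

allVecs : {A : Set} → List A → (n : ℕ) → List (Vec A n)
allVecs as zero    = Vec.[] ∷ []
allVecs as (suc n) = cartesianProductWith Vec._∷_ as (allVecs as n)

-- The index i : Fin n stands for i + 1 ∈ [n].  The first component lists the
-- signs of a₁, …, aₙ; the second is the self-map π of the indices such that
-- w(aᵢ) = a_{π(i)}.  Since S = {a₁, …, aₙ} is indexed by [n], the map w is a
-- bijection S → S iff π is one.
SignedMap : ℕ → Set
SignedMap n = Vec Sign n × Vec (Fin n) n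

elt : ∀ {n} → SignedMap n → Fin n → ℤ
elt (s , _) i = Vec.lookup s i ◃ suc (toℕ i)

val : ∀ {n} → SignedMap n → Fin n → ℤ
val w@(_ , π) i = elt w (Vec.lookup π i)

IsPerm : ∀ {n} → SignedMap n → Set
IsPerm (_ , π) = Bijective _≡_ _≡_ (Vec.lookup π)

isPerm? : ∀ {n} → Decidable (IsPerm {n})
isPerm? (_ , π) = inj? ×-dec surj?
  where
  inj? = map′ (λ f {i} {j} → f i j) (λ f i j → f {i} {j})
    (Finₚ.all? λ i → Finₚ.all? λ j →
      (Vec.lookup π i Fin.≟ Vec.lookup π j) →-dec (i Fin.≟ j))
  surj? = map′ (λ f j → proj₁ (f j) , λ { refl → proj₂ (f j) })
               (λ f j → proj₁ (f j) , proj₂ (f j) refl)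
    (Finₚ.all? λ j → Finₚ.any? λ i → Vec.lookup π i Fin.≟ j)

signedPerms : (n : ℕ) → List (SignedMap n)
signedPerms n =
  filter isPerm? (cartesianProduct (allVecs (Sign.+ ∷ Sign.- ∷ []) n) (allVecs (allFin n) n))

-- w(a₀) w(a₁) ⋯ w(aₙ), where w(a₀) = 0
word₀ : ∀ {n} → SignedMap n → Vec ℤ (suc n)
word₀ w = 0ℤ Vec.∷ Vec.tabulate (val w)

-- i : Fin n runs over the positions 0, …, n - 1 of word₀ w.
desB : ∀ {n} → SignedMap n → ℕ
desB {n} w = length (filter
  (λ i → Vec.lookup (word₀ w) (Fin.suc i) ℤₚ.<? Vec.lookup (word₀ w) (inject₁ i))
  (allFin n))

Excedance : ∀ {n} → SignedMap n → Fin n → Set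
Excedance w i = elt w i ℤ.< val w i ⊎ (elt w i ℤ.< 0ℤ × val w i ≡ elt w i)

excedance? : ∀ {n} (w : SignedMap n) → Decidable (Excedance w)
excedance? w i =
  (elt w i ℤₚ.<? val w i) ⊎-dec ((elt w i ℤₚ.<? 0ℤ) ×-dec (val w i ℤₚ.≟ elt w i))

excB : ∀ {n} → SignedMap n → ℕ
excB {n} w = length (filter (excedance? w) (allFin n))

Derangement : ∀ {n} → SignedMap n → Set
Derangement w = ¬ (∃[ i ] (0ℤ ℤ.< elt w i × val w i ≡ elt w i))

derangement? : ∀ {n} → Decidable (Derangement {n})
derangement? w = ¬? (Finₚ.any? λ i → (0ℤ ℤₚ.<? elt w i) ×-dec (val w i ℤₚ.≟ elt w i))

dB : ℕ → Poly
dB n = ∑ (filter derangement? (signedPerms n)) (λ w → X^ excB w)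

B⁺ : ℕ → Poly
B⁺ zero      = 1ℤ ∷ []
B⁺ n@(suc m) =
  ∑ (filter (λ w → 0ℤ ℤₚ.<? val w (Fin.fromℕ m)) (signedPerms n)) (λ w → X^ desB w)

B⁻ : ℕ → Poly
B⁻ zero      = []
B⁻ n@(suc m) =
  ∑ (filter (λ w → val w (Fin.fromℕ m) ℤₚ.<? 0ℤ) (signedPerms n)) (λ w → X^ desB w)

-- Σ_{k=0}^n (-1)^{n-k} C(n,k) F_k
binomialTransform : (ℕ → Poly) → ℕ → Poly
binomialTransform F n =
  ∑ (upTo (suc n)) (λ k → ((-1ℤ ℤ.^ (n ∸ k)) ℤ.* (+ (n C k))) · F k)

IsSymmetricDecomposition : ℕ → Poly → Poly → Poly → Set
IsSymmetricDecomposition n p f⁺ f⁻ =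
  p ≈ f⁺ ⊕ f⁻ × Symmetric n f⁺ × Symmetric (suc n) f⁻

coeff-⊕ : ∀ p q i → coeff (p ⊕ q) i ≡ coeff p i ℤ.+ coeff q i
coeff-⊕ []      q       i       = sym (ℤₚ.+-identityˡ _)
coeff-⊕ (a ∷ p) []      i       = sym (ℤₚ.+-identityʳ _)
coeff-⊕ (a ∷ p) (b ∷ q) zero    = refl
coeff-⊕ (a ∷ p) (b ∷ q) (suc i) = coeff-⊕ p q i

private

  coeff-∑-zero : {A : Set} (xs : List A) (f : A → Poly) (i : ℕ) →
                 (∀ a → coeff (f a) i ≡ 0ℤ) → coeff (∑ xs f) i ≡ 0ℤ
  coeff-∑-zero []       f i f≡0 = refl
  coeff-∑-zero (a ∷ as) f i f≡0 =
    trans (coeff-⊕ (f a) _ i) (cong₂ ℤ._+_ (f≡0 a) (coeff-∑-zero as f i f≡0))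

  coeff-X^-> : ∀ k i → k ℕ.< i → coeff (X^ k) i ≡ 0ℤ
  coeff-X^-> zero    (suc i) _         = refl
  coeff-X^-> (suc k) (suc i) (s≤s k<i) = coeff-X^-> k i k<i

  excB≤ : ∀ {n} (w : SignedMap n) → excB w ℕ.≤ n
  excB≤ {n} w = ℕₚ.≤-trans (Listₚ.length-filter (excedance? w) (allFin n))
                           (ℕₚ.≤-reflexive (Listₚ.length-tabulate {n = n} (λ i → i)))

  dB-> : ∀ n i → n ℕ.< i → coeff (dB n) i ≡ 0ℤ
  dB-> n i n<i = coeff-∑-zero (filter derangement? (signedPerms n)) _ i
    (λ w → coeff-X^-> (excB w) i (ℕₚ.≤-<-trans (excB≤ w) n<i))

  ≤-sub : ∀ {n i} → i ℕ.≤ n → + n ℤ.- + i ≡ + (n ∸ i)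
  ≤-sub {n} {i} i≤n = trans (ℤₚ.[+m]-[+n]≡m⊖n n i) (ℤₚ.⊖-≥ i≤n)

  >-sub : ∀ {n i} → n ℕ.< i → ∃[ j ] + n ℤ.- + i ≡ -[1+ j ]
  >-sub {n} {i} n<i = i ∸ suc n ,
    trans (ℤₚ.[+m]-[+n]≡m⊖n n i)
    (trans (ℤₚ.⊖-< n<i) (cong (λ m → ℤ.- (+ m)) (ℕₚ.+-∸-assoc 1 n<i)))

  sym-≤ : ∀ {n p} → Symmetric n p → ∀ i → i ℕ.≤ n → coeff p i ≡ coeff p (n ∸ i)
  sym-≤ {p = p} s i i≤n = trans (s (+ i)) (cong (coeffᶻ p) (≤-sub i≤n))

  sym-> : ∀ {n p} → Symmetric n p → ∀ i → n ℕ.< i → coeff p i ≡ 0ℤ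
  sym-> {p = p} s i n<i = trans (s (+ i)) (cong (coeffᶻ p) (proj₂ (>-sub n<i)))

  mkSym : ∀ {n} p → (∀ i → i ℕ.≤ n → coeff p i ≡ coeff p (n ∸ i)) →
          (∀ i → n ℕ.< i → coeff p i ≡ 0ℤ) → Symmetric n p
  mkSym {n} p s z (+ i) with ℕₚ.≤-<-connex i n
  ... | inj₁ i≤n = trans (s i i≤n) (cong (coeffᶻ p) (sym (≤-sub i≤n)))
  ... | inj₂ n<i = trans (z i n<i) (cong (coeffᶻ p) (sym (proj₂ (>-sub n<i))))
  mkSym {n} p s z -[1+ j ] = sym (z (n ℕ.+ suc j) (ℕₚ.m<m+n n (s≤s z≤n)))

  coeff-applyUpTo-< : ∀ (f : ℕ → ℤ) n i → i ℕ.< n → coeff (applyUpTo f n) i ≡ f i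
  coeff-applyUpTo-< f (suc n) zero    _         = refl
  coeff-applyUpTo-< f (suc n) (suc i) (s≤s i<n) = coeff-applyUpTo-< (f ∘ suc) n i i<n

  coeff-applyUpTo-≥ : ∀ (f : ℕ → ℤ) n i → n ℕ.≤ i → coeff (applyUpTo f n) i ≡ 0ℤ
  coeff-applyUpTo-≥ f zero    i       _         = refl
  coeff-applyUpTo-≥ f (suc n) (suc i) (s≤s n≤i) = coeff-applyUpTo-≥ (f ∘ suc) n i n≤i

  -- With partial sums D i = Σ_{j<i} dⱼ and E i = Σ_{j<i} d_{n-j}, the coefficients
  -- are f⁺ᵢ = D (i + 1) - E i and f⁻ᵢ = E i - D i.
  module Existence (n : ℕ) (p : Poly) (deg : ∀ i → n ℕ.< i → coeff p i ≡ 0ℤ) where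

    D E : ℕ → ℤ
    D zero    = 0ℤ
    D (suc i) = D i ℤ.+ coeff p i
    E zero    = 0ℤ
    E (suc i) = E i ℤ.+ coeff p (n ∸ i)

    T : ℤ
    T = D (suc n)

    D+E : ∀ i → i ℕ.≤ suc n → D (suc n ∸ i) ℤ.+ E i ≡ T
    D+E zero    _           = ℤₚ.+-identityʳ _
    D+E (suc i) (s≤s i≤n) = trans
      (swap (D (n ∸ i)) (E i) (coeff p (n ∸ i)))
      (trans (cong (λ m → D m ℤ.+ E i) (sym (ℕₚ.+-∸-assoc 1 i≤n)))
             (D+E i (ℕₚ.m≤n⇒m≤1+n i≤n)))
      where
      swap : ∀ a b c → a ℤ.+ (b ℤ.+ c) ≡ (a ℤ.+ c) ℤ.+ b
      swap = solve-∀

    φ⁺ φ⁻ : ℕ → ℤ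
    φ⁺ i = D (suc i) ℤ.- E i
    φ⁻ i = E i ℤ.- D i

    g⁺ g⁻ : Poly
    g⁺ = applyUpTo φ⁺ (suc n)
    g⁻ = applyUpTo φ⁻ (suc (suc n))

    cross : ∀ a b c d t → a ℤ.+ b ≡ t → c ℤ.+ d ≡ t → c ℤ.- b ≡ a ℤ.- d
    cross a b c d t e₁ e₂ = ℤₚ.m-n≡0⇒m≡n _ _ (begin
      (c ℤ.- b) ℤ.- (a ℤ.- d) ≡⟨ lem a b c d ⟩
      (c ℤ.+ d) ℤ.- (a ℤ.+ b) ≡⟨ cong₂ ℤ._-_ e₂ e₁ ⟩
      t ℤ.- t                 ≡⟨ ℤₚ.+-inverseʳ t ⟩
      0ℤ                      ∎)
      where
      open ≡-Reasoning
      lem : ∀ a b c d → (c ℤ.- b) ℤ.- (a ℤ.- d) ≡ (c ℤ.+ d) ℤ.- (a ℤ.+ b)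
      lem = solve-∀

    φ⁺-sym : ∀ i → i ℕ.≤ n → φ⁺ i ≡ φ⁺ (n ∸ i)
    φ⁺-sym i i≤n = cross (D (suc (n ∸ i))) (E i) (D (suc i)) (E (n ∸ i)) T
      (trans (cong (λ m → D m ℤ.+ E i) (sym (ℕₚ.+-∸-assoc 1 i≤n)))
             (D+E i (ℕₚ.m≤n⇒m≤1+n i≤n)))
      (trans (cong (λ m → D m ℤ.+ E (n ∸ i))
               (trans (cong suc (sym (ℕₚ.m∸[m∸n]≡n i≤n)))
                      (sym (ℕₚ.+-∸-assoc 1 (ℕₚ.m∸n≤m n i)))))
             (D+E (n ∸ i) (ℕₚ.m≤n⇒m≤1+n (ℕₚ.m∸n≤m n i))))

    φ⁻-sym : ∀ i → i ℕ.≤ suc n → φ⁻ i ≡ φ⁻ (suc n ∸ i)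
    φ⁻-sym i i≤1+n = cross (E j) (D i) (E i) (D j) T
      (trans (ℤₚ.+-comm (E j) (D i))
        (trans (cong (λ m → D m ℤ.+ E j) (sym (ℕₚ.m∸[m∸n]≡n i≤1+n)))
               (D+E j (ℕₚ.m∸n≤m (suc n) i))))
      (trans (ℤₚ.+-comm (E i) (D j)) (D+E i i≤1+n))
      where j = suc n ∸ i

    g⁺-≤ : ∀ i → i ℕ.≤ n → coeff g⁺ i ≡ φ⁺ i
    g⁺-≤ i i≤n = coeff-applyUpTo-< φ⁺ (suc n) i (s≤s i≤n)

    g⁻-≤ : ∀ i → i ℕ.≤ suc n → coeff g⁻ i ≡ φ⁻ i
    g⁻-≤ i i≤n = coeff-applyUpTo-< φ⁻ (suc (suc n)) i (s≤s i≤n)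

    g⁺-> : ∀ i → n ℕ.< i → coeff g⁺ i ≡ 0ℤ
    g⁺-> = coeff-applyUpTo-≥ φ⁺ (suc n)

    g⁻-> : ∀ i → suc n ℕ.< i → coeff g⁻ i ≡ 0ℤ
    g⁻-> = coeff-applyUpTo-≥ φ⁻ (suc (suc n))

    φ⁻-end : φ⁻ (suc n) ≡ 0ℤ
    φ⁻-end = trans (φ⁻-sym (suc n) ℕₚ.≤-refl)
                   (cong φ⁻ (ℕₚ.n∸n≡0 n))

    sum-eq : ∀ i → coeff p i ≡ coeff g⁺ i ℤ.+ coeff g⁻ i
    sum-eq i with ℕₚ.≤-<-connex i n
    ... | inj₁ i≤n = sym (trans
      (cong₂ ℤ._+_ (g⁺-≤ i i≤n) (g⁻-≤ i (ℕₚ.m≤n⇒m≤1+n i≤n)))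
      (telescope (D i) (coeff p i) (E i)))
      where
      telescope : ∀ d c e → ((d ℤ.+ c) ℤ.- e) ℤ.+ (e ℤ.- d) ≡ c
      telescope = solve-∀
    ... | inj₂ n<i = trans (deg i n<i) (sym (cong₂ ℤ._+_ (g⁺-> i n<i) g⁻≡0))
      where
      g⁻≡0 : coeff g⁻ i ≡ 0ℤ
      g⁻≡0 with ℕₚ.m≤n⇒m<n∨m≡n n<i
      ... | inj₁ 1+n<i = g⁻-> i 1+n<i
      ... | inj₂ refl  = trans (g⁻-≤ (suc n) ℕₚ.≤-refl) φ⁻-end

    decomposition : IsSymmetricDecomposition n p g⁺ g⁻
    decomposition =
        (λ i → trans (sum-eq i) (sym (coeff-⊕ g⁺ g⁻ i)))
      , mkSym g⁺ (λ i i≤n → trans (g⁺-≤ i i≤n)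
          (trans (φ⁺-sym i i≤n) (sym (g⁺-≤ (n ∸ i) (ℕₚ.m∸n≤m n i))))) g⁺->
      , mkSym g⁻ (λ i i≤n → trans (g⁻-≤ i i≤n)
          (trans (φ⁻-sym i i≤n) (sym (g⁻-≤ (suc n ∸ i) (ℕₚ.m∸n≤m (suc n) i))))) g⁻->

symmetricDecomposition-unique :
  ∀ {n p f⁺ f⁻ g⁺ g⁻} →
  IsSymmetricDecomposition n p f⁺ f⁻ → IsSymmetricDecomposition n p g⁺ g⁻ →
  f⁺ ≈ g⁺ × f⁻ ≈ g⁻
symmetricDecomposition-unique {n} {p} {f⁺} {f⁻} {g⁺} {g⁻} (e , s⁺ , s⁻) (e′ , t⁺ , t⁻) =
  eq⁺ , eq⁻
  where
  sums : ∀ i → coeff f⁺ i ℤ.+ coeff f⁻ i ≡ coeff g⁺ i ℤ.+ coeff g⁻ i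
  sums i = trans (sym (coeff-⊕ f⁺ f⁻ i))
             (trans (sym (e i)) (trans (e′ i) (coeff-⊕ g⁺ g⁻ i)))

  ⁻⇒⁺ : ∀ i → coeff f⁻ i ≡ coeff g⁻ i → coeff f⁺ i ≡ coeff g⁺ i
  ⁻⇒⁺ i eq = ℤ-Group.∙-cancelʳ (coeff f⁻ i) _ _
    (trans (sums i) (cong (λ z → coeff g⁺ i ℤ.+ z) (sym eq)))

  ⁺⇒⁻ : ∀ i → coeff f⁺ i ≡ coeff g⁺ i → coeff f⁻ i ≡ coeff g⁻ i
  ⁺⇒⁻ i eq = ℤ-Group.∙-cancelˡ (coeff f⁺ i) _ _
    (trans (sums i) (cong (λ z → z ℤ.+ coeff g⁻ i) (sym eq)))

  reflect⁻ : ∀ i → i ℕ.≤ suc n → coeff f⁻ (suc n ∸ i) ≡ coeff g⁻ (suc n ∸ i) →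
             coeff f⁻ i ≡ coeff g⁻ i
  reflect⁻ i i≤ eq =
    trans (sym-≤ {p = f⁻} s⁻ i i≤) (trans eq (sym (sym-≤ {p = g⁻} t⁻ i i≤)))

  reflect⁺ : ∀ i → i ℕ.≤ n → coeff f⁺ i ≡ coeff g⁺ i →
             coeff f⁺ (n ∸ i) ≡ coeff g⁺ (n ∸ i)
  reflect⁺ i i≤ eq =
    trans (sym (sym-≤ {p = f⁺} s⁺ i i≤)) (trans eq (sym-≤ {p = g⁺} t⁺ i i≤))

  above⁺ : ∀ i → n ℕ.< i → coeff f⁺ i ≡ coeff g⁺ i
  above⁺ i n<i = trans (sym-> {p = f⁺} s⁺ i n<i) (sym (sym-> {p = g⁺} t⁺ i n<i))

  low⁻ : ∀ i → i ℕ.≤ suc n → coeff f⁻ i ≡ coeff g⁻ i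
  low⁻ zero    _         =
    reflect⁻ 0 z≤n (⁺⇒⁻ (suc n) (above⁺ (suc n) ℕₚ.≤-refl))
  low⁻ (suc i) (s≤s i≤n) =
    reflect⁻ (suc i) (s≤s i≤n)
      (⁺⇒⁻ (n ∸ i) (reflect⁺ i i≤n (⁻⇒⁺ i (low⁻ i (ℕₚ.m≤n⇒m≤1+n i≤n)))))

  eq⁻ : f⁻ ≈ g⁻
  eq⁻ i with ℕₚ.≤-<-connex i (suc n)
  ... | inj₁ i≤ = low⁻ i i≤
  ... | inj₂ i> = trans (sym-> {p = f⁻} s⁻ i i>) (sym (sym-> {p = g⁻} t⁻ i i>))

  eq⁺ : f⁺ ≈ g⁺
  eq⁺ i = ⁻⇒⁺ i (eq⁻ i)

dB-decomposition :
  ∀ n → ∃[ f⁺ ] ∃[ f⁻ ]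
    IsSymmetricDecomposition n (dB n) f⁺ f⁻
    × (∀ g⁺ g⁻ → IsSymmetricDecomposition n (dB n) g⁺ g⁻ → g⁺ ≈ f⁺ × g⁻ ≈ f⁻)
dB-decomposition n = g⁺ , g⁻ , decomposition ,
  λ h⁺ h⁻ dec → symmetricDecomposition-unique {p = dB n} {h⁺} {h⁻} {g⁺} {g⁻} dec decomposition
  where open Existence n (dB n) (dB-> n)

-- This pair over ℤ is also the unique one over ℝ: it is still a solution there,
-- and the uniqueness argument is valid over any ring.
f⁺ f⁻ : ℕ → Poly
f⁺ n = proj₁ (dB-decomposition n)
f⁻ n = proj₁ (proj₂ (dB-decomposition n))

sublists : {A : Set} → List A → List (List A)
sublists []       = [] ∷ []
sublists (x ∷ xs) = map (x ∷_) (sublists xs) ++ sublists xs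

-- A finite set of vertices is a list without repetitions, and each of its
-- subsets is represented by exactly one sublist.  Not every element of
-- vertices has to be a face.
record SimplicialComplex (V : Set) : Set₁ where
  field
    vertices : List V
    distinct : Unique vertices
    Face     : Pred (List V) 0ℓ
    face?    : Decidable Face
    ∅-face   : Face []
    face-⊆   : ∀ {xs ys} → xs ⊆ ys → Face ys → Face xs

  faces : List (List V)
  faces = filter face? (sublists vertices)

  -- dimension plus one
  rank : ℕ
  rank = foldr _⊔_ 0 (map length faces)

  h : Poly
  h = ∑ faces (λ F → (X^ length F) ⊗ 1-X ^ₚ (rank ∸ length F))

allSubsets : (n : ℕ) → List (Subset n)
allSubsets = allVecs (inside ∷ outside ∷ [])

-- The combinatorial data of a subdivision Γ of the simplex on Fin d: a complex
-- and its carrier map.  The topological conditions on the restrictions Γ_F do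
-- not enter the definition of the local h-polynomial.
record CarriedComplex (V : Set) (d : ℕ) : Set₁ where
  field
    complex      : SimplicialComplex V
  open SimplicialComplex complex
  field
    carrier      : List V → Subset d
    carrier-∅    : carrier [] ≡ Subset.⊥
    carrier-mono : ∀ {xs ys} → xs ⊆ ys → Face ys → carrier xs Subset.⊆ carrier ys

  restrict : Subset d → SimplicialComplex V
  restrict F = record
    { vertices = vertices
    ; distinct = distinct
    ; Face     = λ xs → Face xs × carrier xs Subset.⊆ F
    ; face?    = λ xs → face? xs ×-dec (carrier xs Subsetₚ.⊆? F)
    ; ∅-face   = ∅-face , subst (Subset._⊆ F) (sym carrier-∅) (Subsetₚ.⊆-min F)
    ; face-⊆   = λ { xs⊆ys (f , c) →
                     face-⊆ xs⊆ys f , Subsetₚ.⊆-trans (carrier-mono xs⊆ys f) c }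
    }

  localh : Poly
  localh = ∑ (allSubsets d)
    (λ F → (-1ℤ ℤ.^ (d ∸ ∣ F ∣)) · SimplicialComplex.h (restrict F))

Chain : {A : Set} → Rel A 0ℓ → Pred (List A) 0ℓ
Chain _≤_ = AllPairs (λ x y → x ≤ y ⊎ y ≤ x)

AllPairs-⊆ : {A : Set} {R : Rel A 0ℓ} {xs ys : List A} →
             xs ⊆ ys → AllPairs R ys → AllPairs R xs
AllPairs-⊆ []           _        = []
AllPairs-⊆ (y ∷ʳ s)     (_ ∷ rs) = AllPairs-⊆ s rs
AllPairs-⊆ (refl ∷ s)   (r ∷ rs) = Sublistₚ.All-resp-⊆ s r ∷ AllPairs-⊆ s rs

orderComplex : {A : Set} {_≤_ : Rel A 0ℓ} → IsDecPartialOrder _≡_ _≤_ →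
               (xs : List A) → Unique xs → SimplicialComplex A
orderComplex {_≤_ = _≤_} po xs u = record
  { vertices = xs
  ; distinct = u
  ; Face     = Chain _≤_
  ; face?    = allPairs? (λ x y → (x ≤? y) ⊎-dec (y ≤? x))
  ; ∅-face   = []
  ; face-⊆   = AllPairs-⊆
  }
  where open IsDecPartialOrder po using (_≤?_)

-- the pair (A , B) stands for the interval [A , B]
Interval : ℕ → Set
Interval n = Subset n × Subset n

infix 4 _≤ᴵ_
_≤ᴵ_ : ∀ {n} → Rel (Interval n) 0ℓ
(A , B) ≤ᴵ (A′ , B′) = A′ Subset.⊆ A × B Subset.⊆ B′

≤ᴵ-isDecPartialOrder : ∀ {n} → IsDecPartialOrder _≡_ (_≤ᴵ_ {n})
≤ᴵ-isDecPartialOrder = record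
  { isPartialOrder = record
    { isPreorder = record
      { isEquivalence = isEquivalence
      ; reflexive     = λ { refl → Subsetₚ.⊆-refl , Subsetₚ.⊆-refl }
      ; trans         = λ { (a , b) (a′ , b′) →
                            Subsetₚ.⊆-trans a′ a , Subsetₚ.⊆-trans b b′ }
      }
    ; antisym = λ { (a , b) (a′ , b′) →
                    cong₂ _,_ (Subsetₚ.⊆-antisym a′ a) (Subsetₚ.⊆-antisym b b′) }
    }
  ; _≟_  = ≡-dec (Vecₚ.≡-dec _≟ᵇ_) (Vecₚ.≡-dec _≟ᵇ_)
  ; _≤?_ = λ { (A , B) (A′ , B′) → (A′ Subsetₚ.⊆? A) ×-dec (B Subsetₚ.⊆? B′) }
  }

module _ {n : ℕ} where
  open IsDecPartialOrder (≤ᴵ-isDecPartialOrder {n}) public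
    using () renaming (_≤?_ to _≤ᴵ?_; refl to ≤ᴵ-refl; trans to ≤ᴵ-trans)

intervals : (n : ℕ) → List (Interval n)
intervals n = filter (λ { (A , B) → Subsetₚ.nonempty? A ×-dec (A Subsetₚ.⊆? B) })
                     (cartesianProduct (allSubsets n) (allSubsets n))

allVecs-unique : {A : Set} {as : List A} → Unique as → ∀ n → Unique (allVecs as n)
allVecs-unique u zero    = [] ∷ []
allVecs-unique u (suc n) =
  Uniqueₚ.cartesianProductWith⁺ Vec._∷_ Vecₚ.∷-injective u (allVecs-unique u n)

allSubsets-unique : ∀ n → Unique (allSubsets n)
allSubsets-unique = allVecs-unique (((λ ()) ∷ []) ∷ [] ∷ [])

intervals-unique : ∀ n → Unique (intervals n)
intervals-unique n = Uniqueₚ.filter⁺ _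
  (Uniqueₚ.cartesianProduct⁺ (allSubsets-unique n) (allSubsets-unique n))

largest : ∀ {n} → List (Interval n) → Maybe (Interval n)
largest c = head (filter (λ I → All.all? (_≤ᴵ? I) c) c)

carrierᴷ : ∀ {n} → List (Interval n) → Subset n
carrierᴷ c = maybe′ proj₂ Subset.⊥ (largest c)

private

  head-∈ : {A : Set} (xs : List A) {x : A} → head xs ≡ just x → x ∈ xs
  head-∈ (x ∷ xs) refl = here refl

  head-nothing : {A : Set} (xs : List A) {x : A} → head xs ≡ nothing → ¬ x ∈ xs
  head-nothing [] _ ()

  largest-sound : ∀ {n} (c : List (Interval n)) {I} → largest c ≡ just I →
                  I ∈ c × All (_≤ᴵ I) c
  largest-sound c eq = ∈-filter⁻ (λ I → All.all? (_≤ᴵ? I) c) (head-∈ _ eq)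

  chain-greatest : ∀ {n} (J : Interval n) (c : List (Interval n)) → Chain _≤ᴵ_ (J ∷ c) →
                   ∃[ I ] I ∈ J ∷ c × All (_≤ᴵ I) (J ∷ c)
  chain-greatest J []       _              = J , here refl , ≤ᴵ-refl ∷ []
  chain-greatest J (K ∷ c) (J-c ∷ chain) with chain-greatest K c chain
  ... | I , I∈ , ub with All.lookup J-c I∈
  ... | inj₁ J≤I = I , there I∈ , J≤I ∷ ub
  ... | inj₂ I≤J = J , here refl , ≤ᴵ-refl ∷ All.map (λ K≤I → ≤ᴵ-trans K≤I I≤J) ub

  carrierᴷ-mono : ∀ {n} {xs ys : List (Interval n)} → xs ⊆ ys → Chain _≤ᴵ_ ys →
                  carrierᴷ xs Subset.⊆ carrierᴷ ys
  carrierᴷ-mono {xs = xs} {ys} xs⊆ys chain with largest xs in eq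
  ... | nothing = λ x∈⊥ → ⊥-elim (Subsetₚ.∉⊥ x∈⊥)
  ... | just I  with largest ys in eq′
  ...   | just J  = proj₂ (All.lookup (proj₂ (largest-sound ys eq′)) I∈ys)
    where I∈ys = Sublist.lookup xs⊆ys (proj₁ (largest-sound xs eq))
  ...   | nothing = ⊥-elim (absurd ys (Sublist.lookup xs⊆ys (proj₁ (largest-sound xs eq))) chain eq′)
    where
    absurd : ∀ zs → I ∈ zs → Chain _≤ᴵ_ zs → largest zs ≡ nothing → ⊥
    absurd (z ∷ zs) _ ch e with chain-greatest z zs ch
    ... | G , G∈ , ub =
      head-nothing _ e (∈-filter⁺ (λ I → All.all? (_≤ᴵ? I) (z ∷ zs)) G∈ ub)

K : (n : ℕ) → CarriedComplex (Interval n) n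
K n = record
  { complex      = orderComplex ≤ᴵ-isDecPartialOrder (intervals n) (intervals-unique n)
  ; carrier      = carrierᴷ
  ; carrier-∅    = refl
  ; carrier-mono = carrierᴷ-mono
  }

{-# OPTIONS --safe #-}

module Submission where

-- Inserting ±(n+1) into a word at each place, respectively into a cycle after each
-- element, gives recurrences for the descent polynomials B⁺ₙ, B⁻ₙ and for the joint
-- distribution of excedances and positive fixed points on B_n.  Passing to binomial
-- transforms p = Σ (-1)ⁿ⁻ᵏ C(n,k) B⁺ₖ and q = Σ (-1)ⁿ⁻ᵏ C(n,k) B⁻ₖ, these become
--   pₙ₊₁ = 2x(1-x)pₙ′ + 2nxpₙ + 2nxpₙ₋₁ + qₙ,
--   qₙ₊₁ = 2x(1-x)qₙ′ + 2nxqₙ + 2nxqₙ₋₁ + x(pₙ + qₙ) - qₙ,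
-- and the derangement polynomial satisfies the sum of the two.  Hence d^B_n = pₙ + qₙ;
-- the recurrences also preserve the symmetry of p and q, and the property that the
-- coefficients increase up to the centre, so that f⁺ₙ = pₙ is symmetric and unimodal.
--
-- For K_n, the series B⁺ₙ(x) / (1-x)ⁿ has coefficients (2m+1)ⁿ - (2m)ⁿ, for n ≥ 1, by the
-- same recurrence, and these are the numbers of multichains of m intervals [A, B] with
-- ∅ ≠ A ⊆ B ⊆ F and |F| = n.  Therefore h((K_n)_F) = B⁺_{|F|}, and the local
-- h-polynomial is the binomial transform pₙ.

open import Defs
open import Level using (0ℓ)
open import Data.Bool.Base using (Bool; true; false; not; _∧_; _∨_)
open import Data.Nat as ℕ using (ℕ; zero; suc; _≤_; z≤n; s≤s; _∸_; _⊔_)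
import Data.Nat.Properties as ℕₚ
open import Data.Nat.Combinatorics using (_C_; nCk+nC[k+1]≡[n+1]C[k+1]; k>n⇒nCk≡0; nCn≡1; nCk≡nC[n∸k])
open import Data.Integer as ℤ using (ℤ; +_; -[1+_]; 0ℤ; 1ℤ; -1ℤ; _+_; _*_; _-_; -_; _◃_)
import Data.Integer.Properties as ℤₚ
open import Data.Integer.Tactic.RingSolver using (solve-∀)
import Data.Nat.Tactic.RingSolver as ℕ-RingSolver
open import Data.Sign using (Sign)
open import Data.Empty using (⊥; ⊥-elim)
open import Data.Fin as Fin using (Fin; toℕ; inject₁; fromℕ; punchIn; punchOut)
import Data.Fin.Properties as Finₚ
open import Data.Fin.Permutation.Components using (transpose; transpose-inverse)
import Data.Fin.Relation.Unary.Top as Top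
open import Data.Fin.Relation.Unary.Top using (view; ‵fromℕ; ‵inject₁)
open import Data.Fin.Subset as Subset using (Subset; Nonempty; inside; outside; ∣_∣)
import Data.Fin.Subset.Properties as Subsetₚ
open import Data.Vec as Vec using (Vec; lookup; tabulate; insertAt; _∷ʳ_)
import Data.Vec.Properties as Vecₚ
import Data.Vec.Relation.Unary.All.Properties as VAllₚ
open import Data.Vec.Relation.Unary.All as VAll using () renaming (All to VAll)
open import Data.List using (List; []; _∷_; _++_; map; foldr; filter; length; head; upTo; applyUpTo; allFin; cartesianProduct; cartesianProductWith)
import Data.List as List
import Data.List.Properties as Listₚ
open import Data.List.Membership.Propositional using (_∈_)
import Data.List.Membership.Propositional.Properties as ∈ₚ
open import Data.List.Membership.Propositional.Properties.WithK using (unique∧set⇒bag)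
open import Data.List.Relation.Binary.BagAndSetEquality using (∼bag⇒↭)
open import Data.List.Relation.Binary.Permutation.Propositional as Perm using (_↭_; prep; swap)
import Data.List.Relation.Binary.Sublist.Propositional as Sublist
open import Data.List.Relation.Unary.All as All using (All; []; _∷_)
import Data.List.Relation.Unary.All.Properties as Allₚ
open import Data.List.Relation.Unary.AllPairs as AllPairs using (AllPairs; []; _∷_)
open import Data.List.Relation.Unary.Any using (here; there)
open import Data.List.Relation.Unary.Unique.Propositional using (Unique)
import Data.List.Relation.Unary.Unique.Propositional.Properties as Uniqueₚ
open import Data.Maybe using (maybe′)
open import Data.Product using (∃-syntax; _×_; _,_; proj₁; proj₂)
open import Data.Sum using (_⊎_; inj₁; inj₂)
open import Function using (_∘_; id; mk⇔)
open import Function.Definitions using (Injective; Surjective)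
open import Relation.Binary using (Rel; IsDecPartialOrder)
open import Relation.Binary.PropositionalEquality
open import Relation.Nullary using (¬_; Dec; yes; no; does; ¬?; _×-dec_; _⊎-dec_)
open import Relation.Nullary.Decidable using (dec-true; dec-false; does-⇔)
open import Relation.Unary using (Pred; Decidable)

-- Finite sums

-- Since the decomposition of `dB n` is unique, descents and excedances need no direct comparison:
-- it suffices that p and q have the right centres of symmetry and that p + q is the derangement
-- polynomial. Insertion does not stay within derangements, because it can destroy a fixed point;
-- hence the joint count with the number f of positive fixed points, and the ansatz C(n, f) times
-- the polynomial for n - f, checked against the recurrence for all f at once. The transform is an
-- iterated difference, for which a factor j in the summand produces the terms with n - 1. On the
-- geometric side, division by (1 - x)ⁿ turns xᵏ(1 - x)ⁿ⁻ᵏ into (x / (1 - x))ᵏ, whose coefficients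
-- count the multichains with a given support of k elements. Multichains of intervals are counted
-- one coordinate of [n] at a time: summing y^rank over the intervals below I gives (y + 2)^rank(I),
-- which is where the odd numbers come from. Polynomials are treated as coefficient sequences, on
-- which differential operators are weights in the index.

+-congˡ : ∀ a {b c} → b ≡ c → a + b ≡ a + c
+-congˡ a = cong (λ b → a + b)

*-congˡ : ∀ a {b c} → b ≡ c → a * b ≡ a * c
*-congˡ a = cong (λ b → a * b)

𝟙 : Bool → ℤ
𝟙 true  = 1ℤ
𝟙 false = 0ℤ

-- Iverson bracket. It only looks at `does`, so brackets of compound decisions reduce to Boolean
-- operations.
⟦_⟧ : {P : Set} → Dec P → ℤ
⟦ P? ⟧ = 𝟙 (does P?)

⟦⟧-yes : {P : Set} (P? : Dec P) → P → ⟦ P? ⟧ ≡ 1ℤ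
⟦⟧-yes P? p = cong 𝟙 (dec-true P? p)

⟦⟧-no : {P : Set} (P? : Dec P) → ¬ P → ⟦ P? ⟧ ≡ 0ℤ
⟦⟧-no P? ¬p = cong 𝟙 (dec-false P? ¬p)

⟦⟧-⇔ : {P Q : Set} (P? : Dec P) (Q? : Dec Q) → (P → Q) → (Q → P) → ⟦ P? ⟧ ≡ ⟦ Q? ⟧
⟦⟧-⇔ P? Q? f g = cong 𝟙 (does-⇔ (mk⇔ f g) P? Q?)

∑ᶻ : {A : Set} → List A → (A → ℤ) → ℤ
∑ᶻ []       f = 0ℤ
∑ᶻ (x ∷ xs) f = f x + ∑ᶻ xs f

module _ {A : Set} where

  ∑ᶻ-cong-∈ : ∀ (xs : List A) {f g} → (∀ {x} → x ∈ xs → f x ≡ g x) → ∑ᶻ xs f ≡ ∑ᶻ xs g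
  ∑ᶻ-cong-∈ []       e = refl
  ∑ᶻ-cong-∈ (x ∷ xs) e = cong₂ _+_ (e (here refl)) (∑ᶻ-cong-∈ xs (e ∘ there))

  ∑ᶻ-cong : ∀ (xs : List A) {f g} → (∀ x → f x ≡ g x) → ∑ᶻ xs f ≡ ∑ᶻ xs g
  ∑ᶻ-cong xs e = ∑ᶻ-cong-∈ xs (λ {x} _ → e x)

  ∑ᶻ-zero : ∀ (xs : List A) → ∑ᶻ xs (λ _ → 0ℤ) ≡ 0ℤ
  ∑ᶻ-zero []       = refl
  ∑ᶻ-zero (x ∷ xs) = trans (ℤₚ.+-identityˡ _) (∑ᶻ-zero xs)

  ∑ᶻ-+ : ∀ (xs : List A) f g → ∑ᶻ xs (λ x → f x + g x) ≡ ∑ᶻ xs f + ∑ᶻ xs g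
  ∑ᶻ-+ []       f g = refl
  ∑ᶻ-+ (x ∷ xs) f g = trans (+-congˡ (f x + g x) (∑ᶻ-+ xs f g)) (interchange (f x) (g x) (∑ᶻ xs f) (∑ᶻ xs g))
    where
    interchange : ∀ a b c d → a + b + (c + d) ≡ a + c + (b + d)
    interchange = solve-∀

  ∑ᶻ-* : ∀ (xs : List A) c f → ∑ᶻ xs (λ x → c * f x) ≡ c * ∑ᶻ xs f
  ∑ᶻ-* []       c f = sym (ℤₚ.*-zeroʳ c)
  ∑ᶻ-* (x ∷ xs) c f = trans (+-congˡ (c * f x) (∑ᶻ-* xs c f)) (sym (ℤₚ.*-distribˡ-+ c _ _))

  ∑ᶻ-neg : ∀ (xs : List A) f → ∑ᶻ xs (λ x → - f x) ≡ - ∑ᶻ xs f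
  ∑ᶻ-neg []       f = refl
  ∑ᶻ-neg (x ∷ xs) f = trans (+-congˡ (- f x) (∑ᶻ-neg xs f)) (sym (ℤₚ.neg-distrib-+ (f x) (∑ᶻ xs f)))

  ∑ᶻ-++ : ∀ (xs ys : List A) f → ∑ᶻ (xs ++ ys) f ≡ ∑ᶻ xs f + ∑ᶻ ys f
  ∑ᶻ-++ []       ys f = sym (ℤₚ.+-identityˡ _)
  ∑ᶻ-++ (x ∷ xs) ys f = trans (+-congˡ (f x) (∑ᶻ-++ xs ys f)) (sym (ℤₚ.+-assoc (f x) _ _))

  ∑ᶻ-filter : {P : Pred A 0ℓ} (P? : Decidable P) → ∀ xs f →
              ∑ᶻ (filter P? xs) f ≡ ∑ᶻ xs (λ x → ⟦ P? x ⟧ * f x)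
  ∑ᶻ-filter P? []       f = refl
  ∑ᶻ-filter P? (x ∷ xs) f with does (P? x)
  ... | true  = cong₂ _+_ (sym (ℤₚ.*-identityˡ (f x))) (∑ᶻ-filter P? xs f)
  ... | false = trans (∑ᶻ-filter P? xs f) (sym (ℤₚ.+-identityˡ _))

  ∑ᶻ-↭ : ∀ {xs ys : List A} → xs ↭ ys → ∀ f → ∑ᶻ xs f ≡ ∑ᶻ ys f
  ∑ᶻ-↭ Perm.refl         f = refl
  ∑ᶻ-↭ (prep x p)   f = +-congˡ (f x) (∑ᶻ-↭ p f)
  ∑ᶻ-↭ (swap x y p) f = trans (cong (λ s → f x + (f y + s)) (∑ᶻ-↭ p f)) (lem (f x) (f y) _)
    where
    lem : ∀ a b c → a + (b + c) ≡ b + (a + c)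
    lem = solve-∀
  ∑ᶻ-↭ (Perm.trans p q)  f = trans (∑ᶻ-↭ p f) (∑ᶻ-↭ q f)

  ∑ᶻ-nonneg : ∀ (xs : List A) {f} → (∀ x → 0ℤ ℤ.≤ f x) → 0ℤ ℤ.≤ ∑ᶻ xs f
  ∑ᶻ-nonneg []       p = ℤₚ.≤-refl
  ∑ᶻ-nonneg (x ∷ xs) p = ℤₚ.+-mono-≤ (p x) (∑ᶻ-nonneg xs p)

  ∑ᶻ-≥-term : ∀ {xs : List A} {f} → (∀ x → 0ℤ ℤ.≤ f x) → ∀ {x} → x ∈ xs → f x ℤ.≤ ∑ᶻ xs f
  ∑ᶻ-≥-term {y ∷ xs} {f} p {x} (here refl) =
    ℤₚ.≤-trans (ℤₚ.≤-reflexive (sym (ℤₚ.+-identityʳ _))) (ℤₚ.+-monoʳ-≤ (f x) (∑ᶻ-nonneg xs p))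
  ∑ᶻ-≥-term {y ∷ xs} {f} p {x} (there x∈) =
    ℤₚ.≤-trans (ℤₚ.≤-reflexive (sym (ℤₚ.+-identityˡ _))) (ℤₚ.+-mono-≤ (p y) (∑ᶻ-≥-term p x∈))

∑ᶻ-map : {A B : Set} (g : A → B) → ∀ xs f → ∑ᶻ (map g xs) f ≡ ∑ᶻ xs (f ∘ g)
∑ᶻ-map g []       f = refl
∑ᶻ-map g (x ∷ xs) f = +-congˡ (f (g x)) (∑ᶻ-map g xs f)

module _ {A B : Set} where

  ∑ᶻ-swap : ∀ (xs : List A) (ys : List B) (f : A → B → ℤ) →
            ∑ᶻ xs (λ x → ∑ᶻ ys (λ y → f x y)) ≡ ∑ᶻ ys (λ y → ∑ᶻ xs (λ x → f x y))
  ∑ᶻ-swap []       ys f = sym (∑ᶻ-zero ys)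
  ∑ᶻ-swap (x ∷ xs) ys f = trans (+-congˡ (∑ᶻ ys (f x)) (∑ᶻ-swap xs ys f)) (sym (∑ᶻ-+ ys (f x) (λ y → ∑ᶻ xs (λ z → f z y))))

  ∑ᶻ-cartesianProductWith : {D : Set} (g : A → B → D) → ∀ xs ys f →
    ∑ᶻ (cartesianProductWith g xs ys) f ≡ ∑ᶻ xs (λ x → ∑ᶻ ys (λ y → f (g x y)))
  ∑ᶻ-cartesianProductWith g []       ys f = refl
  ∑ᶻ-cartesianProductWith g (x ∷ xs) ys f = trans (∑ᶻ-++ (map (g x) ys) _ f)
    (cong₂ _+_ (∑ᶻ-map (g x) ys f) (∑ᶻ-cartesianProductWith g xs ys f))

  -- Two lists without repetitions that have the same members are permutations of each other, so the
  -- order in which `signedPerms` enumerates never enters.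
  ∑ᶻ-bijection : ∀ {xs : List A} {ys : List B} (φ : B → A) → Unique xs → Unique ys →
    Injective _≡_ _≡_ φ → (∀ {y} → y ∈ ys → φ y ∈ xs) →
    (∀ {x} → x ∈ xs → ∃[ y ] y ∈ ys × x ≡ φ y) →
    ∀ f → ∑ᶻ xs f ≡ ∑ᶻ ys (f ∘ φ)
  ∑ᶻ-bijection {xs} {ys} φ u v inj into onto f = trans
    (∑ᶻ-↭ (∼bag⇒↭ (unique∧set⇒bag u (Uniqueₚ.map⁺ inj v) (mk⇔ to from))) f) (∑ᶻ-map φ ys f)
    where
    to : ∀ {x} → x ∈ xs → x ∈ map φ ys
    to x∈ with y , y∈ , e ← onto x∈ = subst (_∈ map φ ys) (sym e) (∈ₚ.∈-map⁺ φ y∈)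
    from : ∀ {x} → x ∈ map φ ys → x ∈ xs
    from x∈ with y , y∈ , e ← ∈ₚ.∈-map⁻ φ x∈ = subst (_∈ xs) (sym e) (into y∈)

∑ꟳ : ∀ n → (Fin n → ℤ) → ℤ
∑ꟳ zero    f = 0ℤ
∑ꟳ (suc n) f = f Fin.zero + ∑ꟳ n (f ∘ Fin.suc)

∑ᶻ-tabulate : {A : Set} → ∀ {n} (g : Fin n → A) f → ∑ᶻ (List.tabulate g) f ≡ ∑ꟳ n (f ∘ g)
∑ᶻ-tabulate {n = zero}  g f = refl
∑ᶻ-tabulate {n = suc n} g f = +-congˡ (f (g Fin.zero)) (∑ᶻ-tabulate (g ∘ Fin.suc) f)

∑ꟳ-cong : ∀ n {f g : Fin n → ℤ} → (∀ i → f i ≡ g i) → ∑ꟳ n f ≡ ∑ꟳ n g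
∑ꟳ-cong zero    e = refl
∑ꟳ-cong (suc n) e = cong₂ _+_ (e Fin.zero) (∑ꟳ-cong n (e ∘ Fin.suc))

∑ꟳ-last : ∀ n (f : Fin (suc n) → ℤ) → ∑ꟳ (suc n) f ≡ ∑ꟳ n (f ∘ inject₁) + f (fromℕ n)
∑ꟳ-last zero    f = ℤₚ.+-comm (f Fin.zero) 0ℤ
∑ꟳ-last (suc n) f = trans (+-congˡ (f Fin.zero) (∑ꟳ-last n (f ∘ Fin.suc)))
                          (sym (ℤₚ.+-assoc (f Fin.zero) _ _))

-- Coefficient sequences

-- Kronecker delta, by recursion on both arguments so that a comparison of successors reduces
-- definitionally.
δ : ℕ → ℕ → ℤ
δ zero    zero    = 1ℤ
δ zero    (suc b) = 0ℤ
δ (suc a) zero    = 0ℤ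
δ (suc a) (suc b) = δ a b

-- Multiplication by x.
shift : (ℕ → ℤ) → ℕ → ℤ
shift a zero    = 0ℤ
shift a (suc k) = a k

shift-cong : ∀ {a b : ℕ → ℤ} → (∀ k → a k ≡ b k) → ∀ k → shift a k ≡ shift b k
shift-cong e zero    = refl
shift-cong e (suc k) = e k

coeff-∑ : {A : Set} (xs : List A) (f : A → Poly) → ∀ k → coeff (∑ xs f) k ≡ ∑ᶻ xs (λ a → coeff (f a) k)
coeff-∑ []       f k = refl
coeff-∑ (x ∷ xs) f k = trans (coeff-⊕ (f x) _ k) (+-congˡ (coeff (f x) k) (coeff-∑ xs f k))

coeff-· : ∀ c p k → coeff (c · p) k ≡ c * coeff p k
coeff-· c []      k       = sym (ℤₚ.*-zeroʳ c)
coeff-· c (a ∷ p) zero    = refl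
coeff-· c (a ∷ p) (suc k) = coeff-· c p k

coeff-X^ : ∀ j k → coeff (X^ j) k ≡ δ k j
coeff-X^ zero    zero    = refl
coeff-X^ zero    (suc k) = refl
coeff-X^ (suc j) zero    = refl
coeff-X^ (suc j) (suc k) = coeff-X^ j k

-- Signed permutations of [n + 1] from those of [n]

lookup-∷ʳ-inject₁ : ∀ {A : Set} {n} (xs : Vec A n) x i → lookup (xs ∷ʳ x) (inject₁ i) ≡ lookup xs i
lookup-∷ʳ-inject₁ (y Vec.∷ xs) x Fin.zero    = refl
lookup-∷ʳ-inject₁ (y Vec.∷ xs) x (Fin.suc i) = lookup-∷ʳ-inject₁ xs x i

lookup-∷ʳ-fromℕ : ∀ {A : Set} {n} (xs : Vec A n) x → lookup (xs ∷ʳ x) (fromℕ n) ≡ x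
lookup-∷ʳ-fromℕ Vec.[]       x = refl
lookup-∷ʳ-fromℕ (y Vec.∷ xs) x = lookup-∷ʳ-fromℕ xs x

lookup-extensional : ∀ {A : Set} {n} {xs ys : Vec A n} → (∀ i → lookup xs i ≡ lookup ys i) → xs ≡ ys
lookup-extensional {xs = xs} {ys} e =
  trans (sym (Vecₚ.tabulate∘lookup xs)) (trans (Vecₚ.tabulate-cong e) (Vecₚ.tabulate∘lookup ys))

∈-allVecs : ∀ {A : Set} {as : List A} → (∀ a → a ∈ as) → ∀ {n} (v : Vec A n) → v ∈ allVecs as n
∈-allVecs p Vec.[]      = here refl
∈-allVecs p (a Vec.∷ v) = ∈ₚ.∈-cartesianProductWith⁺ Vec._∷_ (p a) (∈-allVecs p v)

signs : List Sign
signs = Sign.+ ∷ Sign.- ∷ []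

∈-signs : ∀ σ → σ ∈ signs
∈-signs Sign.+ = here refl
∈-signs Sign.- = there (here refl)

signs-unique : Unique signs
signs-unique = ((λ ()) ∷ []) ∷ [] ∷ []

∈-signedPerms : ∀ {n} (w : SignedMap n) → IsPerm w → w ∈ signedPerms n
∈-signedPerms w@(s , π) p = ∈ₚ.∈-filter⁺ isPerm?
  (∈ₚ.∈-cartesianProduct⁺ (∈-allVecs ∈-signs s) (∈-allVecs ∈ₚ.∈-allFin π)) p

isPerm-signedPerms : ∀ {n} {w : SignedMap n} → w ∈ signedPerms n → IsPerm w
isPerm-signedPerms {n} w∈ =
  proj₂ (∈ₚ.∈-filter⁻ isPerm? {xs = cartesianProduct (allVecs signs n) (allVecs (allFin n) n)} w∈)

signedPerms-unique : ∀ n → Unique (signedPerms n)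
signedPerms-unique n = Uniqueₚ.filter⁺ isPerm?
  (Uniqueₚ.cartesianProduct⁺ (allVecs-unique signs-unique n) (allVecs-unique (Uniqueₚ.allFin⁺ n) n))

extend : ∀ {n} → Vec (Fin n) n → Fin (suc n) → Fin (suc n)
extend {n} π = lookup (Vec.map inject₁ π ∷ʳ fromℕ n)

extend-inject₁ : ∀ {n} (π : Vec (Fin n) n) j → extend π (inject₁ j) ≡ inject₁ (lookup π j)
extend-inject₁ π j = trans (lookup-∷ʳ-inject₁ (Vec.map inject₁ π) _ j) (Vecₚ.lookup-map j inject₁ π)

extend-fromℕ : ∀ {n} (π : Vec (Fin n) n) → extend π (fromℕ n) ≡ fromℕ n
extend-fromℕ π = lookup-∷ʳ-fromℕ (Vec.map inject₁ π) _

extend-fromℕ⁻ : ∀ {n} (π : Vec (Fin n) n) j → extend π j ≡ fromℕ n → j ≡ fromℕ n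
extend-fromℕ⁻ π j e with view j
... | ‵fromℕ     = refl
... | ‵inject₁ i = ⊥-elim (Finₚ.fromℕ≢inject₁ (sym (trans (sym (extend-inject₁ π i)) e)))

-- A way of building B_{n+1} from B_n: the new letter is put at position i, and the
-- positions are permuted by τ i.  The rotation inserts the letter into the word,
-- the transposition inserts it into a cycle.
record Rearrangement (n : ℕ) : Set where
  field
    τ τ⁻¹  : Fin (suc n) → Fin (suc n) → Fin (suc n)
    τ-τ⁻¹  : ∀ i j → τ i (τ⁻¹ i j) ≡ j
    τ⁻¹-τ  : ∀ i j → τ⁻¹ i (τ i j) ≡ j
    τ-self : ∀ i → τ i i ≡ fromℕ n

  -- After `π` is prolonged by a fixed last index, precomposition with `τ i` moves the new letter
  -- from the end to position i, since `τ i i` is the last index.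
  insert : Sign → Fin (suc n) → SignedMap n → SignedMap (suc n)
  insert σ i (s , π) = s ∷ʳ σ , tabulate (extend π ∘ τ i)

  τ-injective : ∀ i {j k} → τ i j ≡ τ i k → j ≡ k
  τ-injective i {j} {k} e = trans (sym (τ⁻¹-τ i j)) (trans (cong (τ⁻¹ i) e) (τ⁻¹-τ i k))

  insert-isPerm : ∀ σ i w → IsPerm w → IsPerm (insert σ i w)
  insert-isPerm σ i w@(s , π) (inj , sur) = inj′ , λ j → pre j , λ { refl → pre-eq j }
    where
    ext-inj : ∀ {j k} → extend π j ≡ extend π k → j ≡ k
    ext-inj {j} {k} e with view j | view k
    ... | ‵fromℕ     | _          = sym (extend-fromℕ⁻ π k (trans (sym e) (extend-fromℕ π)))
    ... | ‵inject₁ j | ‵fromℕ     = extend-fromℕ⁻ π (inject₁ j) (trans e (extend-fromℕ π))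
    ... | ‵inject₁ j | ‵inject₁ k = cong inject₁ (inj (Finₚ.inject₁-injective
            (trans (sym (extend-inject₁ π j)) (trans e (extend-inject₁ π k)))))

    ext-sur : ∀ j → ∃[ k ] extend π k ≡ j
    ext-sur j with view j
    ... | ‵fromℕ     = fromℕ n , extend-fromℕ π
    ... | ‵inject₁ j = inject₁ (proj₁ (sur j)) ,
            trans (extend-inject₁ π _) (cong inject₁ (proj₂ (sur j) refl))

    inj′ : Injective _≡_ _≡_ (lookup (tabulate (extend π ∘ τ i)))
    inj′ {j} {k} e = τ-injective i (ext-inj (trans (sym (Vecₚ.lookup∘tabulate (extend π ∘ τ i) j))
      (trans e (Vecₚ.lookup∘tabulate (extend π ∘ τ i) k))))

    pre : Fin (suc n) → Fin (suc n)
    pre j = τ⁻¹ i (proj₁ (ext-sur j))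

    pre-eq : ∀ j → lookup (tabulate (extend π ∘ τ i)) (pre j) ≡ j
    pre-eq j = trans (Vecₚ.lookup∘tabulate (extend π ∘ τ i) (pre j))
      (trans (cong (extend π) (τ-τ⁻¹ i _)) (proj₂ (ext-sur j)))

  insert′ : Sign × Fin (suc n) × SignedMap n → SignedMap (suc n)
  insert′ (σ , i , w) = insert σ i w

  -- The position i is recovered as the only one that carries the last index, by `τ-self`;
  -- composition with `τ⁻¹ i` then gives back `extend π`, and hence `π`.
  insert-injective : Injective _≡_ _≡_ insert′
  insert-injective {σ , i , s , π} {σ′ , i′ , s′ , π′} e with Vecₚ.∷ʳ-injective s s′ (cong proj₁ e)
  ... | refl , refl = lem i≡i′
    where
    pointwise : ∀ j → extend π (τ i j) ≡ extend π′ (τ i′ j)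
    pointwise j = trans (sym (Vecₚ.lookup∘tabulate (extend π ∘ τ i) j))
      (trans (cong (λ w → lookup (proj₂ w) j) e) (Vecₚ.lookup∘tabulate (extend π′ ∘ τ i′) j))

    i≡i′ : i ≡ i′
    i≡i′ = τ-injective i′ (trans (extend-fromℕ⁻ π′ (τ i′ i) (trans (sym (pointwise i))
      (trans (cong (extend π) (τ-self i)) (extend-fromℕ π)))) (sym (τ-self i′)))

    lem : i ≡ i′ → (σ , i , s , π) ≡ (σ , i′ , s , π′)
    lem refl = cong (λ ρ → σ , i , s , ρ) (lookup-extensional λ j →
      Finₚ.inject₁-injective (begin
        inject₁ (lookup π j)             ≡⟨ extend-inject₁ π j ⟨
        extend π (inject₁ j)             ≡⟨ cong (extend π) (τ-τ⁻¹ i (inject₁ j)) ⟨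
        extend π (τ i (τ⁻¹ i (inject₁ j)))  ≡⟨ pointwise (τ⁻¹ i (inject₁ j)) ⟩
        extend π′ (τ i (τ⁻¹ i (inject₁ j))) ≡⟨ cong (extend π′) (τ-τ⁻¹ i (inject₁ j)) ⟩
        extend π′ (inject₁ j)            ≡⟨ extend-inject₁ π′ j ⟩
        inject₁ (lookup π′ j)            ∎))
      where open ≡-Reasoning

  -- Here i has to be the position of the letter of absolute value n + 1; undoing `τ i` leaves a
  -- permutation that fixes the last index and so restricts to the smaller ones.
  insert-surjective : ∀ w → IsPerm w → ∃[ t ] IsPerm (proj₂ (proj₂ t)) × w ≡ insert′ t
  insert-surjective (s , ρ) (inj , sur) = (Vec.last s , i , Vec.init s , π) , (inj′ , sur′) ,
    cong₂ _,_ (snoc s) (lookup-extensional λ j → sym (trans (Vecₚ.lookup∘tabulate (extend π ∘ τ i) j)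
      (trans (extend-π (τ i j)) (cong (lookup ρ) (τ⁻¹-τ i j)))))
    where
    snoc : ∀ {A : Set} {m} (xs : Vec A (suc m)) → xs ≡ Vec.init xs ∷ʳ Vec.last xs
    snoc xs with Vec.initLast xs
    ... | ys , y , refl = refl

    i : Fin (suc n)
    i = proj₁ (sur (fromℕ n))

    ρ′ : Fin (suc n) → Fin (suc n)
    ρ′ = lookup ρ ∘ τ⁻¹ i

    ρ′-last : ρ′ (fromℕ n) ≡ fromℕ n
    ρ′-last = trans (cong (lookup ρ) (trans (cong (τ⁻¹ i) (sym (τ-self i))) (τ⁻¹-τ i i)))
      (proj₂ (sur (fromℕ n)) refl)

    ρ′-inj : ∀ {j k} → ρ′ j ≡ ρ′ k → j ≡ k
    ρ′-inj {j} {k} e = trans (sym (τ-τ⁻¹ i j)) (trans (cong (τ i) (inj e)) (τ-τ⁻¹ i k))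

    lower : ∀ j → ∃[ k ] inject₁ k ≡ ρ′ (inject₁ j)
    lower j with ρ′ (inject₁ j) in eq
    ... | r with view r
    ... | ‵fromℕ     = ⊥-elim (Finₚ.fromℕ≢inject₁ (ρ′-inj (trans ρ′-last (sym eq))))
    ... | ‵inject₁ k = k , refl

    π : Vec (Fin n) n
    π = tabulate (proj₁ ∘ lower)

    lookup-π : ∀ j → inject₁ (lookup π j) ≡ ρ′ (inject₁ j)
    lookup-π j = trans (cong inject₁ (Vecₚ.lookup∘tabulate (proj₁ ∘ lower) j)) (proj₂ (lower j))

    extend-π : ∀ j → extend π j ≡ ρ′ j
    extend-π j with view j
    ... | ‵fromℕ     = trans (extend-fromℕ π) (sym ρ′-last)
    ... | ‵inject₁ j = trans (extend-inject₁ π j) (lookup-π j)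

    inj′ : Injective _≡_ _≡_ (lookup π)
    inj′ {j} {k} e = Finₚ.inject₁-injective (ρ′-inj
      (trans (sym (lookup-π j)) (trans (cong inject₁ e) (lookup-π k))))

    pre : ∀ k → ∃[ j ] lookup π j ≡ k
    pre k with sur (inject₁ k)
    ... | m , m↦ with view (τ i m) in eq
    ... | v with τ i m in eq′
    pre k | m , m↦ | ‵fromℕ | _ = ⊥-elim (Finₚ.fromℕ≢inject₁ (trans (sym ρ′-last)
      (trans (cong ρ′ (sym eq′)) (trans (cong (lookup ρ) (τ⁻¹-τ i m)) (m↦ refl)))))
    pre k | m , m↦ | ‵inject₁ j | _ = j , Finₚ.inject₁-injective (trans (lookup-π j)
      (trans (cong ρ′ (sym eq′)) (trans (cong (lookup ρ) (τ⁻¹-τ i m)) (m↦ refl))))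

    sur′ : Surjective _≡_ _≡_ (lookup π)
    sur′ k = proj₁ (pre k) , λ { refl → proj₂ (pre k) }

  -- The recurrences for descents and for excedances are both this identity, for two choices of `τ`.
  ∑ᶻ-signedPerms : ∀ (f : SignedMap (suc n) → ℤ) →
    ∑ᶻ (signedPerms (suc n)) f ≡
    ∑ᶻ (signedPerms n) (λ w → ∑ꟳ (suc n) (λ i → f (insert Sign.+ i w)) + ∑ꟳ (suc n) (λ i → f (insert Sign.- i w)))
  ∑ᶻ-signedPerms f = begin
    ∑ᶻ (signedPerms (suc n)) f
      ≡⟨ ∑ᶻ-bijection insert′ (signedPerms-unique (suc n))
           (Uniqueₚ.cartesianProduct⁺ signs-unique
             (Uniqueₚ.cartesianProduct⁺ (Uniqueₚ.allFin⁺ (suc n)) (signedPerms-unique n)))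
           insert-injective into onto f ⟩
    ∑ᶻ (cartesianProduct signs (cartesianProduct (allFin (suc n)) (signedPerms n))) (f ∘ insert′)
      ≡⟨ ∑ᶻ-cartesianProductWith _,_ signs (cartesianProduct (allFin (suc n)) (signedPerms n)) (f ∘ insert′) ⟩
    ∑ᶻ signs (λ σ → ∑ᶻ (cartesianProduct (allFin (suc n)) (signedPerms n)) (λ (i , w) → f (insert σ i w)))
      ≡⟨ ∑ᶻ-cong signs (λ σ → trans (∑ᶻ-cartesianProductWith _,_ (allFin (suc n)) (signedPerms n) _)
           (trans (∑ᶻ-swap (allFin (suc n)) (signedPerms n) (λ i w → f (insert σ i w)))
             (∑ᶻ-cong (signedPerms n) λ w → ∑ᶻ-tabulate id (λ i → f (insert σ i w))))) ⟩
    ∑ᶻ signs (λ σ → ∑ᶻ (signedPerms n) (λ w → ∑ꟳ (suc n) (λ i → f (insert σ i w))))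
      ≡⟨ +-congˡ (F Sign.+) (ℤₚ.+-identityʳ (F Sign.-)) ⟩
    ∑ᶻ (signedPerms n) (λ w → ∑ꟳ (suc n) (λ i → f (insert Sign.+ i w))) +
    ∑ᶻ (signedPerms n) (λ w → ∑ꟳ (suc n) (λ i → f (insert Sign.- i w)))
      ≡⟨ ∑ᶻ-+ (signedPerms n) _ _ ⟨
    ∑ᶻ (signedPerms n) (λ w → ∑ꟳ (suc n) (λ i → f (insert Sign.+ i w)) + ∑ꟳ (suc n) (λ i → f (insert Sign.- i w))) ∎
    where
    open ≡-Reasoning
    F : Sign → ℤ
    F σ = ∑ᶻ (signedPerms n) (λ w → ∑ꟳ (suc n) (λ i → f (insert σ i w)))
    into : ∀ {t} → t ∈ cartesianProduct signs (cartesianProduct (allFin (suc n)) (signedPerms n)) →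
           insert′ t ∈ signedPerms (suc n)
    into {σ , i , w} t∈ = ∈-signedPerms (insert σ i w) (insert-isPerm σ i w
      (isPerm-signedPerms (proj₂ (∈ₚ.∈-cartesianProduct⁻ (allFin (suc n)) (signedPerms n)
        (proj₂ (∈ₚ.∈-cartesianProduct⁻ signs (cartesianProduct (allFin (suc n)) (signedPerms n)) t∈))))))
    onto : ∀ {w} → w ∈ signedPerms (suc n) →
           ∃[ t ] t ∈ cartesianProduct signs (cartesianProduct (allFin (suc n)) (signedPerms n)) × w ≡ insert′ t
    onto {w} w∈ with insert-surjective w (isPerm-signedPerms w∈)
    ... | t@(σ , i , w′) , p , e = t ,
      ∈ₚ.∈-cartesianProduct⁺ (∈-signs σ) (∈ₚ.∈-cartesianProduct⁺ (∈ₚ.∈-allFin i) (∈-signedPerms w′ p)) , e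

  elt-insert-inject₁ : ∀ σ i w j → elt (insert σ i w) (inject₁ j) ≡ elt w j
  elt-insert-inject₁ σ i (s , π) j =
    cong₂ (λ ρ k → ρ ◃ suc k) (lookup-∷ʳ-inject₁ s σ j) (Finₚ.toℕ-inject₁ j)

  elt-insert-fromℕ : ∀ σ i w → elt (insert σ i w) (fromℕ n) ≡ σ ◃ suc n
  elt-insert-fromℕ σ i (s , π) = cong₂ (λ ρ k → ρ ◃ suc k) (lookup-∷ʳ-fromℕ s σ) (Finₚ.toℕ-fromℕ n)

  val-insert-inject₁ : ∀ σ i w k {j} → τ i k ≡ inject₁ j → val (insert σ i w) k ≡ val w j
  val-insert-inject₁ σ i w@(s , π) k {j} e =
    trans (cong (elt (insert σ i w)) (trans (Vecₚ.lookup∘tabulate (extend π ∘ τ i) k)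
      (trans (cong (extend π) e) (extend-inject₁ π j)))) (elt-insert-inject₁ σ i w (lookup π j))

  val-insert-fromℕ : ∀ σ i w k → τ i k ≡ fromℕ n → val (insert σ i w) k ≡ σ ◃ suc n
  val-insert-fromℕ σ i w@(s , π) k e =
    trans (cong (elt (insert σ i w)) (trans (Vecₚ.lookup∘tabulate (extend π ∘ τ i) k)
      (trans (cong (extend π) e) (extend-fromℕ π)))) (elt-insert-fromℕ σ i w)

-- Descents

-- `τ p` sends p to the end and closes the gap at p, so the new word is the old one with a letter
-- inserted at p.
rotation : ∀ n → Rearrangement n
rotation n = record { τ = τ ; τ⁻¹ = τ⁻¹ ; τ-τ⁻¹ = τ-τ⁻¹ ; τ⁻¹-τ = τ⁻¹-τ ; τ-self = τ-self }
  where
  τ τ⁻¹ : Fin (suc n) → Fin (suc n) → Fin (suc n)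
  τ p k with p Fin.≟ k
  ... | yes _   = fromℕ n
  ... | no p≢k = inject₁ (punchOut p≢k)
  τ⁻¹ p k with view k
  ... | ‵fromℕ     = p
  ... | ‵inject₁ j = punchIn p j

  τ-self : ∀ i → τ i i ≡ fromℕ n
  τ-self i with i Fin.≟ i
  ... | yes _   = refl
  ... | no i≢i = ⊥-elim (i≢i refl)

  τ-τ⁻¹ : ∀ i j → τ i (τ⁻¹ i j) ≡ j
  τ-τ⁻¹ i j with view j
  ... | ‵fromℕ = τ-self i
  ... | ‵inject₁ j with i Fin.≟ punchIn i j
  ...   | yes i≡  = ⊥-elim (Finₚ.punchInᵢ≢i i j (sym i≡))
  ...   | no i≢   = cong inject₁ (trans (Finₚ.punchOut-cong i refl) (Finₚ.punchOut-punchIn i))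

  τ⁻¹-fromℕ : ∀ i → τ⁻¹ i (fromℕ n) ≡ i
  τ⁻¹-fromℕ i rewrite Top.view-fromℕ n = refl

  τ⁻¹-inject₁ : ∀ i j → τ⁻¹ i (inject₁ j) ≡ punchIn i j
  τ⁻¹-inject₁ i j rewrite Top.view-inject₁ j = refl

  τ⁻¹-τ : ∀ i j → τ⁻¹ i (τ i j) ≡ j
  τ⁻¹-τ i j with i Fin.≟ j
  ... | yes refl = τ⁻¹-fromℕ i
  ... | no i≢j   = trans (τ⁻¹-inject₁ i _) (Finₚ.punchIn-punchOut i≢j)

module _ {n : ℕ} where
  open Rearrangement (rotation n)

  word-insert : ∀ σ p w → tabulate (val (insert σ p w)) ≡ insertAt (tabulate (val w)) p (σ ◃ suc n)
  word-insert σ p w = lookup-extensional λ k →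
    trans (Vecₚ.lookup∘tabulate (val (insert σ p w)) k) (pointwise k)
    where
    pointwise : ∀ k → val (insert σ p w) k ≡ lookup (insertAt (tabulate (val w)) p (σ ◃ suc n)) k
    pointwise k with p Fin.≟ k
    ... | yes refl = trans (val-insert-fromℕ σ p w p (τ-self p)) (sym (Vecₚ.insertAt-lookup (tabulate (val w)) p _))
    ... | no p≢k   = begin
      val (insert σ p w) k
        ≡⟨ cong (val (insert σ p w)) (Finₚ.punchIn-punchOut p≢k) ⟨
      val (insert σ p w) (punchIn p j)
        ≡⟨ val-insert-inject₁ σ p w (punchIn p j) (trans (cong (τ p) (Finₚ.punchIn-punchOut p≢k)) τ-≢) ⟩
      val w j
        ≡⟨ Vecₚ.lookup∘tabulate (val w) j ⟨
      lookup (tabulate (val w)) j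
        ≡⟨ Vecₚ.insertAt-punchIn (tabulate (val w)) p _ j ⟨
      lookup (insertAt (tabulate (val w)) p (σ ◃ suc n)) (punchIn p j)
        ≡⟨ cong (lookup (insertAt (tabulate (val w)) p (σ ◃ suc n))) (Finₚ.punchIn-punchOut p≢k) ⟩
      lookup (insertAt (tabulate (val w)) p (σ ◃ suc n)) k ∎
      where
      open ≡-Reasoning
      j = punchOut p≢k
      τ-≢ : τ p k ≡ inject₁ j
      τ-≢ with p Fin.≟ k
      ... | yes p≡k = ⊥-elim (p≢k p≡k)
      ... | no _    = cong inject₁ (Finₚ.punchOut-cong p refl)

bit : Bool → ℕ
bit true  = 1
bit false = 0

-- The preceding letter is a parameter, so that an induction along the word can start from any
-- letter; the convention w(a₀) = 0 is the start at `0ℤ`.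
des : ∀ {n} → ℤ → Vec ℤ n → ℕ
des v Vec.[]       = 0
des v (u Vec.∷ us) = bit (does (u ℤₚ.<? v)) ℕ.+ des u us

-- For the empty word started at 0 this is false, in agreement with B⁺₀ = 1 and B⁻₀ = 0.
lastNegative : ∀ {n} → ℤ → Vec ℤ n → Bool
lastNegative v Vec.[]       = does (v ℤₚ.<? 0ℤ)
lastNegative v (u Vec.∷ us) = lastNegative u us

length-filter-tabulate : ∀ {A : Set} {P : Pred A 0ℓ} (P? : Decidable P) {n} (f : Fin n → A) →
  length (filter P? (List.tabulate f)) ≡ length (filter (P? ∘ f) (allFin n))
length-filter-tabulate P? {zero}  f = refl
length-filter-tabulate P? {suc n} f with does (P? (f Fin.zero))
... | true  = cong suc (trans (length-filter-tabulate P? (f ∘ Fin.suc)) (sym (length-filter-tabulate (P? ∘ f) Fin.suc)))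
... | false = trans (length-filter-tabulate P? (f ∘ Fin.suc)) (sym (length-filter-tabulate (P? ∘ f) Fin.suc))

des-lookup : ∀ {n} v (us : Vec ℤ n) → length (filter
  (λ i → lookup (v Vec.∷ us) (Fin.suc i) ℤₚ.<? lookup (v Vec.∷ us) (inject₁ i)) (allFin n)) ≡ des v us
des-lookup v Vec.[]       = refl
des-lookup {suc n} v (u Vec.∷ us) with does (u ℤₚ.<? v)
... | true  = cong suc (trans (length-filter-tabulate
  (λ i → lookup (v Vec.∷ u Vec.∷ us) (Fin.suc i) ℤₚ.<? lookup (v Vec.∷ u Vec.∷ us) (inject₁ i)) {n} Fin.suc) (des-lookup u us))
... | false = trans (length-filter-tabulate
  (λ i → lookup (v Vec.∷ u Vec.∷ us) (Fin.suc i) ℤₚ.<? lookup (v Vec.∷ u Vec.∷ us) (inject₁ i)) {n} Fin.suc) (des-lookup u us)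

-- Inserting a letter of maximal absolute value into a descent keeps the number of
-- descents, inserting it into an ascent creates one; the end of the word is special.
insertions : ℕ → (Bool → ℕ → ℤ) → Bool → ℕ → ℤ
insertions n φ ε d = + d * φ ε d + (+ n - + d) * φ ε (suc d)

-- Induction along the word. `φ` has to be arbitrary, because the bit of the first comparison is
-- absorbed into it before the induction hypothesis is used. In front of `u` the large letter is
-- preceded by an ascent and followed by a descent; at the end of the word it adds no descent.
∑-insert-large : ∀ {n} {N} (v : ℤ) (us : Vec ℤ n) → 0ℤ ℤ.< N → v ℤ.< N → VAll (ℤ._< N) us → ∀ φ →
  ∑ꟳ (suc n) (λ p → φ (lastNegative v (insertAt us p N)) (des v (insertAt us p N)))
    ≡ insertions n φ (lastNegative v us) (des v us) + φ false (des v us)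
∑-insert-large {N = N} v Vec.[] 0<N v<N VAll.[] φ
  rewrite dec-false (N ℤₚ.<? 0ℤ) (ℤₚ.<-asym 0<N) | dec-false (N ℤₚ.<? v) (ℤₚ.<-asym v<N) =
  lem (φ (does (v ℤₚ.<? 0ℤ)) 0) (φ (does (v ℤₚ.<? 0ℤ)) 1) (φ false 0)
  where
  lem : ∀ a b c → c + 0ℤ ≡ 0ℤ * a + (0ℤ - 0ℤ) * b + c
  lem = solve-∀
∑-insert-large {suc n} {N} v (u Vec.∷ us) 0<N v<N (u<N VAll.∷ us<N) φ
  rewrite dec-false (N ℤₚ.<? v) (ℤₚ.<-asym v<N) | dec-true (u ℤₚ.<? N) u<N =
  trans (+-congˡ (φ ε (suc m)) (∑-insert-large u us 0<N u<N us<N (λ η d → φ η (bit (does (u ℤₚ.<? v)) ℕ.+ d))))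
        (lem (does (u ℤₚ.<? v)))
  where
  ε = lastNegative u us
  m = des u us
  lem₁ : ∀ a b c n k → a + (k * a + (n - k) * b + c) ≡ (1ℤ + k) * a + (1ℤ + n - (1ℤ + k)) * b + c
  lem₁ = solve-∀
  lem₂ : ∀ a b c n k → a + (k * b + (n - k) * a + c) ≡ k * b + (1ℤ + n - k) * a + c
  lem₂ = solve-∀
  lem : ∀ b → φ ε (suc m) + (insertions n (λ η d → φ η (bit b ℕ.+ d)) ε m + φ false (bit b ℕ.+ m)) ≡
              insertions (suc n) φ ε (bit b ℕ.+ m) + φ false (bit b ℕ.+ m)
  lem true  = lem₁ (φ ε (suc m)) (φ ε (suc (suc m))) (φ false (suc m)) (+ n) (+ m)
  lem false = lem₂ (φ ε (suc m)) (φ ε m) (φ false m) (+ n) (+ m)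

-- Mirror image of the large case, except at the end of the word: there a small letter closes a
-- descent and makes the last letter negative.
∑-insert-small : ∀ {n} {N} (v : ℤ) (us : Vec ℤ n) → N ℤ.< 0ℤ → N ℤ.< v → VAll (N ℤ.<_) us → ∀ φ →
  ∑ꟳ (suc n) (λ p → φ (lastNegative v (insertAt us p N)) (des v (insertAt us p N)))
    ≡ insertions n φ (lastNegative v us) (des v us) + φ true (suc (des v us))
∑-insert-small {N = N} v Vec.[] N<0 N<v VAll.[] φ
  rewrite dec-true (N ℤₚ.<? 0ℤ) N<0 | dec-true (N ℤₚ.<? v) N<v =
  lem (φ (does (v ℤₚ.<? 0ℤ)) 0) (φ (does (v ℤₚ.<? 0ℤ)) 1) (φ true 1)
  where
  lem : ∀ a b c → c + 0ℤ ≡ 0ℤ * a + (0ℤ - 0ℤ) * b + c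
  lem = solve-∀
∑-insert-small {suc n} {N} v (u Vec.∷ us) N<0 N<v (N<u VAll.∷ N<us) φ
  rewrite dec-true (N ℤₚ.<? v) N<v | dec-false (u ℤₚ.<? N) (ℤₚ.<-asym N<u) =
  trans (+-congˡ (φ ε (suc m)) (∑-insert-small u us N<0 N<u N<us (λ η d → φ η (bit (does (u ℤₚ.<? v)) ℕ.+ d))))
        (lem (does (u ℤₚ.<? v)))
  where
  ε = lastNegative u us
  m = des u us
  lem₁ : ∀ a b c n k → a + (k * a + (n - k) * b + c) ≡ (1ℤ + k) * a + (1ℤ + n - (1ℤ + k)) * b + c
  lem₁ = solve-∀
  lem₂ : ∀ a b c n k → a + (k * b + (n - k) * a + c) ≡ k * b + (1ℤ + n - k) * a + c
  lem₂ = solve-∀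
  lem : ∀ b → φ ε (suc m) + (insertions n (λ η d → φ η (bit b ℕ.+ d)) ε m + φ true (bit b ℕ.+ suc m)) ≡
              insertions (suc n) φ ε (bit b ℕ.+ m) + φ true (suc (bit b ℕ.+ m))
  lem true  = lem₁ (φ ε (suc m)) (φ ε (suc (suc m))) (φ true (suc (suc m))) (+ n) (+ m)
  lem false = lem₂ (φ ε (suc m)) (φ ε m) (φ true (suc m)) (+ n) (+ m)

◃-<-+ : ∀ σ {m n} → m ℕ.≤ n → σ ◃ m ℤ.< + suc n
◃-<-+ Sign.+ {zero}  m≤n = ℤ.+<+ (s≤s z≤n)
◃-<-+ Sign.+ {suc m} m≤n = ℤ.+<+ (s≤s m≤n)
◃-<-+ Sign.- {zero}  m≤n = ℤ.+<+ (s≤s z≤n)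
◃-<-+ Sign.- {suc m} m≤n = ℤ.-<+

-<-◃ : ∀ σ {m n} → m ℕ.≤ n → -[1+ n ] ℤ.< σ ◃ m
-<-◃ Sign.+ {zero}  m≤n = ℤ.-<+
-<-◃ Sign.+ {suc m} m≤n = ℤ.-<+
-<-◃ Sign.- {zero}  m≤n = ℤ.-<+
-<-◃ Sign.- {suc m} m≤n = ℤ.-<- m≤n

wordSum : (n : ℕ) → (Bool → ℕ → ℤ) → ℤ
wordSum n φ = ∑ᶻ (signedPerms n) (λ w → φ (lastNegative 0ℤ (tabulate (val w))) (des 0ℤ (tabulate (val w))))

wordSum-cong : ∀ n {φ ψ} → (∀ ε d → φ ε d ≡ ψ ε d) → wordSum n φ ≡ wordSum n ψ
wordSum-cong n e = ∑ᶻ-cong (signedPerms n) λ w → e _ _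

-- Before the end of the word both signs contribute the same `insertions`, hence the factor 2; the
-- other two terms are the letters n + 1 and -(n + 1) at the end.
wordSum-suc : ∀ n φ → wordSum (suc n) φ ≡
  wordSum n (λ ε d → + 2 * insertions n φ ε d + (φ false d + φ true (suc d)))
wordSum-suc n φ = trans (∑ᶻ-signedPerms F) (∑ᶻ-cong (signedPerms n) λ w →
  trans (cong₂ _+_
      (trans (∑ꟳ-cong (suc n) λ p → cong G (word-insert Sign.+ p w))
        (∑-insert-large 0ℤ (tabulate (val w)) (ℤ.+<+ (s≤s z≤n)) (ℤ.+<+ (s≤s z≤n))
          (VAllₚ.tabulate⁺ λ i → ◃-<-+ (lookup (proj₁ w) (lookup (proj₂ w) i)) (Finₚ.toℕ<n (lookup (proj₂ w) i))) φ))
      (trans (∑ꟳ-cong (suc n) λ p → cong G (word-insert Sign.- p w))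
        (∑-insert-small 0ℤ (tabulate (val w)) ℤ.-<+ ℤ.-<+
          (VAllₚ.tabulate⁺ λ i → -<-◃ (lookup (proj₁ w) (lookup (proj₂ w) i)) (Finₚ.toℕ<n (lookup (proj₂ w) i))) φ)))
    (lem (insertions n φ (lastNegative 0ℤ (tabulate (val w))) (des 0ℤ (tabulate (val w)))) _ _))
  where
  open Rearrangement (rotation n)
  G : ∀ {m} → Vec ℤ m → ℤ
  G us = φ (lastNegative 0ℤ us) (des 0ℤ us)
  F : SignedMap (suc n) → ℤ
  F w = G (tabulate (val w))
  lem : ∀ a b c → a + b + (a + c) ≡ + 2 * a + (b + c)
  lem = solve-∀

lastNegative-tabulate : ∀ {n} v (f : Fin (suc n) → ℤ) →
  lastNegative v (tabulate f) ≡ does (f (fromℕ n) ℤₚ.<? 0ℤ)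
lastNegative-tabulate {zero}  v f = refl
lastNegative-tabulate {suc n} v f = lastNegative-tabulate (f Fin.zero) (f ∘ Fin.suc)

0<?-◃ : ∀ σ m → does (0ℤ ℤₚ.<? σ ◃ suc m) ≡ not (does (σ ◃ suc m ℤₚ.<? 0ℤ))
0<?-◃ Sign.+ m = refl
0<?-◃ Sign.- m = refl

coeff-B⁺ : ∀ n k → coeff (B⁺ n) k ≡ wordSum n (λ ε d → 𝟙 (not ε) * δ k d)
coeff-B⁺ zero    zero    = refl
coeff-B⁺ zero    (suc k) = refl
coeff-B⁺ (suc m) k = begin
  coeff (B⁺ (suc m)) k
    ≡⟨ coeff-∑ (filter (λ w → 0ℤ ℤₚ.<? val w (fromℕ m)) (signedPerms (suc m))) (λ w → X^ desB w) k ⟩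
  ∑ᶻ (filter (λ w → 0ℤ ℤₚ.<? val w (fromℕ m)) (signedPerms (suc m))) (λ w → coeff (X^ desB w) k)
    ≡⟨ ∑ᶻ-filter (λ w → 0ℤ ℤₚ.<? val w (fromℕ m)) (signedPerms (suc m)) _ ⟩
  ∑ᶻ (signedPerms (suc m)) (λ w → ⟦ 0ℤ ℤₚ.<? val w (fromℕ m) ⟧ * coeff (X^ desB w) k)
    ≡⟨ ∑ᶻ-cong (signedPerms (suc m)) (λ w → cong₂ _*_
         (cong 𝟙 (trans (0<?-◃ (lookup (proj₁ w) (lookup (proj₂ w) (fromℕ m))) _)
           (cong not (sym (lastNegative-tabulate 0ℤ (val w))))))
         (trans (coeff-X^ (desB w) k) (cong (δ k) (des-lookup 0ℤ (tabulate (val w)))))) ⟩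
  wordSum (suc m) (λ ε d → 𝟙 (not ε) * δ k d) ∎
  where open ≡-Reasoning

coeff-B⁻ : ∀ n k → coeff (B⁻ n) k ≡ wordSum n (λ ε d → 𝟙 ε * δ k d)
coeff-B⁻ zero    zero    = refl
coeff-B⁻ zero    (suc k) = refl
coeff-B⁻ (suc m) k = begin
  coeff (B⁻ (suc m)) k
    ≡⟨ coeff-∑ (filter (λ w → val w (fromℕ m) ℤₚ.<? 0ℤ) (signedPerms (suc m))) (λ w → X^ desB w) k ⟩
  ∑ᶻ (filter (λ w → val w (fromℕ m) ℤₚ.<? 0ℤ) (signedPerms (suc m))) (λ w → coeff (X^ desB w) k)
    ≡⟨ ∑ᶻ-filter (λ w → val w (fromℕ m) ℤₚ.<? 0ℤ) (signedPerms (suc m)) _ ⟩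
  ∑ᶻ (signedPerms (suc m)) (λ w → ⟦ val w (fromℕ m) ℤₚ.<? 0ℤ ⟧ * coeff (X^ desB w) k)
    ≡⟨ ∑ᶻ-cong (signedPerms (suc m)) (λ w → cong₂ _*_
         (cong 𝟙 (sym (lastNegative-tabulate 0ℤ (val w))))
         (trans (coeff-X^ (desB w) k) (cong (δ k) (des-lookup 0ℤ (tabulate (val w)))))) ⟩
  wordSum (suc m) (λ ε d → 𝟙 ε * δ k d) ∎
  where open ≡-Reasoning

-- This trades a weight in the statistic d for a weight in the exponent k, which is how the operator
-- x d/dx enters.
δ-* : ∀ k d → + d * δ k d ≡ + k * δ k d
δ-* zero    zero    = refl
δ-* zero    (suc d) = ℤₚ.*-zeroʳ (+ suc d)
δ-* (suc k) zero    = sym (ℤₚ.*-zeroʳ (+ suc k))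
δ-* (suc k) (suc d) = begin
  (1ℤ + + d) * δ k d   ≡⟨ lem (+ d) (δ k d) ⟩
  δ k d + + d * δ k d  ≡⟨ +-congˡ (δ k d) (δ-* k d) ⟩
  δ k d + + k * δ k d  ≡⟨ lem (+ k) (δ k d) ⟨
  (1ℤ + + k) * δ k d   ∎
  where
  open ≡-Reasoning
  lem : ∀ a b → (1ℤ + a) * b ≡ b + a * b
  lem = solve-∀

-- Coefficients of 2x(1 - x)P′ + 2nxP for the polynomial P with coefficients a.
L : ℕ → (ℕ → ℤ) → ℕ → ℤ
L n a k = + 2 * (+ k * a k + (+ suc n - + k) * shift a k)

shift-∑ᶻ : ∀ {A : Set} (xs : List A) (f : ℕ → A → ℤ) k →
  shift (λ j → ∑ᶻ xs (f j)) k ≡ ∑ᶻ xs (λ x → shift (λ j → f j x) k)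
shift-∑ᶻ xs f zero    = sym (∑ᶻ-zero xs)
shift-∑ᶻ xs f (suc k) = refl

L-∑ᶻ : ∀ {A : Set} n (xs : List A) (f : ℕ → A → ℤ) k →
  L n (λ j → ∑ᶻ xs (f j)) k ≡ ∑ᶻ xs (λ x → L n (λ j → f j x) k)
L-∑ᶻ n xs f k = sym (trans (∑ᶻ-* xs (+ 2) _) (*-congˡ (+ 2) (trans (∑ᶻ-+ xs _ _)
  (cong₂ _+_ (∑ᶻ-* xs (+ k) (f k))
    (trans (∑ᶻ-* xs (+ suc n - + k) _) (*-congˡ (+ suc n - + k) (sym (shift-∑ᶻ xs f k))))))))

L-cong : ∀ n {a b} → (∀ k → a k ≡ b k) → ∀ k → L n a k ≡ L n b k
L-cong n e zero    = cong (λ z → + 2 * (0ℤ * z + (+ suc n - 0ℤ) * 0ℤ)) (e 0)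
L-cong n e (suc k) = cong₂ (λ y z → + 2 * (+ suc k * y + (+ suc n - + suc k) * z)) (e (suc k)) (e k)

-- `L n` sends x^d to 2(d x^d + (n - d) x^(d+1)), which is what the insertions before the end make
-- of one word; the rest is linearity.
L-δ : ∀ n c k d → + 2 * (+ d * (c * δ k d) + (+ n - + d) * (c * δ k (suc d))) ≡ L n (λ j → c * δ j d) k
L-δ n c zero d = trans (lem₁ c (+ n) (+ d) (δ 0 d))
    (trans (cong (λ z → + 2 * (c * z)) (δ-* 0 d)) (lem₂ c (δ 0 d) (+ suc n - 0ℤ)))
  where
  lem₁ : ∀ c n d x → + 2 * (d * (c * x) + (n - d) * (c * 0ℤ)) ≡ + 2 * (c * (d * x))
  lem₁ = solve-∀
  lem₂ : ∀ c x m → + 2 * (c * (0ℤ * x)) ≡ + 2 * (0ℤ * (c * x) + m * 0ℤ)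
  lem₂ = solve-∀
L-δ n c (suc k) d = trans (lem₁ c (+ n) (+ d) (δ (suc k) d) (δ k d))
    (trans (cong₂ (λ y z → + 2 * (c * y + c * (+ n * δ k d - z))) (δ-* (suc k) d) (δ-* k d))
      (lem₂ c (+ n) (+ k) (δ (suc k) d) (δ k d)))
  where
  lem₁ : ∀ c n d x y → + 2 * (d * (c * x) + (n - d) * (c * y)) ≡ + 2 * (c * (d * x) + c * (n * y - d * y))
  lem₁ = solve-∀
  lem₂ : ∀ c n k x y → + 2 * (c * ((1ℤ + k) * x) + c * (n * y - k * y)) ≡
                       + 2 * ((1ℤ + k) * (c * x) + (1ℤ + n - (1ℤ + k)) * (c * y))
  lem₂ = solve-∀

b⁺ b⁻ : ℕ → ℕ → ℤ
b⁺ n = coeff (B⁺ n)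
b⁻ n = coeff (B⁻ n)

δ-sucʳ : ∀ k d → δ k (suc d) ≡ shift (λ j → δ j d) k
δ-sucʳ zero    d = refl
δ-sucʳ (suc k) d = refl

wordSum-total : ∀ n k → wordSum n (λ ε d → δ k d) ≡ b⁺ n k + b⁻ n k
wordSum-total n k = sym (trans (cong₂ _+_ (coeff-B⁺ n k) (coeff-B⁻ n k))
  (trans (sym (∑ᶻ-+ (signedPerms n) _ _)) (wordSum-cong n λ ε d → lem ε (δ k d))))
  where
  lem : ∀ ε x → 𝟙 (not ε) * x + 𝟙 ε * x ≡ x
  lem true  x = trans (ℤₚ.+-identityˡ (1ℤ * x)) (ℤₚ.*-identityˡ x)
  lem false x = trans (ℤₚ.+-identityʳ (1ℤ * x)) (ℤₚ.*-identityˡ x)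

-- The last term comes from the letter n + 1 put at the end of an arbitrary word: the result ends
-- positively and has no new descent.
b⁺-suc : ∀ n k → b⁺ (suc n) k ≡ L n (b⁺ n) k + (b⁺ n k + b⁻ n k)
b⁺-suc n k = begin
  b⁺ (suc n) k ≡⟨ coeff-B⁺ (suc n) k ⟩
  wordSum (suc n) (λ ε d → 𝟙 (not ε) * δ k d) ≡⟨ wordSum-suc n (λ ε d → 𝟙 (not ε) * δ k d) ⟩
  wordSum n (λ ε d → + 2 * insertions n (λ η e → 𝟙 (not η) * δ k e) ε d + (1ℤ * δ k d + 0ℤ * δ k (suc d)))
    ≡⟨ wordSum-cong n (λ ε d → cong₂ _+_ (L-δ n (𝟙 (not ε)) k d) (lem (δ k d) (δ k (suc d)))) ⟩
  wordSum n (λ ε d → L n (λ j → 𝟙 (not ε) * δ j d) k + δ k d)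
    ≡⟨ ∑ᶻ-+ (signedPerms n) _ _ ⟩
  wordSum n (λ ε d → L n (λ j → 𝟙 (not ε) * δ j d) k) + wordSum n (λ ε d → δ k d)
    ≡⟨ cong₂ _+_ (sym (L-∑ᶻ n (signedPerms n) _ k)) (wordSum-total n k) ⟩
  L n (λ j → wordSum n (λ ε d → 𝟙 (not ε) * δ j d)) k + (b⁺ n k + b⁻ n k)
    ≡⟨ cong (λ z → z + (b⁺ n k + b⁻ n k)) (L-cong n (λ j → sym (coeff-B⁺ n j)) k) ⟩
  L n (b⁺ n) k + (b⁺ n k + b⁻ n k) ∎
  where
  open ≡-Reasoning
  lem : ∀ x y → 1ℤ * x + 0ℤ * y ≡ x
  lem = solve-∀

-- Here the last term is multiplied by x, since the letter -(n + 1) at the end always creates a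
-- descent.
b⁻-suc : ∀ n k → b⁻ (suc n) k ≡ L n (b⁻ n) k + shift (λ j → b⁺ n j + b⁻ n j) k
b⁻-suc n k = begin
  b⁻ (suc n) k ≡⟨ coeff-B⁻ (suc n) k ⟩
  wordSum (suc n) (λ ε d → 𝟙 ε * δ k d) ≡⟨ wordSum-suc n (λ ε d → 𝟙 ε * δ k d) ⟩
  wordSum n (λ ε d → + 2 * insertions n (λ η e → 𝟙 η * δ k e) ε d + (0ℤ * δ k d + 1ℤ * δ k (suc d)))
    ≡⟨ wordSum-cong n (λ ε d → cong₂ _+_ (L-δ n (𝟙 ε) k d) (trans (lem (δ k d) (δ k (suc d))) (δ-sucʳ k d))) ⟩
  wordSum n (λ ε d → L n (λ j → 𝟙 ε * δ j d) k + shift (λ j → δ j d) k)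
    ≡⟨ ∑ᶻ-+ (signedPerms n) _ _ ⟩
  wordSum n (λ ε d → L n (λ j → 𝟙 ε * δ j d) k) + wordSum n (λ ε d → shift (λ j → δ j d) k)
    ≡⟨ cong₂ _+_ (sym (L-∑ᶻ n (signedPerms n) _ k))
         (trans (sym (shift-∑ᶻ (signedPerms n) _ k)) (shift-cong (wordSum-total n) k)) ⟩
  L n (λ j → wordSum n (λ ε d → 𝟙 ε * δ j d)) k + shift (λ j → b⁺ n j + b⁻ n j) k
    ≡⟨ cong (λ z → z + shift (λ j → b⁺ n j + b⁻ n j) k) (L-cong n (λ j → sym (coeff-B⁻ n j)) k) ⟩
  L n (b⁻ n) k + shift (λ j → b⁺ n j + b⁻ n j) k ∎
  where
  open ≡-Reasoning
  lem : ∀ x y → 0ℤ * x + 1ℤ * y ≡ y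
  lem = solve-∀

-- Excedances

-- Exchanging i with the last index sends a_i to the new letter and the new letter to w(a_i), which
-- puts it into the cycle after a_i; for i = `fromℕ n` the new letter is a fixed point.
transposition : ∀ n → Rearrangement n
transposition n = record
  { τ      = λ i → transpose i (fromℕ n)
  ; τ⁻¹    = λ i → transpose (fromℕ n) i
  ; τ-τ⁻¹  = λ i j → transpose-inverse i (fromℕ n)
  ; τ⁻¹-τ  = λ i j → transpose-inverse (fromℕ n) i
  ; τ-self = λ i → transpose-self i (fromℕ n)
  }
  where
  transpose-self : ∀ {m} (i j : Fin m) → transpose i j i ≡ j
  transpose-self i j rewrite dec-true (i Fin.≟ i) refl = refl

transpose-last : ∀ {n} (i j : Fin n) → transpose i j j ≡ i
transpose-last i j with j Fin.≟ i
... | yes j≡i = j≡i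
... | no _ rewrite dec-true (j Fin.≟ j) refl = refl

transpose-other : ∀ {n} (i j k : Fin n) → k ≢ i → k ≢ j → transpose i j k ≡ k
transpose-other i j k k≢i k≢j rewrite dec-false (k Fin.≟ i) k≢i | dec-false (k Fin.≟ j) k≢j = refl

count : ∀ n → (Fin n → Bool) → ℕ
count zero    b = 0
count (suc n) b = bit (b Fin.zero) ℕ.+ count n (b ∘ Fin.suc)

length-filter-allFin : ∀ n {P : Pred (Fin n) 0ℓ} (P? : Decidable P) →
  length (filter P? (allFin n)) ≡ count n (does ∘ P?)
length-filter-allFin zero    P? = refl
length-filter-allFin (suc n) P? with does (P? Fin.zero)
... | true  = cong suc (trans (length-filter-tabulate P? Fin.suc) (length-filter-allFin n (P? ∘ Fin.suc)))
... | false = trans (length-filter-tabulate P? Fin.suc) (length-filter-allFin n (P? ∘ Fin.suc))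

count-cong : ∀ n {b c : Fin n → Bool} → (∀ i → b i ≡ c i) → count n b ≡ count n c
count-cong zero    e = refl
count-cong (suc n) e = cong₂ (λ x y → bit x ℕ.+ y) (e Fin.zero) (count-cong n (e ∘ Fin.suc))

count-last : ∀ n b → count (suc n) b ≡ count n (b ∘ inject₁) ℕ.+ bit (b (fromℕ n))
count-last zero    b = ℕₚ.+-comm (bit (b Fin.zero)) 0
count-last (suc n) b = trans (cong (bit (b Fin.zero) ℕ.+_) (count-last n (b ∘ Fin.suc)))
  (sym (ℕₚ.+-assoc (bit (b Fin.zero)) _ _))

-- Additive form of the change at i, which avoids subtraction in ℕ.
count-update : ∀ n {b c : Fin n → Bool} i → (∀ j → j ≢ i → c j ≡ b j) →
  count n c ℕ.+ bit (b i) ≡ count n b ℕ.+ bit (c i)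
count-update (suc n) {b} {c} Fin.zero e
  rewrite count-cong n (λ j → e (Fin.suc j) λ ()) = lem (bit (c Fin.zero)) _ (bit (b Fin.zero))
  where
  lem : ∀ x y z → x ℕ.+ y ℕ.+ z ≡ z ℕ.+ y ℕ.+ x
  lem = ℕ-RingSolver.solve-∀
count-update (suc n) {b} {c} (Fin.suc i) e
  rewrite e Fin.zero (λ ()) = trans (ℕₚ.+-assoc (bit (b Fin.zero)) _ _)
    (trans (cong (bit (b Fin.zero) ℕ.+_) (count-update n i λ j j≢i → e (Fin.suc j) (j≢i ∘ Finₚ.suc-injective)))
      (sym (ℕₚ.+-assoc (bit (b Fin.zero)) _ _)))

count-zero : ∀ n {b : Fin n → Bool} → (∀ i → b i ≡ false) → count n b ≡ 0
count-zero zero    e = refl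
count-zero (suc n) e rewrite e Fin.zero = count-zero n (e ∘ Fin.suc)

count-pos : ∀ n {b : Fin n → Bool} i → b i ≡ true → ∃[ m ] count n b ≡ suc m
count-pos (suc n) Fin.zero    e rewrite e = _ , refl
count-pos (suc n) {b} (Fin.suc i) e with count-pos n {b ∘ Fin.suc} i e
... | m , eq = bit (b Fin.zero) ℕ.+ m , trans (cong (bit (b Fin.zero) ℕ.+_) eq) (ℕₚ.+-suc (bit (b Fin.zero)) m)

-- These unfold to the Booleans of `excedance?` and of the test inside `derangement?`, so
-- `length-filter-allFin` alone turns `excB` into `excCount`.
isExcedance isPositiveFixed : ℤ → ℤ → Bool
isExcedance     e v = does ((e ℤₚ.<? v) ⊎-dec ((e ℤₚ.<? 0ℤ) ×-dec (v ℤₚ.≟ e)))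
isPositiveFixed e v = does ((0ℤ ℤₚ.<? e) ×-dec (v ℤₚ.≟ e))

excedance-or-fixed : ∀ e v → isExcedance e v ≡ true → isPositiveFixed e v ≡ true → ⊥
excedance-or-fixed e v p q = exclusive
  (holds ((e ℤₚ.<? v) ⊎-dec ((e ℤₚ.<? 0ℤ) ×-dec (v ℤₚ.≟ e))) p) (holds ((0ℤ ℤₚ.<? e) ×-dec (v ℤₚ.≟ e)) q)
  where
  holds : {P : Set} (P? : Dec P) → does P? ≡ true → P
  holds (yes p) _ = p
  exclusive : e ℤ.< v ⊎ e ℤ.< 0ℤ × v ≡ e → 0ℤ ℤ.< e × v ≡ e → ⊥
  exclusive (inj₁ e<v)       (_   , v≡e) = ℤₚ.<-irrefl (sym v≡e) e<v
  exclusive (inj₂ (e<0 , _)) (0<e , _)   = ℤₚ.<-asym e<0 0<e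

excCount fixCount : ∀ {n} → SignedMap n → ℕ
excCount {n} w = count n (λ i → isExcedance (elt w i) (val w i))
fixCount {n} w = count n (λ i → isPositiveFixed (elt w i) (val w i))

isPlus isMinus : Sign → Bool
isPlus Sign.+ = true
isPlus Sign.- = false
isMinus = not ∘ isPlus

Within : ℕ → ℤ → Set
Within n z = -[1+ n ] ℤ.< z × z ℤ.< + suc n

module _ (n : ℕ) where

  isExcedance-to-new : ∀ σ {e} → Within n e → isExcedance e (σ ◃ suc n) ≡ isPlus σ
  isExcedance-to-new Sign.+ {e} (_ , e<N) = dec-true ((e ℤₚ.<? + suc n) ⊎-dec ((e ℤₚ.<? 0ℤ) ×-dec (+ suc n ℤₚ.≟ e))) (inj₁ e<N)
  isExcedance-to-new Sign.- {e} (N<e , _) = dec-false ((e ℤₚ.<? -[1+ n ]) ⊎-dec ((e ℤₚ.<? 0ℤ) ×-dec (-[1+ n ] ℤₚ.≟ e)))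
    λ { (inj₁ e<N) → ℤₚ.<-asym e<N N<e ; (inj₂ (_ , refl)) → ℤₚ.<-irrefl refl N<e }

  isExcedance-from-new : ∀ σ {v} → Within n v → isExcedance (σ ◃ suc n) v ≡ isMinus σ
  isExcedance-from-new Sign.- {v} (N<v , _) = dec-true ((-[1+ n ] ℤₚ.<? v) ⊎-dec ((-[1+ n ] ℤₚ.<? 0ℤ) ×-dec (v ℤₚ.≟ -[1+ n ]))) (inj₁ N<v)
  isExcedance-from-new Sign.+ {v} (_ , v<N) = dec-false ((+ suc n ℤₚ.<? v) ⊎-dec ((+ suc n ℤₚ.<? 0ℤ) ×-dec (v ℤₚ.≟ + suc n)))
    λ { (inj₁ N<v) → ℤₚ.<-asym v<N N<v ; (inj₂ (ℤ.+<+ () , _)) }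

  isExcedance-new-fixed : ∀ σ → isExcedance (σ ◃ suc n) (σ ◃ suc n) ≡ isMinus σ
  isExcedance-new-fixed Sign.- = dec-true ((-[1+ n ] ℤₚ.<? -[1+ n ]) ⊎-dec ((-[1+ n ] ℤₚ.<? 0ℤ) ×-dec (-[1+ n ] ℤₚ.≟ -[1+ n ]))) (inj₂ (ℤ.-<+ , refl))
  isExcedance-new-fixed Sign.+ = dec-false ((+ suc n ℤₚ.<? + suc n) ⊎-dec ((+ suc n ℤₚ.<? 0ℤ) ×-dec (+ suc n ℤₚ.≟ + suc n)))
    λ { (inj₁ N<N) → ℤₚ.<-irrefl refl N<N ; (inj₂ (ℤ.+<+ () , _)) }

  ≢-new : ∀ σ {e} → Within n e → e ≢ σ ◃ suc n
  ≢-new Sign.+ (_ , e<N) refl = ℤₚ.<-irrefl refl e<N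
  ≢-new Sign.- (N<e , _) refl = ℤₚ.<-irrefl refl N<e

  isPositiveFixed-≢ : ∀ {e v} → v ≢ e → isPositiveFixed e v ≡ false
  isPositiveFixed-≢ {e} {v} v≢e = dec-false ((0ℤ ℤₚ.<? e) ×-dec (v ℤₚ.≟ e)) (v≢e ∘ proj₂)

  isPositiveFixed-new-fixed : ∀ σ → isPositiveFixed (σ ◃ suc n) (σ ◃ suc n) ≡ isPlus σ
  isPositiveFixed-new-fixed Sign.+ = dec-true ((0ℤ ℤₚ.<? + suc n) ×-dec (+ suc n ℤₚ.≟ + suc n)) (ℤ.+<+ (s≤s z≤n) , refl)
  isPositiveFixed-new-fixed Sign.- = dec-false ((0ℤ ℤₚ.<? -[1+ n ]) ×-dec (-[1+ n ] ℤₚ.≟ -[1+ n ])) (λ ())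

elt-within : ∀ {n} (w : SignedMap n) i → Within n (elt w i)
elt-within (s , _) i = -<-◃ (lookup s i) (Finₚ.toℕ<n i) , ◃-<-+ (lookup s i) (Finₚ.toℕ<n i)

∑ꟳ-classes : ∀ n (p q : Fin n → Bool) a b c →
  ∑ꟳ n (λ i → 𝟙 (p i) * a + 𝟙 (q i) * b + (1ℤ - 𝟙 (p i) - 𝟙 (q i)) * c) ≡
  + count n p * a + + count n q * b + (+ n - + count n p - + count n q) * c
∑ꟳ-classes zero    p q a b c = lem a b c
  where
  lem : ∀ a b c → 0ℤ ≡ 0ℤ * a + 0ℤ * b + (0ℤ - 0ℤ - 0ℤ) * c
  lem = solve-∀
∑ꟳ-classes (suc n) p q a b c = trans (+-congˡ (𝟙 (p Fin.zero) * a + 𝟙 (q Fin.zero) * b + (1ℤ - 𝟙 (p Fin.zero) - 𝟙 (q Fin.zero)) * c) (∑ꟳ-classes n (p ∘ Fin.suc) (q ∘ Fin.suc) a b c))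
  (trans (lem (𝟙 (p Fin.zero)) (𝟙 (q Fin.zero)) (+ n) (+ count n (p ∘ Fin.suc)) (+ count n (q ∘ Fin.suc)) a b c)
    (cong₂ (λ x y → x * a + y * b + (+ suc n - x - y) * c) (bit-+ (p Fin.zero) _) (bit-+ (q Fin.zero) _)))
  where
  lem : ∀ x y n k l a b c → x * a + y * b + (1ℤ - x - y) * c + (k * a + l * b + (n - k - l) * c) ≡
        (x + k) * a + (y + l) * b + (1ℤ + n - (x + k) - (y + l)) * c
  lem = solve-∀
  bit-+ : ∀ b m → 𝟙 b + + m ≡ + (bit b ℕ.+ m)
  bit-+ true  m = refl
  bit-+ false m = refl

module _ {n : ℕ} where
  open Rearrangement (transposition n)

  private
    inject₁≢fromℕ : ∀ {j : Fin n} → inject₁ j ≢ fromℕ n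
    inject₁≢fromℕ e = Finₚ.fromℕ≢inject₁ (sym e)

  module _ (σ : Sign) (w : SignedMap n) where

    -- The arrow a_i → w(a_i) is replaced by an arrow from a_i to the new letter and one from there
    -- to w(a_i). Exactly one of these is an excedance: the first for a positive letter, the second
    -- for a negative one.
    excCount-insert-inject₁ : ∀ i → excCount (insert σ (inject₁ i) w) ℕ.+ bit (isExcedance (elt w i) (val w i)) ≡ suc (excCount w)
    excCount-insert-inject₁ i = begin
      excCount w′ ℕ.+ bit (b i)
        ≡⟨ cong (ℕ._+ bit (b i)) (count-last n (λ k → isExcedance (elt w′ k) (val w′ k))) ⟩
      count n c ℕ.+ bit (isExcedance (elt w′ (fromℕ n)) (val w′ (fromℕ n))) ℕ.+ bit (b i)
        ≡⟨ cong (λ x → count n c ℕ.+ bit x ℕ.+ bit (b i)) (trans (cong₂ isExcedance (elt-insert-fromℕ σ (inject₁ i) w)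
             (val-insert-inject₁ σ (inject₁ i) w (fromℕ n) (transpose-last (inject₁ i) (fromℕ n))))
             (isExcedance-from-new n σ (elt-within w (lookup (proj₂ w) i)))) ⟩
      count n c ℕ.+ bit (isMinus σ) ℕ.+ bit (b i)
        ≡⟨ comm₁ (count n c) (bit (isMinus σ)) (bit (b i)) ⟩
      count n c ℕ.+ bit (b i) ℕ.+ bit (isMinus σ)
        ≡⟨ cong (ℕ._+ bit (isMinus σ)) (count-update n i other) ⟩
      excCount w ℕ.+ bit (c i) ℕ.+ bit (isMinus σ)
        ≡⟨ cong (λ x → excCount w ℕ.+ bit x ℕ.+ bit (isMinus σ)) (trans (cong₂ isExcedance (elt-insert-inject₁ σ (inject₁ i) w i)
             (val-insert-fromℕ σ (inject₁ i) w (inject₁ i) (τ-self (inject₁ i)))) (isExcedance-to-new n σ (elt-within w i))) ⟩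
      excCount w ℕ.+ bit (isPlus σ) ℕ.+ bit (isMinus σ)
        ≡⟨ total σ (excCount w) ⟩
      suc (excCount w) ∎
      where
      open ≡-Reasoning
      w′ = insert σ (inject₁ i) w
      b = λ j → isExcedance (elt w j) (val w j)
      c = λ j → isExcedance (elt w′ (inject₁ j)) (val w′ (inject₁ j))
      comm₁ : ∀ x y z → x ℕ.+ y ℕ.+ z ≡ x ℕ.+ z ℕ.+ y
      comm₁ = ℕ-RingSolver.solve-∀
      total : ∀ σ x → x ℕ.+ bit (isPlus σ) ℕ.+ bit (isMinus σ) ≡ suc x
      total Sign.+ x = trans (ℕₚ.+-identityʳ _) (ℕₚ.+-comm x 1)
      total Sign.- x = trans (cong (ℕ._+ 1) (ℕₚ.+-identityʳ x)) (ℕₚ.+-comm x 1)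
      other : ∀ j → j ≢ i → c j ≡ b j
      other j j≢i = cong₂ isExcedance (elt-insert-inject₁ σ (inject₁ i) w j)
        (val-insert-inject₁ σ (inject₁ i) w (inject₁ j) (transpose-other (inject₁ i) (fromℕ n) (inject₁ j) (j≢i ∘ Finₚ.inject₁-injective) inject₁≢fromℕ))

    -- Neither of the two new arrows is a fixed point, so the only possible change is that the
    -- broken arrow was one.
    fixCount-insert-inject₁ : ∀ i → fixCount (insert σ (inject₁ i) w) ℕ.+ bit (isPositiveFixed (elt w i) (val w i)) ≡ fixCount w
    fixCount-insert-inject₁ i = begin
      fixCount w′ ℕ.+ bit (b i)
        ≡⟨ cong (ℕ._+ bit (b i)) (count-last n (λ k → isPositiveFixed (elt w′ k) (val w′ k))) ⟩
      count n c ℕ.+ bit (isPositiveFixed (elt w′ (fromℕ n)) (val w′ (fromℕ n))) ℕ.+ bit (b i)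
        ≡⟨ cong (λ x → count n c ℕ.+ bit x ℕ.+ bit (b i)) (trans (cong₂ isPositiveFixed (elt-insert-fromℕ σ (inject₁ i) w)
             (val-insert-inject₁ σ (inject₁ i) w (fromℕ n) (transpose-last (inject₁ i) (fromℕ n))))
             (isPositiveFixed-≢ n (≢-new n σ (elt-within w (lookup (proj₂ w) i))))) ⟩
      count n c ℕ.+ 0 ℕ.+ bit (b i)
        ≡⟨ cong (ℕ._+ bit (b i)) (ℕₚ.+-identityʳ (count n c)) ⟩
      count n c ℕ.+ bit (b i)
        ≡⟨ count-update n i other ⟩
      fixCount w ℕ.+ bit (c i)
        ≡⟨ cong (λ x → fixCount w ℕ.+ bit x) (trans (cong₂ isPositiveFixed (elt-insert-inject₁ σ (inject₁ i) w i)
             (val-insert-fromℕ σ (inject₁ i) w (inject₁ i) (τ-self (inject₁ i)))) (isPositiveFixed-≢ n (≢-new n σ (elt-within w i) ∘ sym))) ⟩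
      fixCount w ℕ.+ 0
        ≡⟨ ℕₚ.+-identityʳ (fixCount w) ⟩
      fixCount w ∎
      where
      open ≡-Reasoning
      w′ = insert σ (inject₁ i) w
      b = λ j → isPositiveFixed (elt w j) (val w j)
      c = λ j → isPositiveFixed (elt w′ (inject₁ j)) (val w′ (inject₁ j))
      other : ∀ j → j ≢ i → c j ≡ b j
      other j j≢i = cong₂ isPositiveFixed (elt-insert-inject₁ σ (inject₁ i) w j)
        (val-insert-inject₁ σ (inject₁ i) w (inject₁ j) (transpose-other (inject₁ i) (fromℕ n) (inject₁ j) (j≢i ∘ Finₚ.inject₁-injective) inject₁≢fromℕ))

    count-insert-fromℕ : ∀ (f : ℤ → ℤ → Bool) →
      count (suc n) (λ k → f (elt (insert σ (fromℕ n) w) k) (val (insert σ (fromℕ n) w) k)) ≡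
      count n (λ k → f (elt w k) (val w k)) ℕ.+ bit (f (σ ◃ suc n) (σ ◃ suc n))
    count-insert-fromℕ f = trans (count-last n (λ k → f (elt (insert σ (fromℕ n) w) k) (val (insert σ (fromℕ n) w) k))) (cong₂ (λ x y → x ℕ.+ bit y)
      (count-cong n λ j → cong₂ f (elt-insert-inject₁ σ (fromℕ n) w j) (val-insert-inject₁ σ (fromℕ n) w (inject₁ j)
        (transpose-other (fromℕ n) (fromℕ n) (inject₁ j) inject₁≢fromℕ inject₁≢fromℕ)))
      (cong₂ f (elt-insert-fromℕ σ (fromℕ n) w) (val-insert-fromℕ σ (fromℕ n) w (fromℕ n) (τ-self (fromℕ n)))))

  -- The broken arrow is an excedance, a positive fixed point, or neither; in the last two cases the
  -- number of excedances grows. For f = 0 the value of `ℕ.pred` is multiplied by 0.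
  cycleInsertions : (ℕ → ℕ → ℤ) → ℕ → ℕ → ℤ
  cycleInsertions φ e f = + e * φ e f + + f * φ (suc e) (ℕ.pred f) + (+ n - + e - + f) * φ (suc e) f

  -- The last term is the new letter as a cycle of its own: a positive one is a new positive fixed
  -- point, a negative one counts as an excedance.
  ∑-insert-cycle : ∀ φ σ w →
    ∑ꟳ (suc n) (λ i → φ (excCount (insert σ i w)) (fixCount (insert σ i w))) ≡
    cycleInsertions φ (excCount w) (fixCount w)
      + φ (excCount w ℕ.+ bit (isMinus σ)) (fixCount w ℕ.+ bit (isPlus σ))
  ∑-insert-cycle φ σ w = trans (∑ꟳ-last n (λ i → φ (excCount (insert σ i w)) (fixCount (insert σ i w)))) (cong₂ _+_
      (trans (∑ꟳ-cong n λ i → classify (p i) (q i) X F (excCount (insert σ (inject₁ i) w)) (fixCount (insert σ (inject₁ i) w)) (excedance-or-fixed (elt w i) (val w i))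
               (excCount-insert-inject₁ σ w i) (fixCount-insert-inject₁ σ w i))
             (∑ꟳ-classes n p q (φ X F) (φ (suc X) (ℕ.pred F)) (φ (suc X) F)))
      (cong₂ φ (trans (count-insert-fromℕ σ w isExcedance) (cong (λ x → X ℕ.+ bit x) (isExcedance-new-fixed n σ)))
               (trans (count-insert-fromℕ σ w isPositiveFixed) (cong (λ x → F ℕ.+ bit x) (isPositiveFixed-new-fixed n σ)))))
    where
    X = excCount w
    F = fixCount w
    p q : Fin n → Bool
    p i = isExcedance (elt w i) (val w i)
    q i = isPositiveFixed (elt w i) (val w i)
    lem₁ : ∀ a b c → a ≡ 1ℤ * a + 0ℤ * b + (1ℤ - 1ℤ - 0ℤ) * c
    lem₁ = solve-∀
    lem₂ : ∀ a b c → b ≡ 0ℤ * a + 1ℤ * b + (1ℤ - 0ℤ - 1ℤ) * c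
    lem₂ = solve-∀
    lem₃ : ∀ a b c → c ≡ 0ℤ * a + 0ℤ * b + (1ℤ - 0ℤ - 0ℤ) * c
    lem₃ = solve-∀
    classify : ∀ p q X F X′ F′ → (p ≡ true → q ≡ true → ⊥) → X′ ℕ.+ bit p ≡ suc X → F′ ℕ.+ bit q ≡ F →
      φ X′ F′ ≡ 𝟙 p * φ X F + 𝟙 q * φ (suc X) (ℕ.pred F) + (1ℤ - 𝟙 p - 𝟙 q) * φ (suc X) F
    classify true  true  X F X′ F′ x _ _ = ⊥-elim (x refl refl)
    classify true  false X F X′ F′ _ e e′
      rewrite sym e′ | ℕₚ.+-identityʳ F′ | ℕₚ.suc-injective (trans (ℕₚ.+-comm 1 X′) e) =
      lem₁ (φ X F′) (φ (suc X) (ℕ.pred F′)) (φ (suc X) F′)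
    classify false true  X F X′ F′ _ e e′
      rewrite sym e′ | ℕₚ.+-comm F′ 1 | sym e | ℕₚ.+-identityʳ X′ = lem₂ (φ X (suc F′)) (φ X′ F′) (φ X′ (suc F′))
    classify false false X F X′ F′ _ e e′
      rewrite sym e′ | ℕₚ.+-identityʳ F′ | sym e | ℕₚ.+-identityʳ X′ = lem₃ (φ X F′) (φ X′ (ℕ.pred F′)) (φ X′ F′)

cycleSum : (n : ℕ) → (ℕ → ℕ → ℤ) → ℤ
cycleSum n φ = ∑ᶻ (signedPerms n) (λ w → φ (excCount w) (fixCount w))

cycleSum-cong : ∀ n {φ ψ} → (∀ e f → φ e f ≡ ψ e f) → cycleSum n φ ≡ cycleSum n ψ
cycleSum-cong n e = ∑ᶻ-cong (signedPerms n) λ w → e _ _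

cycleSum-suc : ∀ n φ → cycleSum (suc n) φ ≡
  cycleSum n (λ e f → + 2 * cycleInsertions {n} φ e f + (φ e (suc f) + φ (suc e) f))
cycleSum-suc n φ = trans (Rearrangement.∑ᶻ-signedPerms (transposition n) (λ w → φ (excCount w) (fixCount w)))
  (∑ᶻ-cong (signedPerms n) λ w → trans
    (cong₂ _+_ (trans (∑-insert-cycle φ Sign.+ w) (end₊ w)) (trans (∑-insert-cycle φ Sign.- w) (end₋ w)))
    (lem (C w) (φ (excCount w) (suc (fixCount w))) (φ (suc (excCount w)) (fixCount w))))
  where
  C : SignedMap n → ℤ
  C w = cycleInsertions {n} φ (excCount w) (fixCount w)
  end₊ : ∀ w → C w + φ (excCount w ℕ.+ 0) (fixCount w ℕ.+ 1) ≡ C w + φ (excCount w) (suc (fixCount w))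
  end₊ w = cong₂ (λ x y → C w + φ x y) (ℕₚ.+-identityʳ (excCount w)) (ℕₚ.+-comm (fixCount w) 1)
  end₋ : ∀ w → C w + φ (excCount w ℕ.+ 1) (fixCount w ℕ.+ 0) ≡ C w + φ (suc (excCount w)) (fixCount w)
  end₋ w = cong₂ (λ x y → C w + φ x y) (ℕₚ.+-comm (excCount w) 1) (ℕₚ.+-identityʳ (fixCount w))
  lem : ∀ a b c → a + b + (a + c) ≡ + 2 * a + (b + c)
  lem = solve-∀

-- e[ n ] f k counts the w ∈ B_n with f positive fixed points and k excedances.
e[_] : ℕ → ℕ → ℕ → ℤ
e[ n ] f k = cycleSum n (λ e g → δ f g * δ k e)

coeff-dB : ∀ n k → coeff (dB n) k ≡ e[ n ] 0 k
coeff-dB n k = trans (coeff-∑ (filter derangement? (signedPerms n)) (λ w → X^ excB w) k)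
  (trans (∑ᶻ-filter derangement? (signedPerms n) _)
    (∑ᶻ-cong (signedPerms n) λ w → cong₂ _*_ (derangement w)
      (trans (coeff-X^ (excB w) k) (cong (δ k) (length-filter-allFin n (excedance? w))))))
  where
  derangement : ∀ w → ⟦ derangement? w ⟧ ≡ δ 0 (fixCount w)
  derangement w = go (derangement? w)
    where
    fixed? : Decidable (λ i → 0ℤ ℤ.< elt w i × val w i ≡ elt w i)
    fixed? i = (0ℤ ℤₚ.<? elt w i) ×-dec (val w i ℤₚ.≟ elt w i)
    go : (d? : Dec (Derangement w)) → ⟦ d? ⟧ ≡ δ 0 (fixCount w)
    go (yes d) = cong (δ 0) (sym (count-zero n (λ i → dec-false (fixed? i) (λ p → d (i , p)))))
    go (no ¬d) with Finₚ.any? fixed?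
    ... | no ¬p       = ⊥-elim (¬d ¬p)
    ... | yes (i , p) = cong (δ 0) (sym (proj₂ (count-pos n i (dec-true (fixed? i) p))))

-- `L n` treats every arrow that is not an excedance as if breaking it kept f; the bracket corrects
-- this for the positive fixed points, f + 1 of which can be broken when one gets lost. The last two
-- terms are the new letter as a positive and as a negative fixed point.
e-suc : ∀ n f k → e[ suc n ] f k ≡
  L n (e[ n ] f) k + + 2 * (+ suc f * shift (e[ n ] (suc f)) k - + f * shift (e[ n ] f) k)
    + shift (λ g → e[ n ] g k) f + shift (e[ n ] f) k
e-suc n f k = begin
  e[ suc n ] f k
    ≡⟨ cycleSum-suc n (λ e g → δ f g * δ k e) ⟩
  cycleSum n (λ e g → + 2 * cycleInsertions {n} (λ e g → δ f g * δ k e) e g + (δ f (suc g) * δ k e + δ f g * δ k (suc e)))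
    ≡⟨ cycleSum-cong n pointwise ⟩
  cycleSum n (λ e g → L n (λ j → δ f g * δ j e) k
    + + 2 * (+ suc f * shift (λ j → δ (suc f) g * δ j e) k - + f * shift (λ j → δ f g * δ j e) k)
    + shift (λ i → δ i g * δ k e) f + shift (λ j → δ f g * δ j e) k)
    ≡⟨ split ⟩
  L n (e[ n ] f) k + + 2 * (+ suc f * shift (e[ n ] (suc f)) k - + f * shift (e[ n ] f) k)
    + shift (λ g → e[ n ] g k) f + shift (e[ n ] f) k ∎
  where
  open ≡-Reasoning
  P = signedPerms n

  *-shift : ∀ c a k → c * shift a k ≡ shift (λ j → c * a j) k
  *-shift c a zero    = ℤₚ.*-zeroʳ c
  *-shift c a (suc k) = refl

  lem-f : ∀ f g x → + g * (δ f (ℕ.pred g) * x) ≡ + suc f * (δ (suc f) g * x)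
  lem-f f zero    x = sym (trans (*-congˡ (+ suc f) (ℤₚ.*-zeroˡ x)) (ℤₚ.*-zeroʳ (+ suc f)))
  lem-f f (suc g) x = trans (sym (ℤₚ.*-assoc (+ suc g) (δ f g) x))
    (trans (cong (λ z → z * x) (δ-* (suc f) (suc g))) (ℤₚ.*-assoc (+ suc f) (δ f g) x))

  lem-g : ∀ f g x → + g * (δ f g * x) ≡ + f * (δ f g * x)
  lem-g f g x = trans (sym (ℤₚ.*-assoc (+ g) (δ f g) x))
    (trans (cong (λ z → z * x) (δ-* f g)) (ℤₚ.*-assoc (+ f) (δ f g) x))

  rearrange : ∀ n e g A B D U V → + 2 * (e * A + g * B + (n - e - g) * D) + (U + V) ≡
    + 2 * (e * A + (n - e) * D) + + 2 * (g * B - g * D) + U + V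
  rearrange = solve-∀

  pointwise : ∀ e g → + 2 * cycleInsertions {n} (λ e g → δ f g * δ k e) e g + (δ f (suc g) * δ k e + δ f g * δ k (suc e)) ≡
    L n (λ j → δ f g * δ j e) k
    + + 2 * (+ suc f * shift (λ j → δ (suc f) g * δ j e) k - + f * shift (λ j → δ f g * δ j e) k)
    + shift (λ i → δ i g * δ k e) f + shift (λ j → δ f g * δ j e) k
  pointwise e g = trans
    (rearrange (+ n) (+ e) (+ g) (δ f g * δ k e) (δ f (ℕ.pred g) * δ k (suc e)) (δ f g * δ k (suc e)) (δ f (suc g) * δ k e) (δ f g * δ k (suc e)))
    (cong₂ _+_ (cong₂ _+_ (cong₂ _+_ (L-δ n (δ f g) k e)
      (cong₂ (λ x y → + 2 * (x - y))
        (trans (lem-f f g (δ k (suc e))) (*-congˡ (+ suc f) (s₂ (δ (suc f) g))))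
        (trans (lem-g f g (δ k (suc e))) (*-congˡ (+ f) (s₂ (δ f g))))))
      (s₁ f)) (s₂ (δ f g)))
    where
    s₁ : ∀ f → δ f (suc g) * δ k e ≡ shift (λ i → δ i g * δ k e) f
    s₁ zero    = ℤₚ.*-zeroˡ (δ k e)
    s₁ (suc f) = refl
    s₂ : ∀ c → c * δ k (suc e) ≡ shift (λ j → c * δ j e) k
    s₂ c = trans (*-congˡ c (δ-sucʳ k e)) (*-shift c (λ j → δ j e) k)

  split : _ ≡ _
  split = trans (∑ᶻ-+ P _ _) (cong₂ _+_ (trans (∑ᶻ-+ P _ _) (cong₂ _+_ (trans (∑ᶻ-+ P _ _) (cong₂ _+_
    (sym (L-∑ᶻ n P _ k))
    (trans (∑ᶻ-* P (+ 2) _) (*-congˡ (+ 2) (trans (∑ᶻ-+ P _ _) (cong₂ _+_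
      (trans (∑ᶻ-* P (+ suc f) _) (*-congˡ (+ suc f) (sym (shift-∑ᶻ P _ k))))
      (trans (∑ᶻ-neg P _) (cong -_ (trans (∑ᶻ-* P (+ f) _) (*-congˡ (+ f) (sym (shift-∑ᶻ P _ k)))))))))))) 
    (sym (shift-∑ᶻ P _ f)))) (sym (shift-∑ᶻ P _ k)))

-- Binomial transforms

-- The n-th forward difference of G at 0; `∑-binomial` identifies it with the alternating sum.
β : ℕ → (ℕ → ℤ) → ℤ
β zero    G = G 0
β (suc n) G = β n (G ∘ suc) - β n G

β-cong : ∀ n {F G} → (∀ j → F j ≡ G j) → β n F ≡ β n G
β-cong zero    e = e 0
β-cong (suc n) e = cong₂ _-_ (β-cong n (e ∘ suc)) (β-cong n e)

β-+ : ∀ n F G → β n (λ j → F j + G j) ≡ β n F + β n G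
β-+ zero    F G = refl
β-+ (suc n) F G = trans (cong₂ _-_ (β-+ n (F ∘ suc) (G ∘ suc)) (β-+ n F G))
  (lem (β n (F ∘ suc)) (β n (G ∘ suc)) (β n F) (β n G))
  where
  lem : ∀ a b c d → a + b - (c + d) ≡ a - c + (b - d)
  lem = solve-∀

β-* : ∀ n c F → β n (λ j → c * F j) ≡ c * β n F
β-* zero    c F = refl
β-* (suc n) c F = trans (cong₂ _-_ (β-* n c (F ∘ suc)) (β-* n c F)) (lem c (β n (F ∘ suc)) (β n F))
  where
  lem : ∀ c a b → c * a - c * b ≡ c * (a - b)
  lem = solve-∀

-- Leibniz rule for differences: at 0 only the first difference of the factor j, which is 1,
-- survives.
β-index-suc : ∀ n F → β (suc n) (λ j → + j * F j) ≡ + suc n * β n (F ∘ suc)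
β-index-suc zero    F = lem (F 0) (F 1)
  where
  lem : ∀ a b → 1ℤ * b - 0ℤ * a ≡ 1ℤ * b
  lem = solve-∀
β-index-suc (suc n) F = begin
  β (suc n) (λ j → + suc j * F (suc j)) - β (suc n) (λ j → + j * F j)
    ≡⟨ cong₂ _-_ (trans (β-cong (suc n) (λ j → split (+ j) (F (suc j)))) (β-+ (suc n) (λ j → + j * F (suc j)) (F ∘ suc)))
                 (β-index-suc n F) ⟩
  β (suc n) (λ j → + j * F (suc j)) + β (suc n) (F ∘ suc) - + suc n * β n (F ∘ suc)
    ≡⟨ cong (λ z → z + β (suc n) (F ∘ suc) - + suc n * β n (F ∘ suc)) (β-index-suc n (F ∘ suc)) ⟩
  + suc n * β n (F ∘ suc ∘ suc) + (β n (F ∘ suc ∘ suc) - β n (F ∘ suc)) - + suc n * β n (F ∘ suc)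
    ≡⟨ lem (+ suc n) (β n (F ∘ suc ∘ suc)) (β n (F ∘ suc)) ⟩
  + suc (suc n) * (β n (F ∘ suc ∘ suc) - β n (F ∘ suc)) ∎
  where
  open ≡-Reasoning
  split : ∀ j x → (1ℤ + j) * x ≡ j * x + x
  split = solve-∀
  lem : ∀ n a b → n * a + (a - b) - n * b ≡ (1ℤ + n) * (a - b)
  lem = solve-∀

-- The difference of the shifted sequence is rewritten by the recursion of `β`. The second summand
-- is the origin of the terms with n - 1 in the recurrences; at n = 0 the factor n hides the value
-- of `ℕ.pred`.
β-index : ∀ n F → β n (λ j → + j * F j) ≡ + n * (β n F + β (ℕ.pred n) F)
β-index zero    F = trans (ℤₚ.*-zeroˡ (F 0)) (sym (ℤₚ.*-zeroˡ (F 0 + F 0)))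
β-index (suc n) F = trans (β-index-suc n F) (lem (+ suc n) (β n (F ∘ suc)) (β n F))
  where
  lem : ∀ c a b → c * a ≡ c * (a - b + b)
  lem = solve-∀

β-zero : ∀ n → β n (λ _ → 0ℤ) ≡ 0ℤ
β-zero zero    = refl
β-zero (suc n) = cong₂ _-_ (β-zero n) (β-zero n)

β-shift : ∀ n (F : ℕ → ℕ → ℤ) k → β n (λ j → shift (F j) k) ≡ shift (λ i → β n (λ j → F j i)) k
β-shift n F zero    = β-zero n
β-shift n F (suc k) = refl

-- `L j` depends on j only through the summand 2jx, and `β-index` evaluates that one.
β-L : ∀ n (F : ℕ → ℕ → ℤ) k → β n (λ j → L j (F j) k) ≡
  L n (λ i → β n (λ j → F j i)) k + + 2 * (+ n * shift (λ i → β (ℕ.pred n) (λ j → F j i)) k)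
β-L n F k = begin
  β n (λ j → L j (F j) k)
    ≡⟨ β-cong n (λ j → expand (+ j) (+ k) (F j k) (shift (F j) k)) ⟩
  β n (λ j → + 2 * (+ k * F j k) + (+ 2 * ((1ℤ - + k) * shift (F j) k) + + 2 * (+ j * shift (F j) k)))
    ≡⟨ β-+ n (λ j → + 2 * (+ k * F j k)) _ ⟩
  β n (λ j → + 2 * (+ k * F j k)) + β n (λ j → + 2 * ((1ℤ - + k) * shift (F j) k) + + 2 * (+ j * shift (F j) k))
    ≡⟨ cong₂ _+_ (scale (+ k) (λ j → F j k))
         (trans (β-+ n (λ j → + 2 * ((1ℤ - + k) * shift (F j) k)) _)
           (cong₂ _+_ (scale (1ℤ - + k) (λ j → shift (F j) k))
             (trans (β-* n (+ 2) (λ j → + j * shift (F j) k)) (*-congˡ (+ 2) (β-index n (λ j → shift (F j) k)))))) ⟩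
  + 2 * (+ k * β n (λ j → F j k)) + (+ 2 * ((1ℤ - + k) * β n (λ j → shift (F j) k))
    + + 2 * (+ n * (β n (λ j → shift (F j) k) + β (ℕ.pred n) (λ j → shift (F j) k))))
    ≡⟨ collect (+ n) (+ k) (β n (λ j → F j k)) (β n (λ j → shift (F j) k)) (β (ℕ.pred n) (λ j → shift (F j) k)) ⟩
  + 2 * (+ k * β n (λ j → F j k) + (+ suc n - + k) * β n (λ j → shift (F j) k))
    + + 2 * (+ n * β (ℕ.pred n) (λ j → shift (F j) k))
    ≡⟨ cong₂ (λ x y → + 2 * (+ k * β n (λ j → F j k) + (+ suc n - + k) * x) + + 2 * (+ n * y))
         (β-shift n F k) (β-shift (ℕ.pred n) F k) ⟩
  L n (λ i → β n (λ j → F j i)) k + + 2 * (+ n * shift (λ i → β (ℕ.pred n) (λ j → F j i)) k) ∎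
  where
  open ≡-Reasoning
  expand : ∀ j k a b → + 2 * (k * a + (1ℤ + j - k) * b) ≡ + 2 * (k * a) + (+ 2 * ((1ℤ - k) * b) + + 2 * (j * b))
  expand = solve-∀
  collect : ∀ n k a b c → + 2 * (k * a) + (+ 2 * ((1ℤ - k) * b) + + 2 * (n * (b + c))) ≡
                          + 2 * (k * a + (1ℤ + n - k) * b) + + 2 * (n * c)
  collect = solve-∀
  scale : ∀ c G → β n (λ j → + 2 * (c * G j)) ≡ + 2 * (c * β n G)
  scale c G = trans (β-* n (+ 2) (λ j → c * G j)) (*-congˡ (+ 2) (β-* n c G))

nC0≡1 : ∀ n → n C 0 ≡ 1
nC0≡1 n = trans (nCk≡nC[n∸k] {k = 0} {n} z≤n) (nCn≡1 n)

∑ᶻ-applyUpTo-cong : ∀ {f g : ℕ → ℕ} {F G : ℕ → ℤ} m → (∀ j → F (f j) ≡ G (g j)) → ∑ᶻ (applyUpTo f m) F ≡ ∑ᶻ (applyUpTo g m) G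
∑ᶻ-applyUpTo-cong zero    e = refl
∑ᶻ-applyUpTo-cong (suc m) e = cong₂ _+_ (e 0) (∑ᶻ-applyUpTo-cong m (e ∘ suc))

∑ᶻ-applyUpTo-last : ∀ (f : ℕ → ℕ) F m → ∑ᶻ (applyUpTo f (suc m)) F ≡ ∑ᶻ (applyUpTo f m) F + F (f m)
∑ᶻ-applyUpTo-last f F zero    = ℤₚ.+-comm (F (f 0)) 0ℤ
∑ᶻ-applyUpTo-last f F (suc m) = trans (+-congˡ (F (f 0)) (∑ᶻ-applyUpTo-last (f ∘ suc) F m)) (sym (ℤₚ.+-assoc (F (f 0)) _ _))

-- Induction by Pascal's rule: the sum for n + 1 splits into the sum for n with shifted argument
-- minus the sum for n.
∑-binomial : ∀ n G → ∑ᶻ (upTo (suc n)) (λ j → -1ℤ ℤ.^ (n ∸ j) * + (n C j) * G j) ≡ β n G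
∑-binomial zero    G = lem (G 0)
  where
  lem : ∀ x → 1ℤ * 1ℤ * x + 0ℤ ≡ x
  lem = solve-∀
∑-binomial (suc n) G = begin
  s (suc n) 0 * G 0 + ∑ᶻ (applyUpTo suc (suc n)) (λ j → s (suc n) j * G j)
    ≡⟨ cong₂ (λ x y → x * G 0 + y) s-zero (∑ᶻ-applyUpTo-cong {suc} {id} {λ j → s (suc n) j * G j} (suc n) (λ j → trans (cong (λ z → z * G (suc j)) (s-suc j)) (distrib (s n j) (s n (suc j)) (G (suc j))))) ⟩
  - s n 0 * G 0 + ∑ᶻ (upTo (suc n)) (λ j → s n j * G (suc j) + -1ℤ * (s n (suc j) * G (suc j)))
    ≡⟨ +-congˡ (- s n 0 * G 0) (trans (∑ᶻ-+ (upTo (suc n)) (λ j → s n j * G (suc j)) _) (cong₂ _+_ (∑-binomial n (G ∘ suc)) (∑ᶻ-* (upTo (suc n)) -1ℤ (λ j → s n (suc j) * G (suc j))))) ⟩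
  - s n 0 * G 0 + (β n (G ∘ suc) + -1ℤ * ∑ᶻ (upTo (suc n)) (λ j → s n (suc j) * G (suc j)))
    ≡⟨ collect (s n 0) (G 0) (β n (G ∘ suc)) (∑ᶻ (upTo (suc n)) (λ j → s n (suc j) * G (suc j))) ⟩
  β n (G ∘ suc) - (s n 0 * G 0 + ∑ᶻ (upTo (suc n)) (λ j → s n (suc j) * G (suc j)))
    ≡⟨ cong (λ z → β n (G ∘ suc) - (s n 0 * G 0 + z)) (∑ᶻ-applyUpTo-cong {id} {suc} {λ j → s n (suc j) * G (suc j)} {λ j → s n j * G j} (suc n) (λ j → refl)) ⟩
  β n (G ∘ suc) - ∑ᶻ (upTo (suc (suc n))) (λ j → s n j * G j)
    ≡⟨ cong (λ z → β n (G ∘ suc) - z) (trans (∑ᶻ-applyUpTo-last id (λ j → s n j * G j) (suc n))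
         (trans (cong₂ _+_ (∑-binomial n G) s-last) (ℤₚ.+-identityʳ (β n G)))) ⟩
  β n (G ∘ suc) - β n G ∎
  where
  open ≡-Reasoning
  s : ℕ → ℕ → ℤ
  s n j = -1ℤ ℤ.^ (n ∸ j) * + (n C j)
  distrib : ∀ a b c → (a + -1ℤ * b) * c ≡ a * c + -1ℤ * (b * c)
  distrib = solve-∀
  collect : ∀ s g b t → - s * g + (b + -1ℤ * t) ≡ b - (s * g + t)
  collect = solve-∀
  neg : ∀ a b → -1ℤ * a * b ≡ - (a * b)
  neg = solve-∀
  s-zero : s (suc n) 0 ≡ - s n 0
  s-zero = trans (cong (λ c → -1ℤ * -1ℤ ℤ.^ n * + c) (trans (nC0≡1 (suc n)) (sym (nC0≡1 n)))) (neg (-1ℤ ℤ.^ n) (+ (n C 0)))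
  -- The index n + 1 lies outside row n, so the sum may be extended by it.
  s-last : s n (suc n) * G (suc n) ≡ 0ℤ
  s-last = trans (cong (λ c → -1ℤ ℤ.^ (n ∸ suc n) * + c * G (suc n)) (k>n⇒nCk≡0 (ℕₚ.n<1+n n))) (lem (-1ℤ ℤ.^ (n ∸ suc n)) (G (suc n)))
    where
    lem : ∀ a b → a * 0ℤ * b ≡ 0ℤ
    lem = solve-∀
  -- Lowering the exponent by one changes the sign. For j ≥ n the truncated exponents agree, but
  -- then the binomial coefficient is 0.
  alternate : ∀ j → -1ℤ ℤ.^ (n ∸ j) * + (n C suc j) ≡ -1ℤ * s n (suc j)
  alternate j with suc j ℕₚ.≤? n
  ... | yes j<n = trans (cong (λ m → -1ℤ ℤ.^ m * + (n C suc j)) (ℕₚ.+-∸-assoc 1 j<n)) (ℤₚ.*-assoc -1ℤ (-1ℤ ℤ.^ (n ∸ suc j)) (+ (n C suc j)))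
  ... | no  j≮n rewrite k>n⇒nCk≡0 (ℕₚ.≰⇒> j≮n) = lem (-1ℤ ℤ.^ (n ∸ j)) (-1ℤ ℤ.^ (n ∸ suc j))
    where
    lem : ∀ a b → a * 0ℤ ≡ -1ℤ * (b * 0ℤ)
    lem = solve-∀
  s-suc : ∀ j → s (suc n) (suc j) ≡ s n j + -1ℤ * s n (suc j)
  s-suc j = trans (cong (λ c → -1ℤ ℤ.^ (n ∸ j) * + c) (sym (nCk+nC[k+1]≡[n+1]C[k+1] n j)))
    (trans (ℤₚ.*-distribˡ-+ (-1ℤ ℤ.^ (n ∸ j)) (+ (n C j)) (+ (n C suc j))) (+-congˡ (s n j) (alternate j)))

coeff-binomialTransform : ∀ F n k → coeff (binomialTransform F n) k ≡ β n (λ j → coeff (F j) k)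
coeff-binomialTransform F n k = trans (coeff-∑ (upTo (suc n)) (λ j → (-1ℤ ℤ.^ (n ∸ j) * + (n C j)) · F j) k)
  (trans (∑ᶻ-cong (upTo (suc n)) λ j → coeff-· (-1ℤ ℤ.^ (n ∸ j) * + (n C j)) (F j) k) (∑-binomial n (λ j → coeff (F j) k)))

-- Recurrences for the transforms and the derangement polynomial

β⁺ β⁻ β± : ℕ → ℕ → ℤ
β⁺ n k = β n (λ j → b⁺ j k)
β⁻ n k = β n (λ j → b⁻ j k)
β± n k = β⁺ n k + β⁻ n k

-- The difference subtracts pₙ, which cancels one part of the contribution pₙ + qₙ of the positive
-- letters at the end and leaves qₙ.
β⁺-suc : ∀ n k → β⁺ (suc n) k ≡ L n (β⁺ n) k + + 2 * (+ n * shift (β⁺ (ℕ.pred n)) k) + β⁻ n k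
β⁺-suc n k = begin
  β n (λ j → b⁺ (suc j) k) - β⁺ n k
    ≡⟨ cong (λ z → z - β⁺ n k) (trans (β-cong n (λ j → b⁺-suc j k)) (trans (β-+ n (λ j → L j (b⁺ j) k) _)
         (cong₂ _+_ (β-L n b⁺ k) (β-+ n (λ j → b⁺ j k) (λ j → b⁻ j k))))) ⟩
  L n (β⁺ n) k + + 2 * (+ n * shift (β⁺ (ℕ.pred n)) k) + (β⁺ n k + β⁻ n k) - β⁺ n k
    ≡⟨ lem (L n (β⁺ n) k + + 2 * (+ n * shift (β⁺ (ℕ.pred n)) k)) (β⁺ n k) (β⁻ n k) ⟩
  L n (β⁺ n) k + + 2 * (+ n * shift (β⁺ (ℕ.pred n)) k) + β⁻ n k ∎
  where
  open ≡-Reasoning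
  lem : ∀ a b c → a + (b + c) - b ≡ a + c
  lem = solve-∀

shift-+ : ∀ a b k → shift (λ j → a j + b j) k ≡ shift a k + shift b k
shift-+ a b zero    = refl
shift-+ a b (suc k) = refl

shift-* : ∀ c a k → shift (λ j → c * a j) k ≡ c * shift a k
shift-* c a zero    = sym (ℤₚ.*-zeroʳ c)
shift-* c a (suc k) = refl

β⁻-suc : ∀ n k → β⁻ (suc n) k ≡ L n (β⁻ n) k + + 2 * (+ n * shift (β⁻ (ℕ.pred n)) k) + (shift (β⁺ n) k + shift (β⁻ n) k) - β⁻ n k
β⁻-suc n k = cong (λ z → z - β⁻ n k) (trans (β-cong n (λ j → b⁻-suc j k)) (trans (β-+ n (λ j → L j (b⁻ j) k) _)
  (cong₂ _+_ (β-L n b⁻ k) (trans (β-shift n (λ j i → b⁺ j i + b⁻ j i) k)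
    (trans (shift-cong (λ i → β-+ n (λ j → b⁺ j i) (λ j → b⁻ j i)) k) (shift-+ (β⁺ n) (β⁻ n) k))))))

-- The terms qₙ and -qₙ of the two recurrences cancel, so that the sum satisfies a recurrence of its
-- own.
β±-suc : ∀ n k → β± (suc n) k ≡ L n (β± n) k + + 2 * (+ n * shift (β± (ℕ.pred n)) k) + shift (β± n) k
β±-suc n k = trans (cong₂ _+_ (β⁺-suc n k) (β⁻-suc n k))
  (trans (lem (+ n) (+ k) (β⁺ n k) (β⁻ n k) (shift (β⁺ n) k) (shift (β⁻ n) k) (shift (β⁺ (ℕ.pred n)) k) (shift (β⁻ (ℕ.pred n)) k))
    (sym (cong₂ (λ x y → + 2 * (+ k * β± n k + (+ suc n - + k) * x) + + 2 * (+ n * y) + x)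
      (shift-+ (β⁺ n) (β⁻ n) k) (shift-+ (β⁺ (ℕ.pred n)) (β⁻ (ℕ.pred n)) k))))
  where
  lem : ∀ n k a b s t u v →
    + 2 * (k * a + (1ℤ + n - k) * s) + + 2 * (n * u) + b + (+ 2 * (k * b + (1ℤ + n - k) * t) + + 2 * (n * v) + (s + t) - b) ≡
    + 2 * (k * (a + b) + (1ℤ + n - k) * (s + t)) + + 2 * (n * (u + v)) + (s + t)
  lem = solve-∀

-- Absorption, with n - f taken in ℤ so that it also holds for f > n.
C-absorb : ∀ n f → + suc f * + (n C suc f) ≡ (+ n - + f) * + (n C f)
C-absorb zero    zero    = refl
C-absorb zero    (suc f) rewrite k>n⇒nCk≡0 {0} {suc f} (s≤s z≤n) | k>n⇒nCk≡0 {0} {suc (suc f)} (s≤s z≤n) =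
  trans (ℤₚ.*-zeroʳ (+ suc (suc f))) (sym (ℤₚ.*-zeroʳ (0ℤ - + suc f)))
C-absorb (suc n) zero    = begin
  1ℤ * + (suc n C 1)             ≡⟨ cong (λ c → 1ℤ * + c) (nCk+nC[k+1]≡[n+1]C[k+1] n 0) ⟨
  1ℤ * (+ (n C 0) + + (n C 1))   ≡⟨ lem₁ (+ (n C 0)) (+ (n C 1)) ⟩
  + (n C 0) + 1ℤ * + (n C 1)     ≡⟨ +-congˡ (+ (n C 0)) (C-absorb n 0) ⟩
  + (n C 0) + (+ n - 0ℤ) * + (n C 0) ≡⟨ lem₂ (+ n) (+ (n C 0)) ⟩
  (+ suc n - 0ℤ) * + (n C 0)     ≡⟨ cong (λ c → (+ suc n - 0ℤ) * + c) (trans (nC0≡1 n) (sym (nC0≡1 (suc n)))) ⟩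
  (+ suc n - 0ℤ) * + (suc n C 0) ∎
  where
  open ≡-Reasoning
  lem₁ : ∀ a b → 1ℤ * (a + b) ≡ a + 1ℤ * b
  lem₁ = solve-∀
  lem₂ : ∀ n a → a + (n - 0ℤ) * a ≡ (1ℤ + n - 0ℤ) * a
  lem₂ = solve-∀
C-absorb (suc n) (suc f) = begin
  + suc (suc f) * + (suc n C suc (suc f))
    ≡⟨ cong (λ c → + suc (suc f) * + c) (nCk+nC[k+1]≡[n+1]C[k+1] n (suc f)) ⟨
  + suc (suc f) * (+ (n C suc f) + + (n C suc (suc f)))
    ≡⟨ ℤₚ.*-distribˡ-+ (+ suc (suc f)) (+ (n C suc f)) (+ (n C suc (suc f))) ⟩
  + suc (suc f) * + (n C suc f) + + suc (suc f) * + (n C suc (suc f))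
    ≡⟨ +-congˡ (+ suc (suc f) * + (n C suc f)) (C-absorb n (suc f)) ⟩
  + suc (suc f) * + (n C suc f) + (+ n - + suc f) * + (n C suc f)
    ≡⟨ lem₁ (+ n) (+ f) (+ (n C suc f)) ⟩
  + suc f * + (n C suc f) + (+ n - + f) * + (n C suc f)
    ≡⟨ cong (λ z → z + (+ n - + f) * + (n C suc f)) (C-absorb n f) ⟩
  (+ n - + f) * + (n C f) + (+ n - + f) * + (n C suc f)
    ≡⟨ lem₂ (+ n) (+ f) (+ (n C f)) (+ (n C suc f)) ⟩
  (+ suc n - + suc f) * (+ (n C f) + + (n C suc f))
    ≡⟨ cong (λ c → (+ suc n - + suc f) * + c) (nCk+nC[k+1]≡[n+1]C[k+1] n f) ⟩
  (+ suc n - + suc f) * + (suc n C suc f) ∎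
  where
  open ≡-Reasoning
  lem₁ : ∀ n f c → (1ℤ + (1ℤ + f)) * c + (n - (1ℤ + f)) * c ≡ (1ℤ + f) * c + (n - f) * c
  lem₁ = solve-∀
  lem₂ : ∀ n f b c → (n - f) * b + (n - f) * c ≡ (1ℤ + n - (1ℤ + f)) * (b + c)
  lem₂ = solve-∀

-- The meaning is that the f positive fixed points are chosen from n and the rest is a derangement.
-- Instead of a bijection that removes fixed points, the right-hand side is checked against `e-suc`:
-- absorption turns the term with f + 1 into the previous-index term of the recurrence for n - f,
-- and Pascal's rule collects the result in row n + 1.
e-binomial : ∀ n f k → e[ n ] f k ≡ + (n C f) * β± (n ∸ f) k
e-binomial zero zero    zero    = refl
e-binomial zero zero    (suc k) = refl
e-binomial zero (suc f) k       = trans (ℤₚ.+-identityʳ (0ℤ * δ k 0)) (trans (ℤₚ.*-zeroˡ (δ k 0))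
  (sym (trans (cong (λ c → + c * β± 0 k) (k>n⇒nCk≡0 {0} {suc f} (s≤s z≤n))) (ℤₚ.*-zeroˡ (β± 0 k)))))
e-binomial (suc n) f k = begin
  e[ suc n ] f k
    ≡⟨ e-suc n f k ⟩
  L n (e[ n ] f) k + + 2 * (+ suc f * shift (e[ n ] (suc f)) k - + f * shift (e[ n ] f) k)
    + shift (λ g → e[ n ] g k) f + shift (e[ n ] f) k
    ≡⟨ cong₂ _+_ (cong₂ _+_ (cong₂ _+_ (L-cong n (e-binomial n f) k)
         (cong₂ (λ x y → + 2 * (+ suc f * x - + f * y)) (s (suc f)) (s f)))
         (shift-cong (λ g → e-binomial n g k) f)) (s f) ⟩
  L n (λ i → c * D i) k + + 2 * (+ suc f * (+ (n C suc f) * shift (β± (n ∸ suc f)) k) - + f * (c * shift D k))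
    + shift (λ g → + (n C g) * β± (n ∸ g) k) f + c * shift D k
    ≡⟨ cong₂ (λ x y → + 2 * (+ k * (c * D k) + (+ suc n - + k) * x) + + 2 * (y - + f * (c * shift D k))
                       + shift (λ g → + (n C g) * β± (n ∸ g) k) f + c * shift D k)
         (shift-* c D k)
         (trans (sym (ℤₚ.*-assoc (+ suc f) (+ (n C suc f)) (shift (β± (n ∸ suc f)) k)))
           (cong₂ (λ x m → x * shift (β± m) k) (C-absorb n f) (sym (ℕₚ.pred[m∸n]≡m∸[1+n] n f)))) ⟩
  + 2 * (+ k * (c * D k) + (+ suc n - + k) * (c * shift D k))
    + + 2 * ((+ n - + f) * c * shift (β± (ℕ.pred (n ∸ f))) k - + f * (c * shift D k))
    + shift (λ g → + (n C g) * β± (n ∸ g) k) f + c * shift D k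
    ≡⟨ lem₁ (+ n) (+ k) (+ f) c (D k) (shift D k) (shift (β± (ℕ.pred (n ∸ f))) k) (shift (λ g → + (n C g) * β± (n ∸ g) k) f) ⟩
  shift (λ g → + (n C g) * β± (n ∸ g) k) f + c * (+ 2 * (+ k * D k + (1ℤ + (+ n - + f) - + k) * shift D k)
    + + 2 * ((+ n - + f) * shift (β± (ℕ.pred (n ∸ f))) k) + shift D k)
    ≡⟨ +-congˡ (shift (λ g → + (n C g) * β± (n ∸ g) k) f) (fold (f ℕₚ.≤? n)) ⟩
  shift (λ g → + (n C g) * β± (n ∸ g) k) f + c * β± (suc n ∸ f) k
    ≡⟨ pascal f ⟩
  + (suc n C f) * β± (suc n ∸ f) k ∎
  where
  open ≡-Reasoning
  c = + (n C f)
  D = β± (n ∸ f)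
  s : ∀ g → shift (e[ n ] g) k ≡ + (n C g) * shift (β± (n ∸ g)) k
  s g = trans (shift-cong (e-binomial n g) k) (shift-* (+ (n C g)) (β± (n ∸ g)) k)
  lem₁ : ∀ n k f c a s t u →
    + 2 * (k * (c * a) + (1ℤ + n - k) * (c * s)) + + 2 * ((n - f) * c * t - f * (c * s)) + u + c * s ≡
    u + c * (+ 2 * (k * a + (1ℤ + (n - f) - k) * s) + + 2 * ((n - f) * t) + s)
  lem₁ = solve-∀
  R : ℤ
  R = + 2 * (+ k * D k + (1ℤ + (+ n - + f) - + k) * shift D k)
    + + 2 * ((+ n - + f) * shift (β± (ℕ.pred (n ∸ f))) k) + shift D k
  -- For f ≤ n the difference in ℤ is the truncated one and `R` is the recurrence for n - f; for f >
  -- n both sides vanish with the coefficient `c`.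
  fold : Dec (f ≤ n) → c * R ≡ c * β± (suc n ∸ f) k
  fold (yes f≤n) = *-congˡ c (begin
    + 2 * (+ k * D k + (1ℤ + (+ n - + f) - + k) * shift D k)
      + + 2 * ((+ n - + f) * shift (β± (ℕ.pred (n ∸ f))) k) + shift D k
      ≡⟨ cong (λ m → + 2 * (+ k * D k + (1ℤ + m - + k) * shift D k) + + 2 * (m * shift (β± (ℕ.pred (n ∸ f))) k) + shift D k)
           (trans (ℤₚ.[+m]-[+n]≡m⊖n n f) (ℤₚ.⊖-≥ f≤n)) ⟩
    + 2 * (+ k * D k + (+ suc (n ∸ f) - + k) * shift D k) + + 2 * (+ (n ∸ f) * shift (β± (ℕ.pred (n ∸ f))) k) + shift D k
      ≡⟨ β±-suc (n ∸ f) k ⟨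
    β± (suc (n ∸ f)) k
      ≡⟨ cong (λ m → β± m k) (ℕₚ.+-∸-assoc 1 f≤n) ⟨
    β± (suc n ∸ f) k ∎)
  fold (no f≰n) = trans (cong (λ c → + c * R) (k>n⇒nCk≡0 (ℕₚ.≰⇒> f≰n))) (trans (ℤₚ.*-zeroˡ R)
    (sym (trans (cong (λ c → + c * β± (suc n ∸ f) k) (k>n⇒nCk≡0 (ℕₚ.≰⇒> f≰n))) (ℤₚ.*-zeroˡ (β± (suc n ∸ f) k)))))
  pascal : ∀ f → shift (λ g → + (n C g) * β± (n ∸ g) k) f + + (n C f) * β± (suc n ∸ f) k ≡ + (suc n C f) * β± (suc n ∸ f) k
  pascal zero    = trans (ℤₚ.+-identityˡ (+ (n C 0) * β± (suc n) k)) (cong (λ c → + c * β± (suc n) k) (trans (nC0≡1 n) (sym (nC0≡1 (suc n)))))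
  pascal (suc f) = trans (sym (ℤₚ.*-distribʳ-+ (β± (n ∸ f) k) (+ (n C f)) (+ (n C suc f))))
    (cong (λ c → + c * β± (n ∸ f) k) (nCk+nC[k+1]≡[n+1]C[k+1] n f))

coeff-dB≡β± : ∀ n k → coeff (dB n) k ≡ β± n k
coeff-dB≡β± n k = trans (coeff-dB n k) (trans (e-binomial n 0 k) (trans (cong (λ c → + c * β± n k) (nC0≡1 n)) (ℤₚ.*-identityˡ (β± n k))))

-- Symmetry and unimodality

-- Over ℤ the recurrences need no boundary cases.
ext : (ℕ → ℤ) → ℤ → ℤ
ext a (+ i)    = a i
ext a -[1+ _ ] = 0ℤ

ext-shift : ∀ a z → ext (shift a) z ≡ ext a (z - 1ℤ)
ext-shift a (+ zero)  = refl
ext-shift a (+ suc i) = refl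
ext-shift a -[1+ i ]  = refl

ext-L : ∀ n a z → ext (L n a) z ≡ + 2 * (z * ext a z + (+ suc n - z) * ext a (z - 1ℤ))
ext-L n a (+ i)    = cong (λ x → + 2 * (+ i * a i + (+ suc n - + i) * x)) (ext-shift a (+ i))
ext-L n a -[1+ i ] = lem -[1+ i ] (+ suc n - -[1+ i ])
  where
  lem : ∀ x y → 0ℤ ≡ + 2 * (x * 0ℤ + y * 0ℤ)
  lem = solve-∀

ext-β⁺-suc : ∀ n z → ext (β⁺ (suc n)) z ≡
  + 2 * (z * ext (β⁺ n) z + (+ suc n - z) * ext (β⁺ n) (z - 1ℤ))
    + + 2 * (+ n * ext (β⁺ (ℕ.pred n)) (z - 1ℤ)) + ext (β⁻ n) z
ext-β⁺-suc n z@(+ i) = trans (β⁺-suc n i) (cong (λ x → x + β⁻ n i) (cong₂ (λ x y → x + + 2 * (+ n * y))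
  (ext-L n (β⁺ n) z) (ext-shift (β⁺ (ℕ.pred n)) z)))
ext-β⁺-suc n z@(-[1+ i ]) = trans (ext-L n (β⁺ n) z) (lem (+ 2 * (z * 0ℤ + (+ suc n - z) * 0ℤ)) (+ n))
  where
  lem : ∀ a b → a ≡ a + + 2 * (b * 0ℤ) + 0ℤ
  lem = solve-∀

ext-β⁻-suc : ∀ n z → ext (β⁻ (suc n)) z ≡
  + 2 * (z * ext (β⁻ n) z + (+ suc n - z) * ext (β⁻ n) (z - 1ℤ))
    + + 2 * (+ n * ext (β⁻ (ℕ.pred n)) (z - 1ℤ)) + (ext (β⁺ n) (z - 1ℤ) + ext (β⁻ n) (z - 1ℤ)) - ext (β⁻ n) z
ext-β⁻-suc n z@(+ i) = trans (β⁻-suc n i) (cong₂ (λ x y → x + y - β⁻ n i)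
  (cong₂ (λ x y → x + + 2 * (+ n * y)) (ext-L n (β⁻ n) z) (ext-shift (β⁻ (ℕ.pred n)) z))
  (cong₂ _+_ (ext-shift (β⁺ n) z) (ext-shift (β⁻ n) z)))
ext-β⁻-suc n z@(-[1+ i ]) = trans (ext-L n (β⁻ n) z) (lem (+ 2 * (z * 0ℤ + (+ suc n - z) * 0ℤ)) (+ n))
  where
  lem : ∀ a b → a ≡ a + + 2 * (b * 0ℤ) + (0ℤ + 0ℤ) - 0ℤ
  lem = solve-∀

private
  idx₁ : ∀ n z → 1ℤ + n - z ≡ n - (z - 1ℤ)
  idx₁ = solve-∀
  idx₂ : ∀ n z → 1ℤ + n - z - 1ℤ ≡ n - z
  idx₂ = solve-∀
  idx₃ : ∀ n z → 1ℤ + (1ℤ + n) - z - 1ℤ ≡ n - (z - 1ℤ)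
  idx₃ = solve-∀

-- Induction on n, jointly with q. The reflection of z to n + 1 - z exchanges the two products
-- inside the operator; qₙ, and pₙ₋₁ after multiplication by x, are symmetric about (n + 1)/2
-- already.
β⁺-symmetric : ∀ n z → ext (β⁺ n) z ≡ ext (β⁺ n) (+ n - z)
-- Together with `L n`, the terms xqₙ - qₙ give weight 2z - 1 to the coefficient at z and 2(n + 2 -
-- z) - 1 to the one at z - 1, and the reflection of z to n + 2 - z exchanges these.
β⁻-symmetric : ∀ n z → ext (β⁻ n) z ≡ ext (β⁻ n) (+ suc n - z)

-- The factor `+ n` stays inside: at n = 0 `ℕ.pred` returns 0 again, and the bare equation would
-- fail at z = 1.
prev-β⁺-symmetric : ∀ n z → + n * ext (β⁺ (ℕ.pred n)) (z - 1ℤ) ≡ + n * ext (β⁺ (ℕ.pred n)) (+ suc n - z - 1ℤ)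
prev-β⁻-symmetric : ∀ n z → + n * ext (β⁻ (ℕ.pred n)) (z - 1ℤ) ≡ + n * ext (β⁻ (ℕ.pred n)) (+ suc (suc n) - z - 1ℤ)

β⁺-symmetric zero (+ zero)  = refl
β⁺-symmetric zero (+ suc i) = refl
β⁺-symmetric zero -[1+ i ]  = refl
β⁺-symmetric (suc n) z = begin
  ext (β⁺ (suc n)) z
    ≡⟨ ext-β⁺-suc n z ⟩
  + 2 * (z * ext (β⁺ n) z + (+ suc n - z) * ext (β⁺ n) (z - 1ℤ)) + + 2 * (+ n * ext (β⁺ (ℕ.pred n)) (z - 1ℤ)) + ext (β⁻ n) z
    ≡⟨ cong₂ _+_ (cong₂ _+_ (cong₂ (λ x y → + 2 * (z * x + (+ suc n - z) * y))
         (trans (β⁺-symmetric n z) (cong (ext (β⁺ n)) (sym (idx₂ (+ n) z))))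
         (trans (β⁺-symmetric n (z - 1ℤ)) (cong (ext (β⁺ n)) (sym (idx₁ (+ n) z)))))
         (*-congˡ (+ 2) (prev-β⁺-symmetric n z))) (β⁻-symmetric n z) ⟩
  + 2 * (z * ext (β⁺ n) (z′ - 1ℤ) + z′ * ext (β⁺ n) z′) + + 2 * (+ n * ext (β⁺ (ℕ.pred n)) (z′ - 1ℤ)) + ext (β⁻ n) z′
    ≡⟨ lem (+ n) z (ext (β⁺ n) (z′ - 1ℤ)) (ext (β⁺ n) z′) (+ 2 * (+ n * ext (β⁺ (ℕ.pred n)) (z′ - 1ℤ))) (ext (β⁻ n) z′) ⟩
  + 2 * (z′ * ext (β⁺ n) z′ + (+ suc n - z′) * ext (β⁺ n) (z′ - 1ℤ)) + + 2 * (+ n * ext (β⁺ (ℕ.pred n)) (z′ - 1ℤ)) + ext (β⁻ n) z′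
    ≡⟨ ext-β⁺-suc n z′ ⟨
  ext (β⁺ (suc n)) z′ ∎
  where
  open ≡-Reasoning
  z′ = + suc n - z
  lem : ∀ n z a b c d → + 2 * (z * a + (1ℤ + n - z) * b) + c + d ≡
                        + 2 * ((1ℤ + n - z) * b + (1ℤ + n - (1ℤ + n - z)) * a) + c + d
  lem = solve-∀

β⁻-symmetric zero (+ zero)        = refl
β⁻-symmetric zero (+ suc zero)    = refl
β⁻-symmetric zero (+ suc (suc i)) = refl
β⁻-symmetric zero -[1+ i ]        = refl
β⁻-symmetric (suc n) z = begin
  ext (β⁻ (suc n)) z
    ≡⟨ ext-β⁻-suc n z ⟩
  + 2 * (z * ext (β⁻ n) z + (+ suc n - z) * ext (β⁻ n) (z - 1ℤ))
    + + 2 * (+ n * ext (β⁻ (ℕ.pred n)) (z - 1ℤ)) + (ext (β⁺ n) (z - 1ℤ) + ext (β⁻ n) (z - 1ℤ)) - ext (β⁻ n) z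
    ≡⟨ cong₂ (λ x y → x - y) (cong₂ _+_ (cong₂ _+_ (cong₂ (λ x y → + 2 * (z * x + (+ suc n - z) * y)) qz qz₁)
         (*-congˡ (+ 2) (prev-β⁻-symmetric n z)))
         (cong₂ _+_ (trans (β⁺-symmetric n (z - 1ℤ)) (cong (ext (β⁺ n)) (sym (idx₃ (+ n) z)))) qz₁)) qz ⟩
  + 2 * (z * ext (β⁻ n) (z′ - 1ℤ) + (+ suc n - z) * ext (β⁻ n) z′)
    + + 2 * (+ n * ext (β⁻ (ℕ.pred n)) (z′ - 1ℤ)) + (ext (β⁺ n) (z′ - 1ℤ) + ext (β⁻ n) z′) - ext (β⁻ n) (z′ - 1ℤ)
    ≡⟨ lem (+ n) z (ext (β⁻ n) (z′ - 1ℤ)) (ext (β⁻ n) z′) (+ 2 * (+ n * ext (β⁻ (ℕ.pred n)) (z′ - 1ℤ))) (ext (β⁺ n) (z′ - 1ℤ)) ⟩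
  + 2 * (z′ * ext (β⁻ n) z′ + (+ suc n - z′) * ext (β⁻ n) (z′ - 1ℤ))
    + + 2 * (+ n * ext (β⁻ (ℕ.pred n)) (z′ - 1ℤ)) + (ext (β⁺ n) (z′ - 1ℤ) + ext (β⁻ n) (z′ - 1ℤ)) - ext (β⁻ n) z′
    ≡⟨ ext-β⁻-suc n z′ ⟨
  ext (β⁻ (suc n)) z′ ∎
  where
  open ≡-Reasoning
  z′ = + suc (suc n) - z
  qz : ext (β⁻ n) z ≡ ext (β⁻ n) (z′ - 1ℤ)
  qz = trans (β⁻-symmetric n z) (cong (ext (β⁻ n)) (sym (idx₂ (+ suc n) z)))
  qz₁ : ext (β⁻ n) (z - 1ℤ) ≡ ext (β⁻ n) z′
  qz₁ = trans (β⁻-symmetric n (z - 1ℤ)) (cong (ext (β⁻ n)) (sym (idx₁ (+ suc n) z)))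
  lem : ∀ n z a b c d → + 2 * (z * a + (1ℤ + n - z) * b) + c + (d + b) - a ≡
    + 2 * ((1ℤ + (1ℤ + n) - z) * b + (1ℤ + n - (1ℤ + (1ℤ + n) - z)) * a) + c + (d + a) - b
  lem = solve-∀

prev-β⁺-symmetric zero    z = trans (ℤₚ.*-zeroˡ (ext (β⁺ 0) (z - 1ℤ))) (sym (ℤₚ.*-zeroˡ (ext (β⁺ 0) (1ℤ - z - 1ℤ))))
prev-β⁺-symmetric (suc n) z = *-congˡ (+ suc n) (trans (β⁺-symmetric n (z - 1ℤ)) (cong (ext (β⁺ n)) (sym (idx₃ (+ n) z))))

prev-β⁻-symmetric zero    z = trans (ℤₚ.*-zeroˡ (ext (β⁻ 0) (z - 1ℤ))) (sym (ℤₚ.*-zeroˡ (ext (β⁻ 0) (+ 2 - z - 1ℤ))))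
prev-β⁻-symmetric (suc n) z = *-congˡ (+ suc n) (trans (β⁻-symmetric n (z - 1ℤ)) (cong (ext (β⁻ n)) (sym (idx₃ (+ suc n) z))))

β⁻-zero : ∀ n → β⁻ n 0 ≡ 0ℤ
β⁻-zero zero    = refl
β⁻-zero (suc n) = trans (β⁻-suc n 0) (trans (cong (λ x → + 2 * (0ℤ * x + (+ suc n - 0ℤ) * 0ℤ) + + 2 * (+ n * 0ℤ) + (0ℤ + 0ℤ) - x) (β⁻-zero n))
  (lem (+ suc n) (+ n)))
  where
  lem : ∀ a b → + 2 * (0ℤ * 0ℤ + (a - 0ℤ) * 0ℤ) + + 2 * (b * 0ℤ) + (0ℤ + 0ℤ) - 0ℤ ≡ 0ℤ
  lem = solve-∀

β⁺-zero-nonneg : ∀ n → 0ℤ ℤ.≤ β⁺ n 0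
β⁺-zero-nonneg zero    = ℤ.+≤+ z≤n
β⁺-zero-nonneg (suc n) = ℤₚ.≤-reflexive (sym (trans (β⁺-suc n 0) (trans (+-congˡ (+ 2 * (0ℤ * β⁺ n 0 + (+ suc n - 0ℤ) * 0ℤ) + + 2 * (+ n * 0ℤ)) (β⁻-zero n))
  (lem (β⁺ n 0) (+ suc n) (+ n)))))
  where
  lem : ∀ x a b → + 2 * (0ℤ * x + (a - 0ℤ) * 0ℤ) + + 2 * (b * 0ℤ) + 0ℤ ≡ 0ℤ
  lem = solve-∀

*-nonneg : ∀ m {x} → 0ℤ ℤ.≤ x → 0ℤ ℤ.≤ + m * x
*-nonneg m 0≤x = ℤₚ.≤-trans (ℤₚ.≤-reflexive (sym (ℤₚ.*-zeroʳ (+ m)))) (ℤₚ.*-monoˡ-≤-nonNeg (+ m) 0≤x)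

+-nonneg : ∀ {x y} → 0ℤ ℤ.≤ x → 0ℤ ℤ.≤ y → 0ℤ ℤ.≤ x + y
+-nonneg = ℤₚ.+-mono-≤

private
  ∸-cast : ∀ {m n} → n ≤ m → + m - + n ≡ + (m ∸ n)
  ∸-cast {m} {n} n≤m = trans (ℤₚ.[+m]-[+n]≡m⊖n m n) (ℤₚ.⊖-≥ n≤m)

-- At j = 0 this says that `a 0` is nonnegative. The bound `suc n` instead of n lets the hypothesis
-- for n reach as far as the step to n + 1 requires.
Rising : ℕ → (ℕ → ℤ) → Set
Rising n a = ∀ j → j ℕ.+ j ≤ suc n → shift a j ℤ.≤ a j

-- For j = (n + 1) / 2 symmetry turns the inequality into an equality.
rising-middle : ∀ n a → (∀ z → ext a z ≡ ext a (+ n - z)) →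
  (∀ j → j ℕ.+ j ≤ n → shift a j ℤ.≤ a j) → Rising n a
rising-middle n a s r j 2j≤ with ℕₚ.m≤n⇒m<n∨m≡n 2j≤
... | inj₁ (s≤s 2j≤n) = r j 2j≤n
rising-middle n a s r (suc i) 2j≤ | inj₂ 2j≡ = ℤₚ.≤-reflexive (sym (trans (s (+ suc i)) (cong (ext a) middle)))
  where
  middle : + n - + suc i ≡ + i
  middle = trans (cong (λ m → + m - + suc i) (sym (trans (sym (ℕₚ.+-suc i i)) (ℕₚ.suc-injective 2j≡))))
    (lem (+ i))
    where
    lem : ∀ i → 1ℤ + (i + i) - (1ℤ + i) ≡ i
    lem = solve-∀

-- By the recurrence, the increment of pₙ₊₁ at j + 1 is a combination of the increments of pₙ at j
-- and j + 1, of pₙ₋₁ at j and of qₙ at j + 1. The coefficients are nonnegative in the lower half,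
-- where the induction hypotheses cover all these places.
β⁺-rising : ∀ n → Rising n (β⁺ n)
-- As for p: the term -qₙ lowers the weight of the increment of qₙ at j + 1 from 2j + 2 to 2j + 1,
-- and xqₙ raises the weight at j by one, so both remain nonnegative.
β⁻-rising : ∀ n → Rising (suc n) (β⁻ n)
prev-β⁺-rising : ∀ n j → j ℕ.+ j ≤ n → 0ℤ ℤ.≤ + n * (β⁺ (ℕ.pred n) j - shift (β⁺ (ℕ.pred n)) j)
prev-β⁻-rising : ∀ n j → j ℕ.+ j ≤ suc n → 0ℤ ℤ.≤ + n * (β⁻ (ℕ.pred n) j - shift (β⁻ (ℕ.pred n)) j)

increase : ∀ {x y z} → y ≡ x + z → 0ℤ ℤ.≤ z → x ℤ.≤ y
increase {x} {y} {z} e 0≤z = ℤₚ.≤-trans (ℤₚ.≤-reflexive (sym (ℤₚ.+-identityʳ x)))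
  (ℤₚ.≤-trans (ℤₚ.+-monoʳ-≤ x 0≤z) (ℤₚ.≤-reflexive (sym e)))

β⁺-rising zero zero    _       = ℤ.+≤+ z≤n
β⁺-rising zero (suc i) (s≤s h) with () ← trans (sym (ℕₚ.+-suc i i)) (ℕₚ.n≤0⇒n≡0 h)
β⁺-rising (suc n) = rising-middle (suc n) (β⁺ (suc n)) (β⁺-symmetric (suc n)) rising
  where
  rising : ∀ j → j ℕ.+ j ≤ suc n → shift (β⁺ (suc n)) j ℤ.≤ β⁺ (suc n) j
  rising zero    _  = β⁺-zero-nonneg (suc n)
  rising (suc j) h = increase
    (trans (β⁺-suc n (suc j)) (trans
      (lem (+ n) (+ j) (β⁺ n (suc j)) (β⁺ n j) (shift (β⁺ n) j) (β⁺ (ℕ.pred n) j) (shift (β⁺ (ℕ.pred n)) j) (β⁻ n (suc j)) (β⁻ n j))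
      (cong₂ _+_ (sym (β⁺-suc n j)) (cong (λ r → + 2 * (+ suc j * (β⁺ n (suc j) - β⁺ n j)) + + 2 * (r * (β⁺ n j - shift (β⁺ n) j))
        + + 2 * (+ n * (β⁺ (ℕ.pred n) j - shift (β⁺ (ℕ.pred n)) j)) + (β⁻ n (suc j) - β⁻ n j)) (∸-cast j≤)))))
    (+-nonneg (+-nonneg (+-nonneg
      (*-nonneg 2 (*-nonneg (suc j) (ℤₚ.i≤j⇒0≤j-i (β⁺-rising n (suc j) h))))
      (*-nonneg 2 (*-nonneg (suc n ∸ j) (ℤₚ.i≤j⇒0≤j-i (β⁺-rising n j (ℕₚ.≤-trans 2j≤n (ℕₚ.n≤1+n n)))))))
      (*-nonneg 2 (prev-β⁺-rising n j 2j≤n)))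
      (ℤₚ.i≤j⇒0≤j-i (β⁻-rising n (suc j) (ℕₚ.≤-trans h (ℕₚ.n≤1+n (suc n))))))
    where
    2j≤n : j ℕ.+ j ≤ n
    2j≤n = ℕₚ.≤-trans (ℕₚ.n≤1+n (j ℕ.+ j)) (subst (_≤ n) (ℕₚ.+-suc j j) (ℕₚ.≤-pred h))
    j≤ : j ≤ suc n
    j≤ = ℕₚ.≤-trans (ℕₚ.m≤m+n j j) (ℕₚ.≤-trans 2j≤n (ℕₚ.n≤1+n n))
    lem : ∀ n j a b c u v x y →
      + 2 * ((1ℤ + j) * a + (1ℤ + n - (1ℤ + j)) * b) + + 2 * (n * u) + x
        ≡ + 2 * (j * b + (1ℤ + n - j) * c) + + 2 * (n * v) + y
          + (+ 2 * ((1ℤ + j) * (a - b)) + + 2 * ((1ℤ + n - j) * (b - c)) + + 2 * (n * (u - v)) + (x - y))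
    lem = solve-∀

β⁻-rising zero zero    _ = ℤ.+≤+ z≤n
β⁻-rising zero (suc zero)    _ = ℤ.+≤+ z≤n
β⁻-rising zero (suc (suc i)) _ = ℤ.+≤+ z≤n
β⁻-rising (suc n) = rising-middle (suc (suc n)) (β⁻ (suc n)) (β⁻-symmetric (suc n)) rising
  where
  rising : ∀ j → j ℕ.+ j ≤ suc (suc n) → shift (β⁻ (suc n)) j ℤ.≤ β⁻ (suc n) j
  rising zero    _  = ℤₚ.≤-reflexive (sym (β⁻-zero (suc n)))
  rising (suc j) h = increase
    (trans (β⁻-suc n (suc j)) (trans
      (lem (+ n) (+ j) (β⁻ n (suc j)) (β⁻ n j) (shift (β⁻ n) j) (β⁻ (ℕ.pred n) j) (shift (β⁻ (ℕ.pred n)) j) (β⁺ n j) (shift (β⁺ n) j))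
      (cong₂ _+_ (sym (β⁻-suc n j)) (cong (λ r → (1ℤ + + 2 * + j) * (β⁻ n (suc j) - β⁻ n j) + (1ℤ + + 2 * r) * (β⁻ n j - shift (β⁻ n) j)
        + + 2 * (+ n * (β⁻ (ℕ.pred n) j - shift (β⁻ (ℕ.pred n)) j)) + (β⁺ n j - shift (β⁺ n) j)) (∸-cast j≤)))))
    (+-nonneg (+-nonneg (+-nonneg
      (odd-nonneg j (ℤₚ.i≤j⇒0≤j-i (β⁻-rising n (suc j) h)))
      (odd-nonneg (suc n ∸ j) (ℤₚ.i≤j⇒0≤j-i (β⁻-rising n j (ℕₚ.≤-trans 2j≤n (ℕₚ.≤-trans (ℕₚ.n≤1+n n) (ℕₚ.n≤1+n (suc n))))))))
      (*-nonneg 2 (prev-β⁻-rising n j (ℕₚ.≤-trans 2j≤n (ℕₚ.n≤1+n n)))))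
      (ℤₚ.i≤j⇒0≤j-i (β⁺-rising n j (ℕₚ.≤-trans 2j≤n (ℕₚ.n≤1+n n)))))
    where
    odd-nonneg : ∀ m {x} → 0ℤ ℤ.≤ x → 0ℤ ℤ.≤ (1ℤ + + 2 * + m) * x
    odd-nonneg m {x} 0≤x = subst (λ r → 0ℤ ℤ.≤ (1ℤ + r) * x) (ℤₚ.pos-* 2 m) (*-nonneg (suc (2 ℕ.* m)) 0≤x)
    2j≤n : j ℕ.+ j ≤ n
    2j≤n = ℕ.s≤s⁻¹ (ℕ.s≤s⁻¹ (subst (_≤ suc (suc n)) (cong suc (ℕₚ.+-suc j j)) h))
    j≤ : j ≤ suc n
    j≤ = ℕₚ.≤-trans (ℕₚ.m≤m+n j j) (ℕₚ.≤-trans 2j≤n (ℕₚ.n≤1+n n))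
    lem : ∀ n j a b c u v x y →
      + 2 * ((1ℤ + j) * a + (1ℤ + n - (1ℤ + j)) * b) + + 2 * (n * u) + (x + b) - a
        ≡ + 2 * (j * b + (1ℤ + n - j) * c) + + 2 * (n * v) + (y + c) - b
          + ((1ℤ + + 2 * j) * (a - b) + (1ℤ + + 2 * (1ℤ + n - j)) * (b - c) + + 2 * (n * (u - v)) + (x - y))
    lem = solve-∀

prev-β⁺-rising zero    j _ = ℤₚ.≤-reflexive (sym (ℤₚ.*-zeroˡ (β⁺ 0 j - shift (β⁺ 0) j)))
prev-β⁺-rising (suc n) j h = *-nonneg (suc n) (ℤₚ.i≤j⇒0≤j-i (β⁺-rising n j h))

prev-β⁻-rising zero    j _ = ℤₚ.≤-reflexive (sym (ℤₚ.*-zeroˡ (β⁻ 0 j - shift (β⁻ 0) j)))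
prev-β⁻-rising (suc n) j h = *-nonneg (suc n) (ℤₚ.i≤j⇒0≤j-i (β⁻-rising n j h))

module _ (n : ℕ) where

  β⁺-nonneg-low : ∀ i → i ℕ.+ i ≤ suc n → 0ℤ ℤ.≤ β⁺ n i
  β⁺-nonneg-low zero    _ = β⁺-zero-nonneg n
  β⁺-nonneg-low (suc i) h = ℤₚ.≤-trans
    (β⁺-nonneg-low i (ℕₚ.≤-trans (ℕₚ.+-mono-≤ (ℕₚ.n≤1+n i) (ℕₚ.n≤1+n i)) h)) (β⁺-rising n (suc i) h)

  β⁺-reflect : ∀ {i} → i ≤ n → β⁺ n i ≡ β⁺ n (n ∸ i)
  β⁺-reflect {i} i≤n = trans (β⁺-symmetric n (+ i)) (cong (ext (β⁺ n)) (∸-cast i≤n))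

  β⁺-above : ∀ {i} → n ℕ.< i → β⁺ n i ≡ 0ℤ
  β⁺-above {i} n<i = trans (β⁺-symmetric n (+ i)) (trans (cong (ext (β⁺ n)) (trans (ℤₚ.[+m]-[+n]≡m⊖n n i) (ℤₚ.⊖-< n<i)))
    (lem (ℕₚ.m<n⇒0<n∸m n<i)))
    where
    lem : ∀ {m} → 0 ℕ.< m → ext (β⁺ n) (- + m) ≡ 0ℤ
    lem (s≤s _) = refl

  private
    -- Reflection moves an index of the upper half into the range of `Rising`.
    reflect-half : ∀ {i} → i ≤ n → n ≤ suc (i ℕ.+ i) → (n ∸ i) ℕ.+ (n ∸ i) ≤ suc n
    reflect-half {i} i≤n h = ℕₚ.+-cancelʳ-≤ (i ℕ.+ i) _ _ (begin
      (n ∸ i) ℕ.+ (n ∸ i) ℕ.+ (i ℕ.+ i)   ≡⟨ lem (n ∸ i) i ⟩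
      ((n ∸ i) ℕ.+ i) ℕ.+ ((n ∸ i) ℕ.+ i) ≡⟨ cong₂ ℕ._+_ (ℕₚ.m∸n+n≡m i≤n) (ℕₚ.m∸n+n≡m i≤n) ⟩
      n ℕ.+ n                             ≤⟨ ℕₚ.+-monoʳ-≤ n h ⟩
      n ℕ.+ suc (i ℕ.+ i)                 ≡⟨ ℕₚ.+-suc n (i ℕ.+ i) ⟩
      suc n ℕ.+ (i ℕ.+ i)                 ∎)
      where
      open ℕₚ.≤-Reasoning
      lem : ∀ a b → a ℕ.+ a ℕ.+ (b ℕ.+ b) ≡ (a ℕ.+ b) ℕ.+ (a ℕ.+ b)
      lem = ℕ-RingSolver.solve-∀

  β⁺-nonneg : ∀ i → 0ℤ ℤ.≤ β⁺ n i
  β⁺-nonneg i with i ℕ.+ i ℕₚ.≤? suc n | i ℕₚ.≤? n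
  ... | yes h | _       = β⁺-nonneg-low i h
  ... | no _  | no i≰n  = ℤₚ.≤-reflexive (sym (β⁺-above (ℕₚ.≰⇒> i≰n)))
  ... | no h  | yes i≤n = ℤₚ.≤-trans (β⁺-nonneg-low (n ∸ i) (reflect-half i≤n
    (ℕₚ.≤-trans (ℕₚ.n≤1+n n) (ℕₚ.≤-trans (ℕₚ.<⇒≤ (ℕₚ.≰⇒> h)) (ℕₚ.n≤1+n _))))) (ℤₚ.≤-reflexive (sym (β⁺-reflect i≤n)))

  β⁺-increasing : ∀ i → i ℕ.< ℕ.⌊ n /2⌋ → β⁺ n i ℤ.≤ β⁺ n (suc i)
  β⁺-increasing i h = β⁺-rising n (suc i) (ℕₚ.≤-trans (ℕₚ.+-mono-≤ h h)
    (ℕₚ.≤-trans (ℕₚ.+-monoʳ-≤ ℕ.⌊ n /2⌋ (ℕₚ.⌊n/2⌋≤⌈n/2⌉ n)) (ℕₚ.≤-trans (ℕₚ.≤-reflexive (ℕₚ.⌊n/2⌋+⌈n/2⌉≡n n)) (ℕₚ.n≤1+n n))))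

  β⁺-decreasing : ∀ i → ℕ.⌊ n /2⌋ ≤ i → β⁺ n (suc i) ℤ.≤ β⁺ n i
  β⁺-decreasing i h with suc i ℕₚ.≤? n
  ... | no  i≮n = ℤₚ.≤-trans (ℤₚ.≤-reflexive (β⁺-above (ℕₚ.≰⇒> i≮n))) (β⁺-nonneg i)
  -- Reflected, the claim is the rise at n ∸ i; writing n ∸ i as a successor exposes its predecessor
  -- n ∸ (i + 1) under `shift`.
  ... | yes i<n = subst₂ ℤ._≤_ (trans (cong (shift (β⁺ n)) (ℕₚ.+-∸-assoc 1 i<n)) (sym (β⁺-reflect i<n))) (sym (β⁺-reflect (ℕₚ.<⇒≤ i<n)))
    (β⁺-rising n (n ∸ i) (reflect-half (ℕₚ.<⇒≤ i<n) n≤2i+1))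
    where
    n≤2i+1 : n ≤ suc (i ℕ.+ i)
    n≤2i+1 = begin
      n                            ≡⟨ ℕₚ.⌊n/2⌋+⌈n/2⌉≡n n ⟨
      ℕ.⌊ n /2⌋ ℕ.+ ℕ.⌊ suc n /2⌋  ≤⟨ ℕₚ.+-mono-≤ h (ℕₚ.≤-trans (ℕₚ.⌊n/2⌋-mono (ℕₚ.n≤1+n (suc n))) (s≤s h)) ⟩
      i ℕ.+ suc i                  ≡⟨ ℕₚ.+-suc i i ⟩
      suc (i ℕ.+ i)                ∎
      where open ℕₚ.≤-Reasoning

-- Power series

-- On power series these are multiplication by 1 - x and the operator x d/dx. A series is related to
-- its numerator by powers of the former, which avoids quotients.
Δ θ : (ℕ → ℤ) → ℕ → ℤ
Δ a k = a k - shift a k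
θ a k = + k * a k

Δ^ : ℕ → (ℕ → ℤ) → ℕ → ℤ
Δ^ zero    a = a
Δ^ (suc n) a = Δ^ n (Δ a)

Δ-cong : ∀ {a b : ℕ → ℤ} → (∀ k → a k ≡ b k) → ∀ k → Δ a k ≡ Δ b k
Δ-cong e k = cong₂ _-_ (e k) (shift-cong e k)

Δ^-cong : ∀ n {a b : ℕ → ℤ} → (∀ k → a k ≡ b k) → ∀ k → Δ^ n a k ≡ Δ^ n b k
Δ^-cong zero    e = e
Δ^-cong (suc n) e = Δ^-cong n (Δ-cong e)

Δ^-Δ : ∀ n a k → Δ^ n (Δ a) k ≡ Δ (Δ^ n a) k
Δ^-Δ zero    a k = refl
Δ^-Δ (suc n) a k = Δ^-Δ n (Δ a) k

Δ^-shift : ∀ n a k → Δ^ n (shift a) k ≡ shift (Δ^ n a) k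
Δ^-shift zero    a k = refl
Δ^-shift (suc n) a k = trans (Δ^-cong n (lem a) k) (Δ^-shift n (Δ a) k)
  where
  lem : ∀ a k → Δ (shift a) k ≡ shift (Δ a) k
  lem a zero    = refl
  lem a (suc k) = refl

Δ-+ : ∀ a b k → Δ (λ j → a j + b j) k ≡ Δ a k + Δ b k
Δ-+ a b k = trans (cong (λ x → a k + b k - x) (shift-+ a b k)) (lem (a k) (b k) (shift a k) (shift b k))
  where
  lem : ∀ a b c d → a + b - (c + d) ≡ a - c + (b - d)
  lem = solve-∀

Δ^-+ : ∀ n a b k → Δ^ n (λ j → a j + b j) k ≡ Δ^ n a k + Δ^ n b k
Δ^-+ zero    a b k = refl
Δ^-+ (suc n) a b k = trans (Δ^-cong n (Δ-+ a b) k) (Δ^-+ n (Δ a) (Δ b) k)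

Δ^-* : ∀ n c a k → Δ^ n (λ j → c * a j) k ≡ c * Δ^ n a k
Δ^-* zero    c a k = refl
Δ^-* (suc n) c a k = trans (Δ^-cong n lem k) (Δ^-* n c (Δ a) k)
  where
  distrib : ∀ c x y → c * x - c * y ≡ c * (x - y)
  distrib = solve-∀
  lem : ∀ j → Δ (λ j → c * a j) j ≡ c * Δ a j
  lem j = trans (cong (λ x → c * a j - x) (shift-* c a j)) (distrib c (a j) (shift a j))

Δ^-∑ᶻ : ∀ n {A : Set} (xs : List A) (f : A → ℕ → ℤ) k →
  Δ^ n (λ j → ∑ᶻ xs (λ x → f x j)) k ≡ ∑ᶻ xs (λ x → Δ^ n (f x) k)
Δ^-∑ᶻ n []       f k = trans (Δ^-* n 0ℤ (λ _ → 0ℤ) k) (ℤₚ.*-zeroˡ (Δ^ n (λ _ → 0ℤ) k))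
Δ^-∑ᶻ n (x ∷ xs) f k = trans (Δ^-+ n (f x) _ k) (+-congˡ (Δ^ n (f x) k) (Δ^-∑ᶻ n xs f k))

-- t k m is the coefficient of xᵐ in (x / (1 - x))ᵏ.
t : ℕ → ℕ → ℤ
t zero    zero    = 1ℤ
t zero    (suc m) = 0ℤ
t (suc k) zero    = 0ℤ
t (suc k) (suc m) = t k m + t (suc k) m

Δ-t : ∀ k m → Δ (t (suc k)) m ≡ shift (t k) m
Δ-t k zero    = refl
Δ-t k (suc m) = lem (t k m) (t (suc k) m)
  where
  lem : ∀ a b → a + b - b ≡ a
  lem = solve-∀

coeff-[0] : ∀ k → coeff (0ℤ ∷ []) k ≡ 0ℤ
coeff-[0] zero    = refl
coeff-[0] (suc k) = refl

coeff-1-X⊗ : ∀ r k → coeff (1-X ⊗ r) k ≡ Δ (coeff r) k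
coeff-1-X⊗ r k = trans (coeff-⊕ (1ℤ · r) _ k)
  (cong₂ _+_ (trans (coeff-· 1ℤ r k) (ℤₚ.*-identityˡ (coeff r k))) (tail k))
  where
  lem : ∀ a → -1ℤ * a + 0ℤ ≡ - a
  lem = solve-∀
  tail : ∀ k → coeff (0ℤ ∷ ((-1ℤ · r) ⊕ (0ℤ ∷ []))) k ≡ - shift (coeff r) k
  tail zero    = refl
  tail (suc k) = trans (coeff-⊕ (-1ℤ · r) (0ℤ ∷ []) k)
    (trans (cong₂ _+_ (coeff-· -1ℤ r k) (coeff-[0] k)) (lem (coeff r k)))

coeff-1-X^ : ∀ n k → coeff (1-X ^ₚ n) k ≡ Δ^ n (t 0) k
coeff-1-X^ zero    zero    = refl
coeff-1-X^ zero    (suc k) = refl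
coeff-1-X^ (suc n) k = trans (coeff-1-X⊗ (1-X ^ₚ n) k) (trans (Δ-cong (coeff-1-X^ n) k) (sym (Δ^-Δ n (t 0) k)))

-- A face with j vertices contributes (x / (1 - x))ʲ, with coefficients `t j`, to the series h / (1
-- - x)ⁿ.
coeff-X^⊗1-X^ : ∀ {j n} → j ≤ n → ∀ k → coeff (X^ j ⊗ 1-X ^ₚ (n ∸ j)) k ≡ Δ^ n (t j) k
coeff-X^⊗1-X^ {zero} {n} _ k = trans (coeff-⊕ (1ℤ · (1-X ^ₚ n)) (0ℤ ∷ []) k)
  (trans (cong₂ _+_ (trans (coeff-· 1ℤ (1-X ^ₚ n) k) (ℤₚ.*-identityˡ (coeff (1-X ^ₚ n) k))) (coeff-[0] k))
    (trans (ℤₚ.+-identityʳ (coeff (1-X ^ₚ n) k)) (coeff-1-X^ n k)))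
coeff-X^⊗1-X^ {suc j} {suc n} (s≤s j≤n) k = trans (coeff-⊕ (0ℤ · r) (0ℤ ∷ (X^ j ⊗ r)) k)
  (trans (cong₂ _+_ (trans (coeff-· 0ℤ r k) (ℤₚ.*-zeroˡ (coeff r k))) (tail k))
    (trans (ℤₚ.+-identityˡ _) (trans (sym (Δ^-shift n (t j) k)) (Δ^-cong n (λ i → sym (Δ-t j i)) k))))
  where
  r = 1-X ^ₚ (n ∸ j)
  tail : ∀ k → coeff (0ℤ ∷ (X^ j ⊗ r)) k ≡ shift (Δ^ n (t j)) k
  tail zero    = refl
  tail (suc k) = coeff-X^⊗1-X^ j≤n k

-- Leibniz rule, where x d/dx sends 1 - x to -x.
Δ-θ : ∀ a k → Δ (θ a) k ≡ θ (Δ a) k + shift a k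
Δ-θ a zero    = lem (a 0)
  where
  lem : ∀ x → 0ℤ * x - 0ℤ ≡ 0ℤ * (x - 0ℤ) + 0ℤ
  lem = solve-∀
Δ-θ a (suc k) = lem (+ k) (a (suc k)) (a k)
  where
  lem : ∀ k x y → (1ℤ + k) * x - k * y ≡ (1ℤ + k) * (x - y) + y
  lem = solve-∀

Δ^-θ : ∀ n a k → Δ^ (suc n) (θ a) k ≡ Δ (θ (Δ^ n a)) k + + n * shift (Δ^ n a) k
Δ^-θ zero    a k = trans (sym (ℤₚ.+-identityʳ (Δ (θ a) k))) (+-congˡ (Δ (θ a) k) (sym (ℤₚ.*-zeroˡ (shift a k))))
Δ^-θ (suc n) a k = begin
  Δ^ (suc n) (Δ (θ a)) k
    ≡⟨ Δ^-cong (suc n) (Δ-θ a) k ⟩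
  Δ^ (suc n) (λ j → θ (Δ a) j + shift a j) k
    ≡⟨ Δ^-+ (suc n) (θ (Δ a)) (shift a) k ⟩
  Δ^ (suc n) (θ (Δ a)) k + Δ^ (suc n) (shift a) k
    ≡⟨ cong₂ _+_ (Δ^-θ n (Δ a) k) (Δ^-shift (suc n) a k) ⟩
  Δ (θ (Δ^ n (Δ a))) k + + n * shift (Δ^ n (Δ a)) k + shift (Δ^ n (Δ a)) k
    ≡⟨ lem (Δ (θ (Δ^ n (Δ a))) k) (+ n) (shift (Δ^ n (Δ a)) k) ⟩
  Δ (θ (Δ^ n (Δ a))) k + + suc n * shift (Δ^ n (Δ a)) k ∎
  where
  open ≡-Reasoning
  lem : ∀ a n s → a + n * s + s ≡ a + (1ℤ + n) * s
  lem = solve-∀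

-- The operator of the descent recurrence on numerators is 2x d/dx on the series, with the exponent
-- of the denominator raised by one.
L-Δ^ : ∀ n a k → L n (Δ^ n a) k ≡ Δ^ (suc n) (λ m → + 2 * θ a m) k
L-Δ^ n a k = trans (expand (Δ^ n a) k) (trans (*-congˡ (+ 2) (sym (Δ^-θ n a k))) (sym (Δ^-* (suc n) (+ 2) (θ a) k)))
  where
  expand : ∀ b k → L n b k ≡ + 2 * (Δ (θ b) k + + n * shift b k)
  expand b zero    = lem (+ n) (b 0)
    where
    lem : ∀ n x → + 2 * (0ℤ * x + (1ℤ + n - 0ℤ) * 0ℤ) ≡ + 2 * (0ℤ * x - 0ℤ + n * 0ℤ)
    lem = solve-∀
  expand b (suc k) = lem (+ n) (+ k) (b (suc k)) (b k)
    where
    lem : ∀ n k x y → + 2 * ((1ℤ + k) * x + (1ℤ + n - (1ℤ + k)) * y) ≡ + 2 * ((1ℤ + k) * x - k * y + n * y)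
    lem = solve-∀

odd : ℕ → ℤ
odd m = 1ℤ + + 2 * + m

-- u n m is the coefficient of xᵐ in B⁺ₙ(x) / (1 - x)ⁿ.
u : ℕ → ℕ → ℤ
u zero    m = t 0 m
u (suc n) m = + 2 * θ (u n) m + odd m ℤ.^ n

-- The classical series B_n(x) / (1 - x)^(n+1) = Σ (2m + 1)ⁿ xᵐ of the type B Eulerian polynomial.
-- The sum of the two recurrences is `L (suc n)` plus multiplication by 1 - x; on the series this is
-- 2x d/dx + 1, which multiplies each coefficient by 2m + 1.
b⁺+b⁻-series : ∀ n k → b⁺ n k + b⁻ n k ≡ Δ^ (suc n) (λ m → odd m ℤ.^ n) k
b⁺+b⁻-series zero    zero    = refl
b⁺+b⁻-series zero    (suc k) = refl
b⁺+b⁻-series (suc n) k = begin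
  b⁺ (suc n) k + b⁻ (suc n) k
    ≡⟨ cong₂ _+_ (b⁺-suc n k) (b⁻-suc n k) ⟩
  L n (b⁺ n) k + (b⁺ n k + b⁻ n k) + (L n (b⁻ n) k + shift s k)
    ≡⟨ cong (λ x → L n (b⁺ n) k + (b⁺ n k + b⁻ n k) + (L n (b⁻ n) k + x)) (shift-+ (b⁺ n) (b⁻ n) k) ⟩
  L n (b⁺ n) k + (b⁺ n k + b⁻ n k) + (L n (b⁻ n) k + (shift (b⁺ n) k + shift (b⁻ n) k))
    ≡⟨ lem (+ n) (+ k) (b⁺ n k) (b⁻ n k) (shift (b⁺ n) k) (shift (b⁻ n) k) ⟩
  + 2 * (+ k * s k + (+ suc (suc n) - + k) * (shift (b⁺ n) k + shift (b⁻ n) k)) + (s k - (shift (b⁺ n) k + shift (b⁻ n) k))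
    ≡⟨ cong (λ x → + 2 * (+ k * s k + (+ suc (suc n) - + k) * x) + (s k - x)) (shift-+ (b⁺ n) (b⁻ n) k) ⟨
  L (suc n) s k + Δ s k
    ≡⟨ cong₂ _+_ (L-cong (suc n) (b⁺+b⁻-series n) k) (Δ-cong (b⁺+b⁻-series n) k) ⟩
  L (suc n) (Δ^ (suc n) g) k + Δ (Δ^ (suc n) g) k
    ≡⟨ cong₂ _+_ (L-Δ^ (suc n) g k) (sym (Δ^-Δ (suc n) g k)) ⟩
  Δ^ (suc (suc n)) (λ m → + 2 * θ g m) k + Δ^ (suc (suc n)) g k
    ≡⟨ Δ^-+ (suc (suc n)) (λ m → + 2 * θ g m) g k ⟨
  Δ^ (suc (suc n)) (λ m → + 2 * θ g m + g m) k
    ≡⟨ Δ^-cong (suc (suc n)) (λ m → lem₂ (+ m) (g m)) k ⟩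
  Δ^ (suc (suc n)) (λ m → odd m ℤ.^ suc n) k ∎
  where
  open ≡-Reasoning
  s g : ℕ → ℤ
  s j = b⁺ n j + b⁻ n j
  g m = odd m ℤ.^ n
  lem : ∀ n k a b c d → + 2 * (k * a + (1ℤ + n - k) * c) + (a + b) + (+ 2 * (k * b + (1ℤ + n - k) * d) + (c + d)) ≡
    + 2 * (k * (a + b) + (1ℤ + (1ℤ + n) - k) * (c + d)) + ((a + b) - (c + d))
  lem = solve-∀
  lem₂ : ∀ m x → + 2 * (m * x) + x ≡ (1ℤ + + 2 * m) * x
  lem₂ = solve-∀

b⁺-series : ∀ n k → b⁺ n k ≡ Δ^ n (u n) k
b⁺-series zero    zero    = refl
b⁺-series zero    (suc k) = refl
b⁺-series (suc n) k = trans (b⁺-suc n k)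
  (trans (cong₂ _+_ (trans (L-cong n (b⁺-series n) k) (L-Δ^ n (u n) k)) (b⁺+b⁻-series n k))
    (sym (Δ^-+ (suc n) (λ m → + 2 * θ (u n) m) (λ m → odd m ℤ.^ n) k)))

u-zero : ∀ n → u n 0 ≡ 1ℤ
u-zero zero    = refl
u-zero (suc n) = trans (cong (λ x → + 2 * x + 1ℤ ℤ.^ n) (ℤₚ.*-zeroˡ (u n 0))) (trans (ℤₚ.+-identityˡ (1ℤ ℤ.^ n)) (ℤₚ.^-zeroˡ n))

-- Stated for m + 1, because at m = 0 the difference of powers is 0 for n = 0 while `u 0 0` is 1.
-- With y = 2m + 1, the bases y + 2 and y + 1 are those that the count of intervals produces.
u-suc : ∀ n m → u n (suc m) ≡ (odd m + + 2) ℤ.^ n - (odd m + 1ℤ) ℤ.^ n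
u-suc zero    m = refl
u-suc (suc n) m = trans (cong₂ (λ x y → + 2 * (+ suc m * x) + y) (u-suc n m) (cong (λ y → y ℤ.^ n) (odd-suc (+ m))))
  (lem (+ m) ((odd m + + 2) ℤ.^ n) ((odd m + 1ℤ) ℤ.^ n))
  where
  odd-suc : ∀ m → 1ℤ + + 2 * (1ℤ + m) ≡ 1ℤ + + 2 * m + + 2
  odd-suc = solve-∀
  lem : ∀ m x y → + 2 * ((1ℤ + m) * (x - y)) + x ≡ (1ℤ + + 2 * m + + 2) * x - (1ℤ + + 2 * m + 1ℤ) * y
  lem = solve-∀

-- Chains and multichains

𝟙-∧ : ∀ a b → 𝟙 (a ∧ b) ≡ 𝟙 a * 𝟙 b
𝟙-∧ true  b = sym (ℤₚ.*-identityˡ (𝟙 b))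
𝟙-∧ false b = sym (ℤₚ.*-zeroˡ (𝟙 b))

module _ {A : Set} where

  filter-absorb : ∀ {P Q : Pred A 0ℓ} (P? : Decidable P) (Q? : Decidable Q) → (∀ {x} → P x → Q x) →
    ∀ xs → filter P? (filter Q? xs) ≡ filter P? xs
  filter-absorb P? Q? P⇒Q [] = refl
  filter-absorb P? Q? P⇒Q (x ∷ xs) with P? x | Q? x
  ... | yes px | yes _  = trans (Listₚ.filter-accept P? px) (cong (x ∷_) (filter-absorb P? Q? P⇒Q xs))
  ... | yes px | no ¬qx = ⊥-elim (¬qx (P⇒Q px))
  ... | no ¬px | yes _  = trans (Listₚ.filter-reject P? ¬px) (filter-absorb P? Q? P⇒Q xs)
  ... | no _   | no _   = filter-absorb P? Q? P⇒Q xs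

  filter-comm : ∀ {P Q : Pred A 0ℓ} (P? : Decidable P) (Q? : Decidable Q) →
    ∀ xs → filter P? (filter Q? xs) ≡ filter Q? (filter P? xs)
  filter-comm P? Q? [] = refl
  filter-comm P? Q? (x ∷ xs) with does (P? x) in p | does (Q? x) in q
  ... | true  | true  rewrite p | q = cong (x ∷_) (filter-comm P? Q? xs)
  ... | true  | false rewrite q = filter-comm P? Q? xs
  ... | false | true  rewrite p = filter-comm P? Q? xs
  ... | false | false = filter-comm P? Q? xs

  ∑ᶻ-sublists-∷ : ∀ (x : A) xs f → ∑ᶻ (sublists (x ∷ xs)) f ≡ ∑ᶻ (sublists xs) (f ∘ (x ∷_)) + ∑ᶻ (sublists xs) f
  ∑ᶻ-sublists-∷ x xs f = trans (∑ᶻ-++ (map (x ∷_) (sublists xs)) (sublists xs) f)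
    (cong (λ z → z + ∑ᶻ (sublists xs) f) (∑ᶻ-map (x ∷_) (sublists xs) f))

  ∑ᶻ-sublists-filter : ∀ {P : Pred A 0ℓ} (P? : Decidable P) xs f →
    ∑ᶻ (sublists xs) (λ c → ⟦ All.all? P? c ⟧ * f c) ≡ ∑ᶻ (sublists (filter P? xs)) f
  ∑ᶻ-sublists-filter P? []       f = cong (λ x → x + 0ℤ) (ℤₚ.*-identityˡ (f []))
  ∑ᶻ-sublists-filter P? (x ∷ xs) f with P? x in eq
  ... | yes px = trans (∑ᶻ-sublists-∷ x xs (λ c → ⟦ All.all? P? c ⟧ * f c))
    (trans (cong₂ _+_ (trans (∑ᶻ-cong (sublists xs) λ c → cong (λ d → 𝟙 (does d ∧ does (All.all? P? c)) * f (x ∷ c)) eq)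
                             (∑ᶻ-sublists-filter P? xs (f ∘ (x ∷_))))
                      (∑ᶻ-sublists-filter P? xs f))
      (sym (∑ᶻ-sublists-∷ x (filter P? xs) f)))
  ... | no ¬px = trans (∑ᶻ-sublists-∷ x xs (λ c → ⟦ All.all? P? c ⟧ * f c))
    (trans (cong₂ _+_ (trans (∑ᶻ-cong (sublists xs) λ c → trans (cong (λ d → 𝟙 (does d ∧ does (All.all? P? c)) * f (x ∷ c)) eq) (ℤₚ.*-zeroˡ (f (x ∷ c))))
                             (∑ᶻ-zero (sublists xs)))
                      (∑ᶻ-sublists-filter P? xs f))
      (ℤₚ.+-identityˡ (∑ᶻ (sublists (filter P? xs)) f)))

  ∑ᶻ-select : ∀ {xs : List A} (_≟_ : (x y : A) → Dec (x ≡ y)) → Unique xs → ∀ {x} → x ∈ xs → ∀ (f : A → ℤ) →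
    ∑ᶻ xs (λ y → ⟦ y ≟ x ⟧ * f y) ≡ f x
  ∑ᶻ-select {y ∷ xs} _≟_ (y∉ ∷ uq) {x} (here refl) f = trans (cong₂ _+_
    (trans (cong (λ z → z * f x) (⟦⟧-yes (x ≟ x) refl)) (ℤₚ.*-identityˡ (f x)))
    (trans (∑ᶻ-cong-∈ xs λ {z} z∈ → trans (cong (λ w → w * f z) (⟦⟧-no (z ≟ x) (All.lookup y∉ z∈ ∘ sym))) (ℤₚ.*-zeroˡ (f z)))
      (∑ᶻ-zero xs))) (ℤₚ.+-identityʳ (f x))
  ∑ᶻ-select {y ∷ xs} _≟_ (y∉ ∷ uq) {x} (there x∈) f = trans (cong₂ _+_
    (trans (cong (λ z → z * f y) (⟦⟧-no (y ≟ x) (All.lookup y∉ x∈))) (ℤₚ.*-zeroˡ (f y)))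
    (∑ᶻ-select _≟_ uq x∈ f)) (ℤₚ.+-identityˡ (f x))

  ∈-sublists : ∀ {c} (xs : List A) → c ∈ sublists xs → c Sublist.⊆ xs
  ∈-sublists []       (here refl) = Sublist.[]
  ∈-sublists (x ∷ xs) c∈ with ∈ₚ.∈-++⁻ (map (x ∷_) (sublists xs)) c∈
  ... | inj₂ c∈′ = x Sublist.∷ʳ ∈-sublists xs c∈′
  ... | inj₁ c∈′ with ∈ₚ.∈-map⁻ (x ∷_) c∈′
  ...   | c′ , c′∈ , refl = refl Sublist.∷ ∈-sublists xs c′∈

  lookup-injective : ∀ {xs : List A} → Unique xs → ∀ {i j} → List.lookup xs i ≡ List.lookup xs j → i ≡ j
  lookup-injective (x∉ ∷ uq) {Fin.zero}  {Fin.zero}  e = refl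
  lookup-injective (x∉ ∷ uq) {Fin.zero}  {Fin.suc j} e = ⊥-elim (All.lookup x∉ (∈ₚ.∈-lookup j) e)
  lookup-injective (x∉ ∷ uq) {Fin.suc i} {Fin.zero}  e = ⊥-elim (All.lookup x∉ (∈ₚ.∈-lookup i) (sym e))
  lookup-injective (x∉ ∷ uq) {Fin.suc i} {Fin.suc j} e = cong Fin.suc (lookup-injective uq e)

unique-bounded : ∀ {xs : List ℕ} {m} → Unique xs → All (ℕ._< m) xs → length xs ≤ m
unique-bounded {xs} {m} uq b = Finₚ.injective⇒≤ {f = λ i → Fin.fromℕ< (All.lookup b (∈ₚ.∈-lookup {xs = xs} i))}
  λ {i} {j} e → lookup-injective uq (trans (sym (Finₚ.toℕ-fromℕ< _)) (trans (cong toℕ e) (Finₚ.toℕ-fromℕ< _)))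

module _ {A : Set} {_≼_ : Rel A 0ℓ} (po : IsDecPartialOrder _≡_ _≼_) where
  open IsDecPartialOrder po using (_≟_) renaming (_≤?_ to _≼?_; trans to ≼-trans; antisym to ≼-antisym; refl to ≼-refl)

  comparable? : ∀ x y → Dec (x ≼ y ⊎ y ≼ x)
  comparable? x y = (x ≼? y) ⊎-dec (y ≼? x)

  chain? : Decidable (Chain _≼_)
  chain? = AllPairs.allPairs? comparable?

  _≺_ : Rel A 0ℓ
  y ≺ x = y ≼ x × y ≢ x

  _≺?_ : ∀ y x → Dec (y ≺ x)
  y ≺? x = (y ≼? x) ×-dec ¬? (y ≟ x)

  below : A → List A → List A
  below x = filter (_≺? x)

  chainSum : (ℕ → ℤ) → List A → ℤ
  chainSum g xs = ∑ᶻ (sublists xs) (λ c → ⟦ chain? c ⟧ * g (length c))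

  chainSum-+ : ∀ f g xs → chainSum (λ k → f k + g k) xs ≡ chainSum f xs + chainSum g xs
  chainSum-+ f g xs = trans (∑ᶻ-cong (sublists xs) λ c → ℤₚ.*-distribˡ-+ ⟦ chain? c ⟧ (f (length c)) (g (length c)))
    (∑ᶻ-+ (sublists xs) _ _)

  chainSum-zero : ∀ xs → chainSum (λ _ → 0ℤ) xs ≡ 0ℤ
  chainSum-zero xs = trans (∑ᶻ-cong (sublists xs) λ c → ℤₚ.*-zeroʳ ⟦ chain? c ⟧) (∑ᶻ-zero (sublists xs))

  chainSum-∷ : ∀ g x xs → chainSum g (x ∷ xs) ≡ chainSum (g ∘ suc) (filter (comparable? x) xs) + chainSum g xs
  chainSum-∷ g x xs = trans (∑ᶻ-sublists-∷ x xs _) (cong (λ z → z + chainSum g xs)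
    (trans (∑ᶻ-cong (sublists xs) λ c → trans (cong (λ z → z * g (suc (length c))) (𝟙-∧ (does (All.all? (comparable? x) c)) (does (chain? c))))
              (ℤₚ.*-assoc ⟦ All.all? (comparable? x) c ⟧ ⟦ chain? c ⟧ (g (suc (length c)))))
           (∑ᶻ-sublists-filter (comparable? x) xs (λ c → ⟦ chain? c ⟧ * g (suc (length c))))))

  below-∷-≺ : ∀ {x y} xs → x ≺ y → below y (x ∷ xs) ≡ x ∷ below y xs
  below-∷-≺ xs x≺y = Listₚ.filter-accept (_≺? _) x≺y

  below-∷-⊀ : ∀ {x y} xs → ¬ x ≺ y → below y (x ∷ xs) ≡ below y xs
  below-∷-⊀ xs x⊀y = Listₚ.filter-reject (_≺? _) x⊀y

  below-below : ∀ {x y} xs → y ≺ x → below y (below x xs) ≡ below y xs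
  below-below {x} {y} xs (y≼x , y≢x) = filter-absorb (_≺? y) (_≺? x)
    (λ { (z≼y , z≢y) → ≼-trans z≼y y≼x , λ { refl → z≢y (≼-antisym z≼y y≼x) } }) xs

  chainSum-below-∷ : ∀ g x y xs → chainSum g (below y (x ∷ xs)) ≡
    ⟦ x ≺? y ⟧ * chainSum (g ∘ suc) (filter (comparable? x) (below y xs)) + chainSum g (below y xs)
  chainSum-below-∷ g x y xs = go (x ≺? y)
    where
    r = chainSum (g ∘ suc) (filter (comparable? x) (below y xs))
    go : (d : Dec (x ≺ y)) → chainSum g (below y (x ∷ xs)) ≡ ⟦ d ⟧ * r + chainSum g (below y xs)
    go (yes x≺y) = trans (cong (chainSum g) (below-∷-≺ xs x≺y)) (trans (chainSum-∷ g x (below y xs))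
      (cong (λ z → z + chainSum g (below y xs)) (sym (ℤₚ.*-identityˡ r))))
    go (no x⊀y)  = trans (cong (chainSum g) (below-∷-⊀ xs x⊀y))
      (trans (sym (ℤₚ.+-identityˡ _)) (cong (λ z → z + chainSum g (below y xs)) (sym (ℤₚ.*-zeroˡ r))))

  -- Sorting the nonempty chains by their greatest elements.
  chainSum-top : ∀ {xs} → Unique xs → ∀ g → chainSum g xs ≡ g 0 + ∑ᶻ xs (λ x → chainSum (g ∘ suc) (below x xs))
  chainSum-top {xs} uq g = go (length xs) xs ℕₚ.≤-refl uq g
    where
    open ≡-Reasoning
    -- `N` bounds the length, since the recursive calls are on filtered lists. The list is not
    -- sorted by the order, so its head may occur anywhere in a chain.
    go : ∀ N xs → length xs ≤ N → Unique xs → ∀ g →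
      chainSum g xs ≡ g 0 + ∑ᶻ xs (λ x → chainSum (g ∘ suc) (below x xs))
    go N []       _         _           g = cong (λ z → z + 0ℤ) (ℤₚ.*-identityˡ (g 0))
    go (suc N) (x ∷ xs) (s≤s len) (x∉ ∷ uq) g = begin
      chainSum g (x ∷ xs)
        ≡⟨ chainSum-∷ g x xs ⟩
      chainSum g′ ys + chainSum g xs
        ≡⟨ cong₂ _+_ ys-sum (go N xs len uq g) ⟩
      chainSum g′ zs + S + (g 0 + ∑ᶻ xs (λ y → chainSum g′ (below y xs)))
        ≡⟨ rearrange (chainSum g′ zs) S (g 0) (∑ᶻ xs (λ y → chainSum g′ (below y xs))) ⟩
      g 0 + (chainSum g′ zs + (S + ∑ᶻ xs (λ y → chainSum g′ (below y xs))))
        ≡⟨ +-congˡ (g 0) (cong₂ _+_ (cong (chainSum g′) (sym (below-∷-⊀ xs λ { (_ , x≢x) → x≢x refl })))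
             (trans (sym (∑ᶻ-+ xs _ _)) (∑ᶻ-cong xs λ y → sym (chainSum-below-∷ g′ x y xs)))) ⟩
      g 0 + (chainSum g′ (below x (x ∷ xs)) + ∑ᶻ xs (λ y → chainSum g′ (below y (x ∷ xs)))) ∎
      where
      g′ = g ∘ suc
      g″ = g′ ∘ suc
      ys = filter (comparable? x) xs
      zs = below x xs
      S = ∑ᶻ xs (λ y → ⟦ x ≺? y ⟧ * chainSum g″ (filter (comparable? x) (below y xs)))
      rearrange : ∀ a b c d → a + b + (c + d) ≡ c + (a + (b + d))
      rearrange = solve-∀

      -- For chains through x, y is the greatest of the other elements. If y ≺ x, everything below y
      -- is comparable to x automatically and x is on top; if x ≺ y, comparability to x remains a
      -- condition.
      term : ∀ {y} → y ∈ xs → ⟦ comparable? x y ⟧ * chainSum g″ (below y ys) ≡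
        ⟦ y ≺? x ⟧ * chainSum g″ (below y zs) + ⟦ x ≺? y ⟧ * chainSum g″ (filter (comparable? x) (below y xs))
      term {y} y∈ = cases (comparable? x y) (y ≺? x) (x ≺? y)
        where
        x≢y : x ≢ y
        x≢y = All.lookup x∉ y∈
        a = chainSum g″ (below y ys)
        b = chainSum g″ (below y zs)
        c = chainSum g″ (filter (comparable? x) (below y xs))
        one : ∀ b c → 1ℤ * b ≡ 1ℤ * b + 0ℤ * c
        one = solve-∀
        two : ∀ b c → 1ℤ * c ≡ 0ℤ * b + 1ℤ * c
        two = solve-∀
        none : ∀ a b c → 0ℤ * a ≡ 0ℤ * b + 0ℤ * c
        none = solve-∀
        a≡b : y ≺ x → a ≡ b
        a≡b y≺x = cong (chainSum g″) (trans
          (filter-absorb (_≺? y) (comparable? x) (λ (z≼y , _) → inj₂ (≼-trans z≼y (proj₁ y≺x))) xs)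
          (sym (below-below xs y≺x)))
        a≡c : a ≡ c
        a≡c = cong (chainSum g″) (filter-comm (_≺? y) (comparable? x) xs)
        cases : (p : Dec (x ≼ y ⊎ y ≼ x)) (q : Dec (y ≺ x)) (r : Dec (x ≺ y)) → ⟦ p ⟧ * a ≡ ⟦ q ⟧ * b + ⟦ r ⟧ * c
        cases _ (yes (y≼x , _)) (yes (x≼y , _))                = ⊥-elim (x≢y (≼-antisym x≼y y≼x))
        cases (yes _) (yes y≺x) (no _)                         = trans (*-congˡ 1ℤ (a≡b y≺x)) (one b c)
        cases (no ¬p) (yes (y≼x , _)) (no _)                   = ⊥-elim (¬p (inj₂ y≼x))
        cases (yes _) (no _) (yes _)                           = trans (*-congˡ 1ℤ a≡c) (two b c)
        cases (no ¬p) (no _) (yes (x≼y , _))                   = ⊥-elim (¬p (inj₁ x≼y))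
        cases (yes (inj₁ x≼y)) (no _) (no ¬r)                  = ⊥-elim (¬r (x≼y , x≢y))
        cases (yes (inj₂ y≼x)) (no ¬q) (no _)                  = ⊥-elim (¬q (y≼x , x≢y ∘ sym))
        cases (no _) (no _) (no _)                             = none a b c

      ys-sum : chainSum g′ ys ≡ chainSum g′ zs + S
      ys-sum = begin
        chainSum g′ ys
          ≡⟨ go N ys (ℕₚ.≤-trans (Listₚ.length-filter (comparable? x) xs) len) (Uniqueₚ.filter⁺ (comparable? x) uq) g′ ⟩
        g′ 0 + ∑ᶻ ys (λ y → chainSum g″ (below y ys))
          ≡⟨ +-congˡ (g′ 0) (trans (∑ᶻ-filter (comparable? x) xs _) (trans (∑ᶻ-cong-∈ xs term) (∑ᶻ-+ xs _ _))) ⟩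
        g′ 0 + (∑ᶻ xs (λ y → ⟦ y ≺? x ⟧ * chainSum g″ (below y zs)) + S)
          ≡⟨ ℤₚ.+-assoc (g′ 0) _ S ⟨
        g′ 0 + ∑ᶻ xs (λ y → ⟦ y ≺? x ⟧ * chainSum g″ (below y zs)) + S
          ≡⟨ cong (λ z → g′ 0 + z + S) (sym (∑ᶻ-filter (_≺? x) xs _)) ⟩
        g′ 0 + ∑ᶻ zs (λ y → chainSum g″ (below y zs)) + S
          ≡⟨ cong (λ z → z + S) (go N zs (ℕₚ.≤-trans (Listₚ.length-filter (_≺? x) xs) len) (Uniqueₚ.filter⁺ (_≺? x) uq) g′) ⟨
        chainSum g′ zs + S ∎

  -- The number of multichains x₁ ≼ ⋯ ≼ xₘ in xs: a chain of k elements is the support of t k m of them.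
  multichains : ℕ → List A → ℤ
  multichains m = chainSum (λ k → t k m)

  multichains-zero : ∀ {ys} → Unique ys → multichains 0 ys ≡ 1ℤ
  multichains-zero {ys} uq′ = trans (chainSum-top uq′ (λ k → t k 0))
    (cong (λ z → 1ℤ + z) (trans (∑ᶻ-cong ys λ x → chainSum-zero (below x ys)) (∑ᶻ-zero ys)))

  chainCount-nonneg : ∀ k ys → 0ℤ ℤ.≤ chainSum (δ k) ys
  chainCount-nonneg k ys = ∑ᶻ-nonneg (sublists ys) λ c → product (does (chain? c)) (length c) k
    where
    product : ∀ b l k → 0ℤ ℤ.≤ 𝟙 b * δ k l
    product false l       k       = ℤₚ.≤-reflexive (sym (ℤₚ.*-zeroˡ (δ k l)))
    product true  zero    zero    = ℤ.+≤+ z≤n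
    product true  zero    (suc k) = ℤ.+≤+ z≤n
    product true  (suc l) zero    = ℤ.+≤+ z≤n
    product true  (suc l) (suc k) = product true l k

  -- Chains of a given length are produced by keeping their number positive, so that `chainSum-top`
  -- supplies the extension by a greatest element.
  chainCount-suc : ∀ k {ys y} → Unique ys → y ∈ ys → 1ℤ ℤ.≤ chainSum (δ k) (below y ys) → 1ℤ ℤ.≤ chainSum (δ (suc k)) ys
  chainCount-suc k {ys} {y} uq′ y∈ h = ℤₚ.≤-trans h (ℤₚ.≤-trans
    (∑ᶻ-≥-term (λ x → chainCount-nonneg k (below x ys)) y∈)
    (ℤₚ.≤-reflexive (sym (trans (chainSum-top uq′ (δ (suc k))) (ℤₚ.+-identityˡ _)))))

  chainCount-zero : ∀ {ys} → Unique ys → chainSum (δ 0) ys ≡ 1ℤ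
  chainCount-zero {ys} uq′ = trans (chainSum-top uq′ (δ 0))
    (cong (λ z → 1ℤ + z) (trans (∑ᶻ-cong ys λ x → chainSum-zero (below x ys)) (∑ᶻ-zero ys)))

  module _ {xs : List A} (uq : Unique xs) where

    -- The number of multichains x₁ ≼ ⋯ ≼ xₘ ≼ x in xs; the second summand counts those with xₘ = x.
    multichainsTo : A → ℕ → ℤ
    multichainsTo x m = multichains m (below x xs) + chainSum (λ k → t (suc k) m) (below x xs)

    -- `ys` is closed downwards in `xs`, because the lemma serves for `xs` itself and for the
    -- elements below some x. The recursion of `t` distinguishes whether the greatest entry x occurs
    -- once or more often.
    multichains-suc : ∀ {ys} → Unique ys → (∀ {x} → x ∈ ys → below x ys ≡ below x xs) →
      ∀ m → multichains (suc m) ys ≡ ∑ᶻ ys (λ x → multichainsTo x m)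
    multichains-suc {ys} uq′ e m = trans (chainSum-top uq′ (λ k → t k (suc m))) (trans (ℤₚ.+-identityˡ _)
      (∑ᶻ-cong-∈ ys λ {x} x∈ → trans (chainSum-+ (λ k → t k m) (λ k → t (suc k) m) (below x ys))
        (cong (λ zs → multichains m zs + chainSum (λ k → t (suc k) m) zs) (e x∈))))

    below-unique : ∀ x → Unique (below x xs)
    below-unique x = Uniqueₚ.filter⁺ (_≺? x) uq

    multichainsTo-zero : ∀ x → multichainsTo x 0 ≡ 1ℤ
    multichainsTo-zero x = trans (cong₂ _+_ (multichains-zero (below-unique x)) (chainSum-zero (below x xs))) refl

    multichainsTo-suc : ∀ {x} → x ∈ xs → ∀ m → multichainsTo x (suc m) ≡ ∑ᶻ xs (λ y → ⟦ y ≼? x ⟧ * multichainsTo y m)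
    multichainsTo-suc {x} x∈ m = begin
      multichains (suc m) (below x xs) + chainSum (λ k → t k m + t (suc k) m) (below x xs)
        ≡⟨ cong₂ _+_ (trans (multichains-suc (below-unique x) (λ y∈ → below-below xs (proj₂ (∈ₚ.∈-filter⁻ (_≺? x) {xs = xs} y∈))) m)
             (∑ᶻ-filter (_≺? x) xs _)) (chainSum-+ (λ k → t k m) (λ k → t (suc k) m) (below x xs)) ⟩
      ∑ᶻ xs (λ y → ⟦ y ≺? x ⟧ * multichainsTo y m) + multichainsTo x m
        ≡⟨ +-congˡ (∑ᶻ xs (λ y → ⟦ y ≺? x ⟧ * multichainsTo y m)) (∑ᶻ-select _≟_ uq x∈ (λ y → multichainsTo y m)) ⟨
      ∑ᶻ xs (λ y → ⟦ y ≺? x ⟧ * multichainsTo y m) + ∑ᶻ xs (λ y → ⟦ y ≟ x ⟧ * multichainsTo y m)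
        ≡⟨ ∑ᶻ-+ xs _ _ ⟨
      ∑ᶻ xs (λ y → ⟦ y ≺? x ⟧ * multichainsTo y m + ⟦ y ≟ x ⟧ * multichainsTo y m)
        ≡⟨ ∑ᶻ-cong xs (λ y → trans (sym (ℤₚ.*-distribʳ-+ (multichainsTo y m) ⟦ y ≺? x ⟧ ⟦ y ≟ x ⟧))
             (cong (λ z → z * multichainsTo y m) (split (y ≼? x) (y ≺? x) (y ≟ x)))) ⟩
      ∑ᶻ xs (λ y → ⟦ y ≼? x ⟧ * multichainsTo y m) ∎
      where
      open ≡-Reasoning
      split : ∀ {y} (p : Dec (y ≼ x)) (q : Dec (y ≺ x)) (r : Dec (y ≡ x)) → ⟦ q ⟧ + ⟦ r ⟧ ≡ ⟦ p ⟧
      split (yes _) (yes _)         (no _)     = refl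
      split (yes _) (no _)          (yes _)    = refl
      split (no _)  (no _)          (no _)     = refl
      split _       (yes (_ , y≢x)) (yes y≡x)  = ⊥-elim (y≢x y≡x)
      split (yes p) (no ¬q)         (no y≢x)   = ⊥-elim (¬q (p , y≢x))
      split (no ¬p) (yes (p , _))   _          = ⊥-elim (¬p p)
      split (no ¬p) _               (yes refl) = ⊥-elim (¬p ≼-refl)

    module _ (w : A → ℕ → ℤ) (w-zero : ∀ x → w x 0 ≡ 1ℤ)
             (w-suc : ∀ {x} → x ∈ xs → ∀ m → ∑ᶻ xs (λ y → ⟦ y ≼? x ⟧ * w y m) ≡ w x (suc m)) where

      -- The recurrence over the order and the value 1 at m = 0 determine the counts, so a guessed
      -- formula `w` only has to be verified.
      multichainsTo-unique : ∀ m {x} → x ∈ xs → multichainsTo x m ≡ w x m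
      multichainsTo-unique zero    {x} x∈ = trans (multichainsTo-zero x) (sym (w-zero x))
      multichainsTo-unique (suc m) {x} x∈ = trans (multichainsTo-suc x∈ m)
        (trans (∑ᶻ-cong-∈ xs λ {y} y∈ → *-congˡ ⟦ y ≼? x ⟧ (multichainsTo-unique m y∈)) (w-suc x∈ m))

      multichains-total : ∀ m → multichains (suc m) xs ≡ ∑ᶻ xs (λ x → w x m)
      multichains-total m = trans (multichains-suc uq (λ _ → refl) m) (∑ᶻ-cong-∈ xs (multichainsTo-unique m))

    module _ (r : A → ℕ) where

      -- A strictly monotone `r` is injective on a chain, and it takes values below m.
      chain-length : (∀ {x y} → x ∈ xs → y ∈ xs → y ≺ x → r y ℕ.< r x) → ∀ {m} → (∀ {x} → x ∈ xs → r x ℕ.< m) →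
        ∀ {c} → c ∈ sublists xs → Chain _≼_ c → length c ≤ m
      chain-length mono {m} bound {c} c∈ ch = subst (_≤ m) (Listₚ.length-map r c)
        (unique-bounded (distinct c (λ x∈ → Sublist.lookup c⊆xs x∈) (AllPairs-⊆ c⊆xs uq) ch)
          (Allₚ.map⁺ (All.tabulate λ x∈ → bound (Sublist.lookup c⊆xs x∈))))
        where
        c⊆xs = ∈-sublists xs c∈
        distinct : ∀ c → (∀ {x} → x ∈ c → x ∈ xs) → Unique c → Chain _≼_ c → Unique (map r c)
        distinct []      _  _          _          = []
        distinct (x ∷ c) ∈xs (x∉ ∷ uq) (cmp ∷ ch) =
          Allₚ.map⁺ (All.tabulate λ {y} y∈ e → differ (∈xs (here refl)) (∈xs (there y∈)) (All.lookup x∉ y∈) (All.lookup cmp y∈) e)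
            ∷ distinct c (∈xs ∘ there) uq ch
          where
          differ : ∀ {x y} → x ∈ xs → y ∈ xs → x ≢ y → x ≼ y ⊎ y ≼ x → r x ≢ r y
          differ x∈ y∈ x≢y (inj₁ x≼y) e = ℕₚ.<⇒≢ (mono y∈ x∈ (x≼y , x≢y)) e
          differ x∈ y∈ x≢y (inj₂ y≼x) e = ℕₚ.<⇒≢ (mono x∈ y∈ (y≼x , x≢y ∘ sym)) (sym e)

      -- Descent from x through covered elements lowers `r` by one at each step and so finds k
      -- elements below x.
      chainCount-below : (∀ {x k} → x ∈ xs → r x ≡ suc k → ∃[ y ] y ∈ xs × y ≺ x × r y ≡ k) →
        ∀ k {x} → x ∈ xs → r x ≡ k → 1ℤ ℤ.≤ chainSum (δ k) (below x xs)
      chainCount-below cover zero    {x} x∈ _ = ℤₚ.≤-reflexive (sym (chainCount-zero (below-unique x)))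
      chainCount-below cover (suc k) {x} x∈ e with cover x∈ e
      ... | y , y∈ , y≺x , e′ = chainCount-suc k (below-unique x) (∈ₚ.∈-filter⁺ (_≺? x) y∈ y≺x)
        (subst (λ zs → 1ℤ ℤ.≤ chainSum (δ k) zs) (sym (below-below xs y≺x)) (chainCount-below cover k y∈ e′))

  chain-exists : ∀ k ys → 1ℤ ℤ.≤ chainSum (δ k) ys → ∃[ c ] c ∈ sublists ys × Chain _≼_ c × length c ≡ k
  chain-exists k ys h = find (sublists ys) h
    where
    δ-≢ : ∀ {k l} → l ≢ k → δ k l ≡ 0ℤ
    δ-≢ {zero}  {zero}  l≢k = ⊥-elim (l≢k refl)
    δ-≢ {zero}  {suc l} l≢k = refl
    δ-≢ {suc k} {zero}  l≢k = refl
    δ-≢ {suc k} {suc l} l≢k = δ-≢ (l≢k ∘ cong suc)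
    rest : List (List A) → ℤ
    rest cs = ∑ᶻ cs (λ c → ⟦ chain? c ⟧ * δ k (length c))
    find : ∀ cs → 1ℤ ℤ.≤ rest cs → ∃[ c ] c ∈ cs × Chain _≼_ c × length c ≡ k
    find (c ∷ cs) h with chain? c | length c ℕₚ.≟ k
    ... | yes ch | yes e = c , here refl , ch , e
    ... | no _   | _     with c′ , c′∈ , p ← find cs (subst (1ℤ ℤ.≤_) (trans (cong (λ z → z + rest cs) (ℤₚ.*-zeroˡ (δ k (length c)))) (ℤₚ.+-identityˡ (rest cs))) h) = c′ , there c′∈ , p
    ... | yes _  | no ≢k with c′ , c′∈ , p ← find cs (subst (1ℤ ℤ.≤_) (trans (cong (λ z → 1ℤ * z + rest cs) (δ-≢ ≢k)) (ℤₚ.+-identityˡ (rest cs))) h) = c′ , there c′∈ , p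
    find [] (ℤ.+≤+ ())

-- Intervals of the Boolean lattice

-- For A ⊆ B this is the number of elements of B outside A, the rank of [A, B] in the poset of
-- intervals.
height : ∀ {n} → Subset n → Subset n → ℕ
height Vec.[]              Vec.[]             = 0
height (outside Vec.∷ A)   (inside Vec.∷ B)   = suc (height A B)
height (outside Vec.∷ A)   (outside Vec.∷ B)  = height A B
height (inside Vec.∷ A)    (b Vec.∷ B)        = height A B

implies : Bool → Bool → Bool
implies a b = not a ∨ b

⊆?-∷ : ∀ {n} a b (A B : Subset n) → ⟦ (a Vec.∷ A) Subsetₚ.⊆? (b Vec.∷ B) ⟧ ≡ 𝟙 (implies a b) * ⟦ A Subsetₚ.⊆? B ⟧
⊆?-∷ outside b       A B = sym (ℤₚ.*-identityˡ ⟦ A Subsetₚ.⊆? B ⟧)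
⊆?-∷ inside  outside A B = sym (ℤₚ.*-zeroˡ ⟦ A Subsetₚ.⊆? B ⟧)
⊆?-∷ inside  inside  A B = sym (ℤₚ.*-identityˡ ⟦ A Subsetₚ.⊆? B ⟧)

inside⊈outside : ∀ {n} {A B : Subset n} → ¬ (inside Vec.∷ A) Subset.⊆ (outside Vec.∷ B)
inside⊈outside s with () ← s Vec.here

∑-allSubsets-suc : ∀ n (f : Subset (suc n) → ℤ) → ∑ᶻ (allSubsets (suc n)) f ≡
  ∑ᶻ (allSubsets n) (f ∘ (inside Vec.∷_)) + ∑ᶻ (allSubsets n) (f ∘ (outside Vec.∷_))
∑-allSubsets-suc n f = trans (∑ᶻ-cartesianProductWith Vec._∷_ (inside ∷ outside ∷ []) (allSubsets n) f)
  (+-congˡ (∑ᶻ (allSubsets n) (f ∘ (inside Vec.∷_))) (ℤₚ.+-identityʳ (∑ᶻ (allSubsets n) (f ∘ (outside Vec.∷_)))))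

-- Weight of one coordinate of a pair (A, B), according to its membership in A and in B. Summed over
-- all pairs, a product of such weights factors into sums of four entries.
Kernel : Set
Kernel = Bool → Bool → ℤ

kernelProduct : ∀ {n} → Vec Kernel n → Subset n → Subset n → ℤ
kernelProduct Vec.[]        Vec.[]        Vec.[]        = 1ℤ
kernelProduct (κ Vec.∷ κs) (a Vec.∷ A) (b Vec.∷ B) = κ a b * kernelProduct κs A B

kernelTotal : ∀ {n} → Vec Kernel n → ℤ
kernelTotal Vec.[]       = 1ℤ
kernelTotal (κ Vec.∷ κs) = (κ inside inside + κ inside outside + (κ outside inside + κ outside outside)) * kernelTotal κs

∑-kernelProduct : ∀ {n} (κs : Vec Kernel n) →
  ∑ᶻ (allSubsets n) (λ A → ∑ᶻ (allSubsets n) (kernelProduct κs A)) ≡ kernelTotal κs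
∑-kernelProduct Vec.[]                = refl
∑-kernelProduct {suc n} (κ Vec.∷ κs) = begin
  ∑ᶻ (allSubsets (suc n)) (λ A → ∑ᶻ (allSubsets (suc n)) (kernelProduct (κ Vec.∷ κs) A))
    ≡⟨ trans (∑-allSubsets-suc n _) (cong₂ _+_ (row inside) (row outside)) ⟩
  κ inside inside * T + κ inside outside * T + (κ outside inside * T + κ outside outside * T)
    ≡⟨ lem (κ inside inside) (κ inside outside) (κ outside inside) (κ outside outside) T ⟩
  (κ inside inside + κ inside outside + (κ outside inside + κ outside outside)) * T
    ≡⟨ *-congˡ (κ inside inside + κ inside outside + (κ outside inside + κ outside outside)) (∑-kernelProduct κs) ⟩
  (κ inside inside + κ inside outside + (κ outside inside + κ outside outside)) * kernelTotal κs ∎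
  where
  open ≡-Reasoning
  T = ∑ᶻ (allSubsets n) (λ A → ∑ᶻ (allSubsets n) (kernelProduct κs A))
  lem : ∀ a b c d t → a * t + b * t + (c * t + d * t) ≡ (a + b + (c + d)) * t
  lem = solve-∀
  entry : ∀ a b → ∑ᶻ (allSubsets n) (λ A → ∑ᶻ (allSubsets n) (λ B → κ a b * kernelProduct κs A B)) ≡ κ a b * T
  entry a b = trans (∑ᶻ-cong (allSubsets n) λ A → ∑ᶻ-* (allSubsets n) (κ a b) (kernelProduct κs A))
    (∑ᶻ-* (allSubsets n) (κ a b) _)
  row : ∀ a → ∑ᶻ (allSubsets n) (λ A → ∑ᶻ (allSubsets (suc n)) (kernelProduct (κ Vec.∷ κs) (a Vec.∷ A)))
            ≡ κ a inside * T + κ a outside * T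
  row a = trans (∑ᶻ-cong (allSubsets n) λ A → ∑-allSubsets-suc n _)
    (trans (∑ᶻ-+ (allSubsets n) _ _) (cong₂ _+_ (entry a inside) (entry a outside)))

weight : ℤ → Kernel
weight y outside inside  = y
weight y outside outside = 1ℤ
weight y inside  b       = 1ℤ

-- The bits a₀, b₀ bound a, b by a₀ ≤ a ≤ b ≤ b₀.
boundedKernel emptyKernel : ℤ → Bool → Bool → Kernel
boundedKernel y a₀ b₀ a b = 𝟙 (implies a₀ a) * (𝟙 (implies a b) * (𝟙 (implies b b₀) * weight y a b))
emptyKernel   y a₀ b₀ a b = 𝟙 (not a) * boundedKernel y a₀ b₀ a b

module _ (y : ℤ) where

  height-weight : ∀ {n} a b (A B : Subset n) → y ℤ.^ height (a Vec.∷ A) (b Vec.∷ B) ≡ weight y a b * y ℤ.^ height A B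
  height-weight outside inside  A B = refl
  height-weight outside outside A B = sym (ℤₚ.*-identityˡ (y ℤ.^ height A B))
  height-weight inside  b       A B = sym (ℤₚ.*-identityˡ (y ℤ.^ height A B))

  boundedTerm : ∀ {n} → Subset n → Subset n → Subset n → Subset n → ℤ
  boundedTerm A₀ B₀ A B = ⟦ A₀ Subsetₚ.⊆? A ⟧ * (⟦ A Subsetₚ.⊆? B ⟧ * (⟦ B Subsetₚ.⊆? B₀ ⟧ * y ℤ.^ height A B))

  boundedTerm-product : ∀ {n} (A₀ B₀ A B : Subset n) →
    boundedTerm A₀ B₀ A B ≡ kernelProduct (Vec.zipWith (boundedKernel y) A₀ B₀) A B
  boundedTerm-product Vec.[] Vec.[] Vec.[] Vec.[] = refl
  boundedTerm-product (a₀ Vec.∷ A₀) (b₀ Vec.∷ B₀) (a Vec.∷ A) (b Vec.∷ B) = trans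
    (cong₂ _*_ (⊆?-∷ a₀ a A₀ A) (cong₂ _*_ (⊆?-∷ a b A B) (cong₂ _*_ (⊆?-∷ b b₀ B B₀) (height-weight a b A B))))
    (trans (lem (𝟙 (implies a₀ a)) ⟦ A₀ Subsetₚ.⊆? A ⟧ (𝟙 (implies a b)) ⟦ A Subsetₚ.⊆? B ⟧
                (𝟙 (implies b b₀)) ⟦ B Subsetₚ.⊆? B₀ ⟧ (weight y a b) (y ℤ.^ height A B))
      (*-congˡ (boundedKernel y a₀ b₀ a b) (boundedTerm-product A₀ B₀ A B)))
    where
    lem : ∀ a a′ b b′ c c′ d d′ → a * a′ * (b * b′ * (c * c′ * (d * d′))) ≡ a * (b * (c * d)) * (a′ * (b′ * (c′ * d′)))
    lem = solve-∀

  -- Emptiness of A is a condition on each coordinate, unlike nonemptiness; hence the complementary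
  -- count.
  nonempty-∷ : ∀ {n} a (A : Subset n) → 1ℤ - ⟦ Subsetₚ.nonempty? (a Vec.∷ A) ⟧ ≡ 𝟙 (not a) * (1ℤ - ⟦ Subsetₚ.nonempty? A ⟧)
  nonempty-∷ inside  A = trans (cong (λ z → 1ℤ - z) (⟦⟧-yes (Subsetₚ.nonempty? (inside Vec.∷ A)) (Fin.zero , Vec.here)))
    (sym (ℤₚ.*-zeroˡ (1ℤ - ⟦ Subsetₚ.nonempty? A ⟧)))
  nonempty-∷ outside A = trans (cong (λ z → 1ℤ - z) (⟦⟧-⇔ (Subsetₚ.nonempty? (outside Vec.∷ A)) (Subsetₚ.nonempty? A)
      (λ { (Fin.suc i , Vec.there i∈) → i , i∈ }) (λ { (i , i∈) → Fin.suc i , Vec.there i∈ })))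
    (sym (ℤₚ.*-identityˡ (1ℤ - ⟦ Subsetₚ.nonempty? A ⟧)))

  emptyTerm-product : ∀ {n} (A₀ B₀ A B : Subset n) →
    (1ℤ - ⟦ Subsetₚ.nonempty? A ⟧) * boundedTerm A₀ B₀ A B ≡ kernelProduct (Vec.zipWith (emptyKernel y) A₀ B₀) A B
  emptyTerm-product Vec.[] Vec.[] Vec.[] Vec.[] = refl
  emptyTerm-product (a₀ Vec.∷ A₀) (b₀ Vec.∷ B₀) (a Vec.∷ A) (b Vec.∷ B) = trans
    (cong₂ _*_ (nonempty-∷ a A) (trans (boundedTerm-product (a₀ Vec.∷ A₀) (b₀ Vec.∷ B₀) (a Vec.∷ A) (b Vec.∷ B))
      (*-congˡ (boundedKernel y a₀ b₀ a b) (sym (boundedTerm-product A₀ B₀ A B)))))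
    (trans (lem (𝟙 (not a)) (1ℤ - ⟦ Subsetₚ.nonempty? A ⟧) (boundedKernel y a₀ b₀ a b) (boundedTerm A₀ B₀ A B))
      (*-congˡ (emptyKernel y a₀ b₀ a b) (emptyTerm-product A₀ B₀ A B)))
    where
    lem : ∀ a b c d → a * b * (c * d) ≡ a * c * (b * d)
    lem = solve-∀

  -- A coordinate in B₀ but not in A₀ can lie in both sets, in B only, or in neither, with total
  -- weight 1 + y + 1; every other coordinate is forced.
  boundedKernel-total : ∀ {n} (A₀ B₀ : Subset n) → A₀ Subset.⊆ B₀ →
    kernelTotal (Vec.zipWith (boundedKernel y) A₀ B₀) ≡ (y + + 2) ℤ.^ height A₀ B₀
  boundedKernel-total Vec.[] Vec.[] _ = refl
  boundedKernel-total (inside Vec.∷ A₀) (outside Vec.∷ B₀) s = ⊥-elim (inside⊈outside s)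
  boundedKernel-total (inside Vec.∷ A₀) (inside Vec.∷ B₀) s =
    trans (ℤₚ.*-identityˡ _) (boundedKernel-total A₀ B₀ (Subsetₚ.drop-∷-⊆ s))
  boundedKernel-total (outside Vec.∷ A₀) (outside Vec.∷ B₀) s =
    trans (ℤₚ.*-identityˡ _) (boundedKernel-total A₀ B₀ (Subsetₚ.drop-∷-⊆ s))
  boundedKernel-total (outside Vec.∷ A₀) (inside Vec.∷ B₀) s =
    cong₂ _*_ (lem y) (boundedKernel-total A₀ B₀ (Subsetₚ.drop-∷-⊆ s))
    where
    lem : ∀ y → 1ℤ * (1ℤ * (1ℤ * 1ℤ)) + 1ℤ * (0ℤ * (1ℤ * 1ℤ)) + (1ℤ * (1ℤ * (1ℤ * y)) + 1ℤ * (1ℤ * (1ℤ * 1ℤ))) ≡ y + + 2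
    lem = solve-∀

  -- With A empty, only the last two of these possibilities are left, of total weight y + 1.
  emptyKernel-total : ∀ {n} (B₀ : Subset n) →
    kernelTotal (Vec.zipWith (emptyKernel y) Subset.⊥ B₀) ≡ (y + 1ℤ) ℤ.^ ∣ B₀ ∣
  emptyKernel-total Vec.[]               = refl
  emptyKernel-total (outside Vec.∷ B₀) = trans (ℤₚ.*-identityˡ _) (emptyKernel-total B₀)
  emptyKernel-total (inside Vec.∷ B₀)  = cong₂ _*_ (lem y) (emptyKernel-total B₀)
    where
    lem : ∀ y → 0ℤ * (1ℤ * (1ℤ * (1ℤ * 1ℤ))) + 0ℤ * (1ℤ * (0ℤ * (1ℤ * 1ℤ)))
      + (1ℤ * (1ℤ * (1ℤ * (1ℤ * y))) + 1ℤ * (1ℤ * (1ℤ * (1ℤ * 1ℤ)))) ≡ y + 1ℤ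
    lem = solve-∀

height-⊥ : ∀ {n} (B : Subset n) → height Subset.⊥ B ≡ ∣ B ∣
height-⊥ Vec.[]              = refl
height-⊥ (outside Vec.∷ B) = height-⊥ B
height-⊥ (inside Vec.∷ B)  = cong suc (height-⊥ B)

height-+ : ∀ {n} {A B : Subset n} → A Subset.⊆ B → height A B ℕ.+ ∣ A ∣ ≡ ∣ B ∣
height-+ {A = Vec.[]}              {Vec.[]}              s = refl
height-+ {A = outside Vec.∷ A} {outside Vec.∷ B} s = height-+ (Subsetₚ.drop-∷-⊆ s)
height-+ {A = outside Vec.∷ A} {inside Vec.∷ B}  s = cong suc (height-+ (Subsetₚ.drop-∷-⊆ s))
height-+ {A = inside Vec.∷ A}  {outside Vec.∷ B} s = ⊥-elim (inside⊈outside s)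
height-+ {A = inside Vec.∷ A}  {inside Vec.∷ B}  s = trans (ℕₚ.+-suc (height A B) ∣ A ∣) (cong suc (height-+ (Subsetₚ.drop-∷-⊆ s)))

height-strict : ∀ {n} {A₀ A B B₀ : Subset n} → A₀ Subset.⊆ A → A Subset.⊆ B → B Subset.⊆ B₀ →
  (A , B) ≡ (A₀ , B₀) ⊎ height A B ℕ.< height A₀ B₀
height-strict {A₀ = A₀} {A} {B} {B₀} s₁ s₂ s₃ with ∣ A₀ ∣ ℕₚ.≟ ∣ A ∣ | ∣ B ∣ ℕₚ.≟ ∣ B₀ ∣
... | yes e | yes e′ = inj₁ (cong₂ _,_ (sym (⊆-card s₁ e)) (⊆-card s₃ e′))
  where
  ⊆-card : ∀ {n} {A B : Subset n} → A Subset.⊆ B → ∣ A ∣ ≡ ∣ B ∣ → A ≡ B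
  ⊆-card {A = Vec.[]}              {Vec.[]}              s e = refl
  ⊆-card {A = outside Vec.∷ A} {outside Vec.∷ B} s e = cong (outside Vec.∷_) (⊆-card (Subsetₚ.drop-∷-⊆ s) e)
  ⊆-card {A = outside Vec.∷ A} {inside Vec.∷ B}  s e = ⊥-elim (ℕₚ.<⇒≢ (s≤s (Subsetₚ.p⊆q⇒∣p∣≤∣q∣ (Subsetₚ.drop-∷-⊆ {s = outside} {t = inside} s))) e)
  ⊆-card {A = inside Vec.∷ A}  {outside Vec.∷ B} s e = ⊥-elim (inside⊈outside s)
  ⊆-card {A = inside Vec.∷ A}  {inside Vec.∷ B}  s e = cong (inside Vec.∷_) (⊆-card (Subsetₚ.drop-∷-⊆ s) (ℕₚ.suc-injective e))
... | no ≢ | _ = inj₂ (ℕₚ.+-cancelʳ-< ∣ A₀ ∣ _ _ (begin-strict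
  height A B ℕ.+ ∣ A₀ ∣   <⟨ ℕₚ.+-monoʳ-< (height A B) (ℕₚ.≤∧≢⇒< (Subsetₚ.p⊆q⇒∣p∣≤∣q∣ s₁) ≢) ⟩
  height A B ℕ.+ ∣ A ∣    ≡⟨ height-+ s₂ ⟩
  ∣ B ∣                   ≤⟨ Subsetₚ.p⊆q⇒∣p∣≤∣q∣ s₃ ⟩
  ∣ B₀ ∣                  ≡⟨ height-+ (Subsetₚ.⊆-trans s₁ (Subsetₚ.⊆-trans s₂ s₃)) ⟨
  height A₀ B₀ ℕ.+ ∣ A₀ ∣ ∎))
  where open ℕₚ.≤-Reasoning
... | yes _ | no ≢ = inj₂ (ℕₚ.+-cancelʳ-< ∣ A₀ ∣ _ _ (begin-strict
  height A B ℕ.+ ∣ A₀ ∣   ≤⟨ ℕₚ.+-monoʳ-≤ (height A B) (Subsetₚ.p⊆q⇒∣p∣≤∣q∣ s₁) ⟩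
  height A B ℕ.+ ∣ A ∣    ≡⟨ height-+ s₂ ⟩
  ∣ B ∣                   <⟨ ℕₚ.≤∧≢⇒< (Subsetₚ.p⊆q⇒∣p∣≤∣q∣ s₃) ≢ ⟩
  ∣ B₀ ∣                  ≡⟨ height-+ (Subsetₚ.⊆-trans s₁ (Subsetₚ.⊆-trans s₂ s₃)) ⟨
  height A₀ B₀ ℕ.+ ∣ A₀ ∣ ∎))
  where open ℕₚ.≤-Reasoning

shrink : ∀ {n} {A B : Subset n} {k} → A Subset.⊆ B → height A B ≡ suc k →
  ∃[ B′ ] A Subset.⊆ B′ × B′ Subset.⊆ B × height A B′ ≡ k
shrink {A = Vec.[]} {Vec.[]} s ()
shrink {A = outside Vec.∷ A} {inside Vec.∷ B} s refl =
  outside Vec.∷ B , Subsetₚ.s⊆s (Subsetₚ.drop-∷-⊆ s) , Subsetₚ.out⊆ Subsetₚ.⊆-refl , refl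
shrink {A = outside Vec.∷ A} {outside Vec.∷ B} s e with shrink (Subsetₚ.drop-∷-⊆ s) e
... | B′ , s₁ , s₂ , e′ = outside Vec.∷ B′ , Subsetₚ.s⊆s s₁ , Subsetₚ.s⊆s s₂ , e′
shrink {A = inside Vec.∷ A} {outside Vec.∷ B} s e = ⊥-elim (inside⊈outside s)
shrink {A = inside Vec.∷ A} {inside Vec.∷ B} s e with shrink (Subsetₚ.drop-∷-⊆ s) e
... | B′ , s₁ , s₂ , e′ = inside Vec.∷ B′ , Subsetₚ.s⊆s s₁ , Subsetₚ.s⊆s s₂ , e′

-- [A, B], with A the singleton of the first element of B, serves as the top of a longest chain.
singleton-below : ∀ {n} (B : Subset n) {m} → ∣ B ∣ ≡ suc m → ∃[ A ] Nonempty A × A Subset.⊆ B × height A B ≡ m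
singleton-below (inside Vec.∷ B) e = inside Vec.∷ Subset.⊥ , (Fin.zero , Vec.here) , Subsetₚ.s⊆s (Subsetₚ.⊆-min B) ,
  trans (height-⊥ B) (ℕₚ.suc-injective e)
singleton-below (outside Vec.∷ B) e with singleton-below B e
... | A , (i , i∈) , s , e′ = outside Vec.∷ A , (Fin.suc i , Vec.there i∈) , Subsetₚ.s⊆s s , e′

nonempty-card : ∀ {n} {A : Subset n} → Nonempty A → 0 ℕ.< ∣ A ∣
nonempty-card {A = inside Vec.∷ A}  _ = s≤s z≤n
nonempty-card {A = outside Vec.∷ A} (Fin.suc i , Vec.there i∈) = nonempty-card (i , i∈)

∈-allSubsets : ∀ {n} (A : Subset n) → A ∈ allSubsets n
∈-allSubsets = ∈-allVecs λ { inside → here refl ; outside → there (here refl) }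

isInterval? : ∀ {n} → Decidable (λ (I : Interval n) → Nonempty (proj₁ I) × proj₁ I Subset.⊆ proj₂ I)
isInterval? (A , B) = Subsetₚ.nonempty? A ×-dec (A Subsetₚ.⊆? B)

∈-intervals : ∀ {n} {I : Interval n} → Nonempty (proj₁ I) → proj₁ I Subset.⊆ proj₂ I → I ∈ intervals n
∈-intervals {I = A , B} ne s = ∈ₚ.∈-filter⁺ isInterval? (∈ₚ.∈-cartesianProduct⁺ (∈-allSubsets A) (∈-allSubsets B)) (ne , s)

∈-intervals⁻ : ∀ {n} {I : Interval n} → I ∈ intervals n → Nonempty (proj₁ I) × proj₁ I Subset.⊆ proj₂ I
∈-intervals⁻ {n} I∈ = proj₂ (∈ₚ.∈-filter⁻ isInterval? {xs = cartesianProduct (allSubsets n) (allSubsets n)} I∈)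

module _ {n : ℕ} (S : Subset n) where

  within? : Decidable (λ (I : Interval n) → proj₂ I Subset.⊆ S)
  within? I = proj₂ I Subsetₚ.⊆? S

  intervalsIn : List (Interval n)
  intervalsIn = filter within? (intervals n)

  intervalsIn-unique : Unique intervalsIn
  intervalsIn-unique = Uniqueₚ.filter⁺ within? (intervals-unique n)

  ∈-intervalsIn⁻ : ∀ {I} → I ∈ intervalsIn → Nonempty (proj₁ I) × proj₁ I Subset.⊆ proj₂ I × proj₂ I Subset.⊆ S
  ∈-intervalsIn⁻ I∈ with I∈′ , s′ ← ∈ₚ.∈-filter⁻ within? {xs = intervals n} I∈ with ne , s ← ∈-intervals⁻ I∈′ = ne , s , s′

  ∈-intervalsIn : ∀ {I} → Nonempty (proj₁ I) → proj₁ I Subset.⊆ proj₂ I → proj₂ I Subset.⊆ S → I ∈ intervalsIn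
  ∈-intervalsIn ne s s′ = ∈ₚ.∈-filter⁺ within? (∈-intervals ne s) s′

  ∑-intervalsIn : ∀ f → ∑ᶻ intervalsIn f ≡ ∑ᶻ (allSubsets n) (λ A → ∑ᶻ (allSubsets n) (λ B →
    ⟦ isInterval? (A , B) ⟧ * (⟦ B Subsetₚ.⊆? S ⟧ * f (A , B))))
  ∑-intervalsIn f = trans (∑ᶻ-filter within? (intervals n) f)
    (trans (∑ᶻ-filter isInterval? (cartesianProduct (allSubsets n) (allSubsets n)) _)
      (∑ᶻ-cartesianProductWith _,_ (allSubsets n) (allSubsets n) _))

  ×-dec-* : ∀ {P Q : Set} (P? : Dec P) (Q? : Dec Q) → ⟦ P? ×-dec Q? ⟧ ≡ ⟦ P? ⟧ * ⟦ Q? ⟧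
  ×-dec-* P? Q? = 𝟙-∧ (does P?) (does Q?)

  -- For J ≤ I the conditions A ≠ ∅ and B ⊆ S are inherited from I, so all remaining constraints are
  -- coordinatewise. With y = 2m + 1 this is the step to 2m + 3 in the numbers of multichains below
  -- I.
  ∑-intervals-below : ∀ y {I} → I ∈ intervalsIn →
    ∑ᶻ intervalsIn (λ J → ⟦ J ≤ᴵ? I ⟧ * y ℤ.^ height (proj₁ J) (proj₂ J)) ≡ (y + + 2) ℤ.^ height (proj₁ I) (proj₂ I)
  ∑-intervals-below y {A₀ , B₀} I∈ with ∈-intervalsIn⁻ I∈
  ... | (i , i∈) , A₀⊆B₀ , B₀⊆S = trans (∑-intervalsIn _)
    (trans (∑ᶻ-cong (allSubsets n) λ A → ∑ᶻ-cong (allSubsets n) λ B → trans (term A B) (boundedTerm-product y A₀ B₀ A B))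
      (trans (∑-kernelProduct (Vec.zipWith (boundedKernel y) A₀ B₀)) (boundedKernel-total y A₀ B₀ A₀⊆B₀)))
    where
    open ≡-Reasoning
    term : ∀ A B → ⟦ isInterval? (A , B) ⟧ * (⟦ B Subsetₚ.⊆? S ⟧ * (⟦ (A , B) ≤ᴵ? (A₀ , B₀) ⟧ * y ℤ.^ height A B)) ≡
      boundedTerm y A₀ B₀ A B
    term A B = begin
      ⟦ isInterval? (A , B) ⟧ * (⟦ B Subsetₚ.⊆? S ⟧ * (⟦ (A , B) ≤ᴵ? (A₀ , B₀) ⟧ * w))
        ≡⟨ lem ⟦ isInterval? (A , B) ⟧ ⟦ B Subsetₚ.⊆? S ⟧ ⟦ (A , B) ≤ᴵ? (A₀ , B₀) ⟧ w ⟩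
      ⟦ isInterval? (A , B) ⟧ * (⟦ B Subsetₚ.⊆? S ⟧ * ⟦ (A , B) ≤ᴵ? (A₀ , B₀) ⟧) * w
        ≡⟨ cong (λ z → z * w) (trans (*-congˡ ⟦ isInterval? (A , B) ⟧ (sym (×-dec-* (B Subsetₚ.⊆? S) ((A , B) ≤ᴵ? (A₀ , B₀)))))
             (sym (×-dec-* (isInterval? (A , B)) ((B Subsetₚ.⊆? S) ×-dec ((A , B) ≤ᴵ? (A₀ , B₀)))))) ⟩
      ⟦ isInterval? (A , B) ×-dec ((B Subsetₚ.⊆? S) ×-dec ((A , B) ≤ᴵ? (A₀ , B₀))) ⟧ * w
        ≡⟨ cong (λ z → z * w) (⟦⟧-⇔ (isInterval? (A , B) ×-dec ((B Subsetₚ.⊆? S) ×-dec ((A , B) ≤ᴵ? (A₀ , B₀))))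
             ((A₀ Subsetₚ.⊆? A) ×-dec ((A Subsetₚ.⊆? B) ×-dec (B Subsetₚ.⊆? B₀)))
             (λ { ((_ , s) , _ , (s₁ , s₂)) → s₁ , s , s₂ })
             (λ { (s₁ , s , s₂) → ((i , s₁ i∈) , s) , Subsetₚ.⊆-trans s₂ B₀⊆S , (s₁ , s₂) })) ⟩
      ⟦ (A₀ Subsetₚ.⊆? A) ×-dec ((A Subsetₚ.⊆? B) ×-dec (B Subsetₚ.⊆? B₀)) ⟧ * w
        ≡⟨ cong (λ z → z * w) (trans (×-dec-* (A₀ Subsetₚ.⊆? A) ((A Subsetₚ.⊆? B) ×-dec (B Subsetₚ.⊆? B₀)))
             (*-congˡ ⟦ A₀ Subsetₚ.⊆? A ⟧ (×-dec-* (A Subsetₚ.⊆? B) (B Subsetₚ.⊆? B₀)))) ⟩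
      ⟦ A₀ Subsetₚ.⊆? A ⟧ * (⟦ A Subsetₚ.⊆? B ⟧ * ⟦ B Subsetₚ.⊆? B₀ ⟧) * w
        ≡⟨ lem ⟦ A₀ Subsetₚ.⊆? A ⟧ ⟦ A Subsetₚ.⊆? B ⟧ ⟦ B Subsetₚ.⊆? B₀ ⟧ w ⟨
      boundedTerm y A₀ B₀ A B ∎
      where
      w = y ℤ.^ height A B
      lem : ∀ a b c d → a * (b * (c * d)) ≡ a * (b * c) * d
      lem = solve-∀

  -- All pairs A ⊆ B ⊆ S minus those with A = ∅.
  ∑-intervalsIn-total : ∀ y → ∑ᶻ intervalsIn (λ J → y ℤ.^ height (proj₁ J) (proj₂ J)) ≡ (y + + 2) ℤ.^ ∣ S ∣ - (y + 1ℤ) ℤ.^ ∣ S ∣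
  ∑-intervalsIn-total y = begin
    ∑ᶻ intervalsIn (λ J → y ℤ.^ height (proj₁ J) (proj₂ J))
      ≡⟨ ∑-intervalsIn (λ J → y ℤ.^ height (proj₁ J) (proj₂ J)) ⟩
    ∑ᶻ (allSubsets n) (λ A → ∑ᶻ (allSubsets n) (λ B → ⟦ isInterval? (A , B) ⟧ * (⟦ B Subsetₚ.⊆? S ⟧ * y ℤ.^ height A B)))
      ≡⟨ ∑ᶻ-cong (allSubsets n) (λ A → trans (∑ᶻ-cong (allSubsets n) (term A)) (∑ᶻ-+ (allSubsets n) (kernelProduct κs A) _)) ⟩
    ∑ᶻ (allSubsets n) (λ A → ∑ᶻ (allSubsets n) (kernelProduct κs A) + ∑ᶻ (allSubsets n) (λ B → -1ℤ * kernelProduct εs A B))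
      ≡⟨ trans (∑ᶻ-+ (allSubsets n) (λ A → ∑ᶻ (allSubsets n) (kernelProduct κs A)) _)
           (+-congˡ (∑ᶻ (allSubsets n) (λ A → ∑ᶻ (allSubsets n) (kernelProduct κs A)))
             (trans (∑ᶻ-cong (allSubsets n) λ A → ∑ᶻ-* (allSubsets n) -1ℤ (kernelProduct εs A))
               (∑ᶻ-* (allSubsets n) -1ℤ (λ A → ∑ᶻ (allSubsets n) (kernelProduct εs A))))) ⟩
    ∑ᶻ (allSubsets n) (λ A → ∑ᶻ (allSubsets n) (kernelProduct κs A)) +
    -1ℤ * ∑ᶻ (allSubsets n) (λ A → ∑ᶻ (allSubsets n) (kernelProduct εs A))
      ≡⟨ cong₂ (λ a b → a + -1ℤ * b)
           (trans (∑-kernelProduct κs) (trans (boundedKernel-total y Subset.⊥ S (Subsetₚ.⊆-min S)) (cong (λ k → (y + + 2) ℤ.^ k) (height-⊥ S))))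
           (trans (∑-kernelProduct εs) (emptyKernel-total y S)) ⟩
    (y + + 2) ℤ.^ ∣ S ∣ + -1ℤ * (y + 1ℤ) ℤ.^ ∣ S ∣
      ≡⟨ +-congˡ ((y + + 2) ℤ.^ ∣ S ∣) (ℤₚ.-1*i≡-i ((y + 1ℤ) ℤ.^ ∣ S ∣)) ⟩
    (y + + 2) ℤ.^ ∣ S ∣ - (y + 1ℤ) ℤ.^ ∣ S ∣ ∎
    where
    open ≡-Reasoning
    κs εs : Vec Kernel n
    κs = Vec.zipWith (boundedKernel y) Subset.⊥ S
    εs = Vec.zipWith (emptyKernel y) Subset.⊥ S
    term : ∀ A B → ⟦ isInterval? (A , B) ⟧ * (⟦ B Subsetₚ.⊆? S ⟧ * y ℤ.^ height A B) ≡
      kernelProduct κs A B + -1ℤ * kernelProduct εs A B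
    term A B = trans (cong (λ z → z * (⟦ B Subsetₚ.⊆? S ⟧ * w)) (×-dec-* (Subsetₚ.nonempty? A) (A Subsetₚ.⊆? B)))
      (trans (lem ⟦ Subsetₚ.nonempty? A ⟧ ⟦ A Subsetₚ.⊆? B ⟧ ⟦ B Subsetₚ.⊆? S ⟧ w)
        (trans (cong (λ z → z * (⟦ A Subsetₚ.⊆? B ⟧ * (⟦ B Subsetₚ.⊆? S ⟧ * w)) + -1ℤ * ((1ℤ - ⟦ Subsetₚ.nonempty? A ⟧) * (z * (⟦ A Subsetₚ.⊆? B ⟧ * (⟦ B Subsetₚ.⊆? S ⟧ * w)))))
                 (sym (⟦⟧-yes (Subset.⊥ Subsetₚ.⊆? A) (Subsetₚ.⊆-min A))))
          (cong₂ (λ a b → a + -1ℤ * b) (boundedTerm-product y Subset.⊥ S A B) (emptyTerm-product y Subset.⊥ S A B))))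
      where
      w = y ℤ.^ height A B
      lem : ∀ e a b w → e * a * (b * w) ≡ 1ℤ * (a * (b * w)) + -1ℤ * ((1ℤ - e) * (1ℤ * (a * (b * w))))
      lem = solve-∀

-- The subdivision K_n

foldr-⊔-≡ : ∀ {m} (xs : List ℕ) → (∀ {x} → x ∈ xs → x ≤ m) → m ∈ xs → foldr _⊔_ 0 xs ≡ m
foldr-⊔-≡ {m} xs bound m∈ = ℕₚ.≤-antisym (upper xs bound) (lower m∈)
  where
  upper : ∀ xs → (∀ {x} → x ∈ xs → x ≤ m) → foldr _⊔_ 0 xs ≤ m
  upper []       b = z≤n
  upper (x ∷ xs) b = ℕₚ.⊔-lub (b (here refl)) (upper xs (b ∘ there))
  lower : ∀ {xs} → m ∈ xs → m ≤ foldr _⊔_ 0 xs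
  lower {x ∷ xs} (here refl) = ℕₚ.m≤m⊔n m (foldr _⊔_ 0 xs)
  lower {x ∷ xs} (there m∈)  = ℕₚ.≤-trans (lower m∈) (ℕₚ.m≤n⊔m x (foldr _⊔_ 0 xs))

module _ {A : Set} {P : Pred A 0ℓ} (P? : Decidable P) where

  ∈-sublists-filter⁺ : ∀ {c} xs → c ∈ sublists xs → All P c → c ∈ sublists (filter P? xs)
  ∈-sublists-filter⁺ []       (here refl) _ = here refl
  ∈-sublists-filter⁺ (x ∷ xs) c∈ all with ∈ₚ.∈-++⁻ (map (x ∷_) (sublists xs)) c∈
  ∈-sublists-filter⁺ (x ∷ xs) c∈ all | inj₁ c∈′ with ∈ₚ.∈-map⁻ (x ∷_) c∈′
  ∈-sublists-filter⁺ (x ∷ xs) c∈ (px ∷ all) | inj₁ c∈′ | c′ , c′∈ , refl =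
    subst (λ zs → x ∷ c′ ∈ sublists zs) (sym (Listₚ.filter-accept P? px))
      (∈ₚ.∈-++⁺ˡ (∈ₚ.∈-map⁺ (x ∷_) (∈-sublists-filter⁺ xs c′∈ all)))
  ∈-sublists-filter⁺ (x ∷ xs) c∈ all | inj₂ c∈′ with does (P? x)
  ... | true  = ∈ₚ.∈-++⁺ʳ (map (x ∷_) (sublists (filter P? xs))) (∈-sublists-filter⁺ xs c∈′ all)
  ... | false = ∈-sublists-filter⁺ xs c∈′ all

  ∈-sublists-filter⁻ : ∀ {c} xs → c ∈ sublists (filter P? xs) → c ∈ sublists xs
  ∈-sublists-filter⁻ []       c∈ = c∈
  ∈-sublists-filter⁻ (x ∷ xs) c∈ with does (P? x)
  ... | false = ∈ₚ.∈-++⁺ʳ (map (x ∷_) (sublists xs)) (∈-sublists-filter⁻ xs c∈)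
  ... | true with ∈ₚ.∈-++⁻ (map (x ∷_) (sublists (filter P? xs))) c∈
  ...   | inj₂ c∈′ = ∈ₚ.∈-++⁺ʳ (map (x ∷_) (sublists xs)) (∈-sublists-filter⁻ xs c∈′)
  ...   | inj₁ c∈′ with ∈ₚ.∈-map⁻ (x ∷_) c∈′
  ...     | c′ , c′∈ , refl = ∈ₚ.∈-++⁺ˡ (∈ₚ.∈-map⁺ (x ∷_) (∈-sublists-filter⁻ xs c′∈))

carrierᴷ-singleton : ∀ {n} (I : Interval n) → carrierᴷ (I ∷ []) ≡ proj₂ I
carrierᴷ-singleton I = cong (λ c → maybe′ proj₂ Subset.⊥ (head c))
  (Listₚ.filter-accept (λ J → All.all? (_≤ᴵ? J) (I ∷ [])) {x = I} {xs = []} (≤ᴵ-refl {x = I} ∷ []))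

module _ {n : ℕ} (S : Subset n) where
  open CarriedComplex (K n) using (restrict; carrier-mono)
  open SimplicialComplex (restrict S) using (Face; face?; faces; rank; h)

  private
    po = ≤ᴵ-isDecPartialOrder {n}

  Within-S : Pred (Interval n) 0ℓ
  Within-S I = proj₂ I Subset.⊆ S

  carrierᴷ-within : ∀ {c} → All Within-S c → carrierᴷ c Subset.⊆ S
  carrierᴷ-within {c} all = head-within (filter (λ I → All.all? (_≤ᴵ? I) c) c)
    (λ I∈ → All.lookup all (proj₁ (∈ₚ.∈-filter⁻ (λ I → All.all? (_≤ᴵ? I) c) {xs = c} I∈)))
    where
    head-within : ∀ xs → (∀ {I} → I ∈ xs → Within-S I) → maybe′ proj₂ Subset.⊥ (head xs) Subset.⊆ S
    head-within []       _ = Subsetₚ.⊆-min S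
    head-within (x ∷ xs) w = w (here refl)

  -- The carrier of a single vertex is the upper end of that interval, so monotonicity of the
  -- carrier bounds every upper end by S.
  face⇒within : ∀ {c} → Face c → All Within-S c
  face⇒within {c} (ch , s) = All.tabulate λ {I} I∈ → subst (Subset._⊆ S) (carrierᴷ-singleton I)
    (Subsetₚ.⊆-trans (carrier-mono (Sublist.from∈ I∈) ch) s)

  ∑-faces : ∀ f → ∑ᶻ faces (f ∘ length) ≡ chainSum po f (intervalsIn S)
  ∑-faces f = begin
    ∑ᶻ faces (f ∘ length)
      ≡⟨ ∑ᶻ-filter face? (sublists (intervals n)) (f ∘ length) ⟩
    ∑ᶻ (sublists (intervals n)) (λ c → ⟦ face? c ⟧ * f (length c))
      ≡⟨ ∑ᶻ-cong (sublists (intervals n)) (λ c → trans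
           (cong (λ z → z * f (length c)) (trans
             (⟦⟧-⇔ (face? c) (All.all? (within? S) c ×-dec chain? po c)
               (λ face → face⇒within face , proj₁ face) (λ (all , ch) → ch , carrierᴷ-within all))
             (𝟙-∧ (does (All.all? (within? S) c)) (does (chain? po c)))))
           (ℤₚ.*-assoc ⟦ All.all? (within? S) c ⟧ ⟦ chain? po c ⟧ (f (length c)))) ⟩
    ∑ᶻ (sublists (intervals n)) (λ c → ⟦ All.all? (within? S) c ⟧ * (⟦ chain? po c ⟧ * f (length c)))
      ≡⟨ ∑ᶻ-sublists-filter (within? S) (intervals n) (λ c → ⟦ chain? po c ⟧ * f (length c)) ⟩
    chainSum po f (intervalsIn S) ∎
    where open ≡-Reasoning

  private
    r : Interval n → ℕ
    r I = height (proj₁ I) (proj₂ I)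

    r-bound : ∀ {I} → I ∈ intervalsIn S → r I ℕ.< ∣ S ∣
    r-bound {A , B} I∈ with ne , A⊆B , B⊆S ← ∈-intervalsIn⁻ S I∈ = begin-strict
      height A B             ≡⟨ ℕₚ.+-identityʳ (height A B) ⟨
      height A B ℕ.+ 0       <⟨ ℕₚ.+-monoʳ-< (height A B) (nonempty-card ne) ⟩
      height A B ℕ.+ ∣ A ∣   ≡⟨ height-+ A⊆B ⟩
      ∣ B ∣                  ≤⟨ Subsetₚ.p⊆q⇒∣p∣≤∣q∣ B⊆S ⟩
      ∣ S ∣                  ∎
      where open ℕₚ.≤-Reasoning

    r-strict : ∀ {I J} → I ∈ intervalsIn S → J ∈ intervalsIn S → _≺_ po J I → r J ℕ.< r I
    r-strict I∈ J∈ ((A₀⊆A , B⊆B₀) , J≢I) with height-strict A₀⊆A (proj₁ (proj₂ (∈-intervalsIn⁻ S J∈))) B⊆B₀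
    ... | inj₁ J≡I = ⊥-elim (J≢I J≡I)
    ... | inj₂ lt  = lt

    r-cover : ∀ {I k} → I ∈ intervalsIn S → r I ≡ suc k → ∃[ J ] J ∈ intervalsIn S × _≺_ po J I × r J ≡ k
    r-cover {A , B} {k} I∈ e with ne , A⊆B , B⊆S ← ∈-intervalsIn⁻ S I∈ with B′ , A⊆B′ , B′⊆B , e′ ← shrink A⊆B e =
      (A , B′) , ∈-intervalsIn S ne A⊆B′ (Subsetₚ.⊆-trans B′⊆B B⊆S) ,
      ((Subsetₚ.⊆-refl , B′⊆B) , λ J≡I → ℕₚ.1+n≢n (trans (sym e) (trans (cong r (sym J≡I)) e′))) , e′

  face-length : ∀ {c} → c ∈ faces → length c ≤ ∣ S ∣
  face-length {c} c∈ with c∈′ , face ← ∈ₚ.∈-filter⁻ face? {xs = sublists (intervals n)} c∈ =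
    chain-length po (intervalsIn-unique S) r r-strict r-bound
      (∈-sublists-filter⁺ (within? S) (intervals n) c∈′ (face⇒within face)) (proj₁ face)

  full-face : ∃[ c ] c ∈ faces × length c ≡ ∣ S ∣
  full-face with chain-exists po ∣ S ∣ (intervalsIn S) (positive ∣ S ∣ refl)
    where
    positive : ∀ m → ∣ S ∣ ≡ m → 1ℤ ℤ.≤ chainSum po (δ m) (intervalsIn S)
    positive zero    _ = ℤₚ.≤-reflexive (sym (chainCount-zero po (intervalsIn-unique S)))
    positive (suc m) e with A , ne , A⊆S , e′ ← singleton-below S e =
      chainCount-suc po m (intervalsIn-unique S) I∈
        (chainCount-below po (intervalsIn-unique S) r r-cover m I∈ e′)
      where I∈ = ∈-intervalsIn S ne A⊆S Subsetₚ.⊆-refl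
  ... | c , c∈ , ch , e = c , ∈ₚ.∈-filter⁺ face? (∈-sublists-filter⁻ (within? S) (intervals n) c∈)
    (ch , carrierᴷ-within (All.tabulate λ I∈ → proj₂ (∈ₚ.∈-filter⁻ (within? S) {xs = intervals n}
      (Sublist.lookup (∈-sublists (intervalsIn S) c∈) I∈)))) , e

  -- The exponent in h is read off from the faces and has to be identified: the intervals of a chain
  -- have distinct ranks below |S|, and `full-face` attains the bound.
  rank≡ : rank ≡ ∣ S ∣
  rank≡ = foldr-⊔-≡ (map length faces)
    (λ x∈ → let c , c∈ , e = ∈ₚ.∈-map⁻ length x∈ in subst (_≤ ∣ S ∣) (sym e) (face-length c∈))
    (let c , c∈ , e = full-face in subst (_∈ map length faces) e (∈ₚ.∈-map⁺ length c∈))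

  -- The guess for `w` is (2m + 1) to the rank of I, for the multichains of m intervals weakly below
  -- I; summing over I, as the last entry, gives the multichains with m + 1 entries.
  multichains≡u : ∀ m → multichains po m (intervalsIn S) ≡ u ∣ S ∣ m
  multichains≡u zero    = trans (multichains-zero po (intervalsIn-unique S)) (sym (u-zero ∣ S ∣))
  multichains≡u (suc m) = trans
    (multichains-total po (intervalsIn-unique S) (λ I m → odd m ℤ.^ r I) (λ I → ℤₚ.^-zeroˡ (r I))
      (λ {I} I∈ m → trans (∑-intervals-below S (odd m) I∈) (cong (λ y → y ℤ.^ r I) (odd-suc (+ m)))) m)
    (trans (∑-intervalsIn-total S (odd m)) (sym (u-suc ∣ S ∣ m)))
    where
    odd-suc : ∀ m → 1ℤ + + 2 * m + + 2 ≡ 1ℤ + + 2 * (1ℤ + m)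
    odd-suc = solve-∀

  coeff-h : ∀ k → coeff h k ≡ b⁺ (∣ S ∣) k
  coeff-h k = begin
    coeff h k
      ≡⟨ coeff-∑ faces (λ c → (X^ length c) ⊗ 1-X ^ₚ (rank ∸ length c)) k ⟩
    ∑ᶻ faces (λ c → coeff ((X^ length c) ⊗ 1-X ^ₚ (rank ∸ length c)) k)
      ≡⟨ ∑ᶻ-cong-∈ faces (λ {c} c∈ → trans (cong (λ m → coeff ((X^ length c) ⊗ 1-X ^ₚ (m ∸ length c)) k) rank≡)
           (coeff-X^⊗1-X^ (face-length c∈) k)) ⟩
    ∑ᶻ faces (λ c → Δ^ (∣ S ∣) (t (length c)) k)
      ≡⟨ Δ^-∑ᶻ (∣ S ∣) faces (t ∘ length) k ⟨
    Δ^ (∣ S ∣) (λ m → ∑ᶻ faces (λ c → t (length c) m)) k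
      ≡⟨ Δ^-cong (∣ S ∣) (λ m → trans (∑-faces (λ j → t j m)) (multichains≡u m)) k ⟩
    Δ^ (∣ S ∣) (u (∣ S ∣)) k
      ≡⟨ b⁺-series (∣ S ∣) k ⟨
    b⁺ (∣ S ∣) k ∎
    where open ≡-Reasoning

-- Splitting by membership of the first element is the defining recursion of `β`, which spares
-- counting subsets by size.
∑-subsets : ∀ n G → ∑ᶻ (allSubsets n) (λ S → -1ℤ ℤ.^ (n ∸ ∣ S ∣) * G ∣ S ∣) ≡ β n G
∑-subsets zero    G = trans (ℤₚ.+-identityʳ (1ℤ * G 0)) (ℤₚ.*-identityˡ (G 0))
∑-subsets (suc n) G = trans (∑-allSubsets-suc n _) (cong₂ _+_ (∑-subsets n (G ∘ suc))
  (trans (∑ᶻ-cong (allSubsets n) λ S → trans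
           (cong (λ m → -1ℤ ℤ.^ m * G ∣ S ∣) (ℕₚ.+-∸-assoc 1 (Subsetₚ.∣p∣≤n S)))
           (ℤₚ.*-assoc -1ℤ (-1ℤ ℤ.^ (n ∸ ∣ S ∣)) (G ∣ S ∣)))
    (trans (∑ᶻ-* (allSubsets n) -1ℤ (λ S → -1ℤ ℤ.^ (n ∸ ∣ S ∣) * G ∣ S ∣))
      (trans (*-congˡ -1ℤ (∑-subsets n G)) (ℤₚ.-1*i≡-i (β n G))))))

coeff-localh : ∀ n k → coeff (CarriedComplex.localh (K n)) k ≡ β⁺ n k
coeff-localh n k = trans (coeff-∑ (allSubsets n) (λ S → (-1ℤ ℤ.^ (n ∸ ∣ S ∣)) · SimplicialComplex.h (CarriedComplex.restrict (K n) S)) k)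
  (trans (∑ᶻ-cong (allSubsets n) λ S → trans (coeff-· (-1ℤ ℤ.^ (n ∸ ∣ S ∣)) (SimplicialComplex.h (CarriedComplex.restrict (K n) S)) k)
           (*-congˡ (-1ℤ ℤ.^ (n ∸ ∣ S ∣)) (coeff-h S k)))
    (∑-subsets n (λ j → b⁺ j k)))

-- The symmetric decomposition and the theorem

coeffᶻ-ext : ∀ r {a} → (∀ k → coeff r k ≡ a k) → ∀ z → coeffᶻ r z ≡ ext a z
coeffᶻ-ext r e (+ i)    = e i
coeffᶻ-ext r e -[1+ i ] = refl

symmetric : ∀ n r {a} → (∀ k → coeff r k ≡ a k) → (∀ z → ext a z ≡ ext a (+ n - z)) → Symmetric n r
symmetric n r e s z = trans (coeffᶻ-ext r e z) (trans (s z) (sym (coeffᶻ-ext r e (+ n - z))))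

dB-symmetricDecomposition : ∀ n → IsSymmetricDecomposition n (dB n) (binomialTransform B⁺ n) (binomialTransform B⁻ n)
dB-symmetricDecomposition n =
    (λ k → trans (coeff-dB≡β± n k) (sym (trans (coeff-⊕ (binomialTransform B⁺ n) (binomialTransform B⁻ n) k)
             (cong₂ _+_ (coeff-binomialTransform B⁺ n k) (coeff-binomialTransform B⁻ n k)))))
  , symmetric n (binomialTransform B⁺ n) (coeff-binomialTransform B⁺ n) (β⁺-symmetric n)
  , symmetric (suc n) (binomialTransform B⁻ n) (coeff-binomialTransform B⁻ n) (β⁻-symmetric n)

f±-binomialTransform : ∀ n → binomialTransform B⁺ n ≈ f⁺ n × binomialTransform B⁻ n ≈ f⁻ n
f±-binomialTransform n = proj₂ (proj₂ (proj₂ (dB-decomposition n)))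
  (binomialTransform B⁺ n) (binomialTransform B⁻ n) (dB-symmetricDecomposition n)

coeff-f⁺ : ∀ n k → coeff (f⁺ n) k ≡ β⁺ n k
coeff-f⁺ n k = trans (sym (proj₁ (f±-binomialTransform n) k)) (coeff-binomialTransform B⁺ n k)

theorem1p3 : (∀ (n : ℕ) → 1 ≤ n →
    f⁺ n ≈ CarriedComplex.localh (K n)
    × Nonneg (f⁺ n) × Symmetric n (f⁺ n) × Unimodal (f⁺ n))
    × (∀ (n : ℕ) →
    f⁺ n ≈ binomialTransform B⁺ n
    × f⁻ n ≈ binomialTransform B⁻ n)
theorem1p3 =
    (λ n _ →
        (λ k → trans (coeff-f⁺ n k) (sym (coeff-localh n k)))
      , (λ k → subst (0ℤ ℤ.≤_) (sym (coeff-f⁺ n k)) (β⁺-nonneg n k))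
      , proj₁ (proj₂ (proj₁ (proj₂ (proj₂ (dB-decomposition n)))))
      -- The peak is at the centre of symmetry; for odd n the next coefficient has the same value.
      , ℕ.⌊ n /2⌋
      , (λ i h → subst₂ ℤ._≤_ (sym (coeff-f⁺ n i)) (sym (coeff-f⁺ n (suc i))) (β⁺-increasing n i h))
      , (λ i h → subst₂ ℤ._≤_ (sym (coeff-f⁺ n (suc i))) (sym (coeff-f⁺ n i)) (β⁺-decreasing n i h)))
  , (λ n → (λ k → sym (proj₁ (f±-binomialTransform n) k)) , (λ k → sym (proj₂ (f±-binomialTransform n) k)))
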